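{- Let $G$ be a finite simple graph and $\theta$ a real number. Let $Q_1,\dots,Q_m$ be all the connected components $Q$ of $G\setminus A_\theta(G)$ with $\textnormal{mult}(\theta,Q)=0$. Then for distinct $u,v\in V(G)$, $uv\in E(D_{1,\theta}(S_\theta(G)))$ if and only if (a) one of $u,v$ lies in $A_\theta(G)$ and the other in $N_\theta(G)$, or (b) one of $u,v$ lies in $P_\theta(G)$ and the other in $N_\theta(G)$, and $u\in V(Q_{j_1})$, $v\in V(Q_{j_2})$ for some $j_1\neq j_2$, or (c) $uv\in E(D_{1,\theta}(Q_{j_0}))$ for some $j_0$.
   Context: $\mu(G,x)=\sum_{r\ge 0}(-1)^r p(G,r)x^{|V(G)|-2r}$ is the matching polynomial ($p(G,r)$ = number of $r$-matchings, $p(G,0)=1$, empty graph has $\mu=1$); $\textnormal{mult}(\theta,G)$ is the multiplicity of $\theta$ as a root of $\mu(G,x)$ ($0$ if not a root). $G\setminus X$, $G\setminus uv$ denote vertex deletion. A vertex $u$ is $\theta$-essential if $\textnormal{mult}(\theta,G\setminus u)=\textnormal{mult}(\theta,G)-1$, $\theta$-neutral if $\textnormal{mult}(\theta,G\setminus u)=\textnormal{mult}(\theta,G)$, $\theta$-positive if $\textnormal{mult}(\theta,G\setminus u)=\textnormal{mult}(\theta,G)+1$, and $\theta$-special if it is not $\theta$-essential but adjacent to a $\theta$-essential vertex. $N_\theta(G)$, $A_\theta(G)$ are the sets of $\theta$-neutral and $\theta$-special vertices, and $P_\theta(G)$ is the set of $\theta$-positive vertices that are not $\theta$-special. $S_\theta(G)$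 is the graph on $V(G)$ in which distinct $w,z$ are adjacent iff $wz\in E(G)$ or one of $w,z$ is in $A_\theta(G)$. For a graph $F$ and $r\in\{ -2,-1,0,1,2\}$, $D_{r,\theta}(F)$ is the graph on $V(F)$ in which distinct $u,v$ are adjacent iff $\textnormal{mult}(\theta,F\setminus uv)=\textnormal{mult}(\theta,F)+r$. -}

module Defs where

open import Data.Bool using (Bool; true; false; _∧_; _∨_; not; if_then_else_)
open import Data.Nat using (ℕ; zero; suc; _∸_; _≡ᵇ_; _<ᵇ_; _%_; _/_)
open import Data.Fin using (Fin; toℕ) renaming (_≟_ to _≟ᶠ_)
open import Data.List using (List; []; _∷_; _++_; map; concatMap; length; upTo; filterᵇ; allFin)
open import Data.Bool.ListAction using (any; all)
open import Data.Product using (_×_; _,_; ∃; proj₁; proj₂)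
open import Data.Sum using (_⊎_)
open import Relation.Nullary using (¬_; does)
open import Relation.Binary.PropositionalEquality using (_≡_)
open import Relation.Binary.Definitions using (DecidableEquality)

-- The real numbers, axiomatised as a complete ordered field
-- (any model is isomorphic to ℝ).  Equality on ℝ is (classically)
-- decidable; we include this as a field so that multiplicities can be
-- computed.

record RealField : Set₁ where
  infixl 6 _+_
  infixl 7 _*_
  infix 4 _<_
  field
    R : Set
    0# 1# : R
    _+_ _*_ : R → R → R
    -_ : R → R
    _<_ : R → R → Set
    _≟_ : DecidableEquality R
    +-assoc : ∀ x y z → (x + y) + z ≡ x + (y + z)
    +-comm : ∀ x y → x + y ≡ y + x
    +-identityˡ : ∀ x → 0# + x ≡ x
    -‿inverseˡ : ∀ x → (- x) + x ≡ 0#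
    *-assoc : ∀ x y z → (x * y) * z ≡ x * (y * z)
    *-comm : ∀ x y → x * y ≡ y * x
    *-identityˡ : ∀ x → 1# * x ≡ x
    distribʳ : ∀ x y z → (x + y) * z ≡ x * z + y * z
    0≢1 : ¬ (0# ≡ 1#)
    *-inverse : ∀ x → ¬ (x ≡ 0#) → ∃ λ y → y * x ≡ 1#
    <-irrefl : ∀ x → ¬ (x < x)
    <-trans : ∀ x y z → x < y → y < z → x < z
    <-trichotomy : ∀ x y → x < y ⊎ (x ≡ y ⊎ y < x)
    +-mono-< : ∀ x y z → x < y → x + z < y + z
    *-pos : ∀ x y → 0# < x → 0# < y → 0# < x * y
    lub : (P : R → Set) → ∃ P → (∃ λ b → ∀ x → P x → x < b ⊎ x ≡ b) →
          ∃ λ s → (∀ x → P x → x < s ⊎ x ≡ s) ×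
                  (∀ b → (∀ x → P x → x < b ⊎ x ≡ b) → s < b ⊎ s ≡ b)

-- Graphs: a finite simple graph on vertex type Fin n is given by a
-- Boolean adjacency function (symmetry/irreflexivity are hypotheses of
-- the theorem).  Subgraphs induced on a vertex subset are represented by
-- the ambient adjacency together with a vertex mask.

Adj : ℕ → Set
Adj n = Fin n → Fin n → Bool

Mask : ℕ → Set
Mask n = Fin n → Bool

module _ {n : ℕ} where

  full : Mask n
  full _ = true

  eqᶠ : Fin n → Fin n → Bool
  eqᶠ i j = does (i ≟ᶠ j)

  del : Mask n → Fin n → Mask n
  del S u i = S i ∧ not (eqᶠ i u)

  size : Mask n → ℕ
  size S = length (filterᵇ S (allFin n))

  edges : Adj n → Mask n → List (Fin n × Fin n)
  edges adj S = concatMap (λ i → concatMap (λ j →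
      if S i ∧ S j ∧ adj i j ∧ (toℕ i <ᵇ toℕ j) then (i , j) ∷ [] else [])
      (allFin n)) (allFin n)

  sublists : {A : Set} → List A → List (List A)
  sublists [] = [] ∷ []
  sublists (x ∷ xs) = sublists xs ++ map (x ∷_) (sublists xs)

  disjointE : Fin n × Fin n → Fin n × Fin n → Bool
  disjointE (a , b) (c , d) =
    not (eqᶠ a c ∨ eqᶠ a d ∨ eqᶠ b c ∨ eqᶠ b d)

  isMatching : List (Fin n × Fin n) → Bool
  isMatching [] = true
  isMatching (e ∷ M) = all (disjointE e) M ∧ isMatching M

  pMatch : Adj n → Mask n → ℕ → ℕ
  pMatch adj S r =
    length (filterᵇ (λ M → (length M ≡ᵇ r) ∧ isMatching M) (sublists (edges adj S)))

module _ (F : RealField) where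
  open RealField F

  fromℕ : ℕ → R
  fromℕ zero = 0#
  fromℕ (suc k) = 1# + fromℕ k

  -- coefficient list (lowest degree first) of
  -- μ(G,x) = Σ_r (-1)^r p(G,r) x^{|V|-2r}
  μcoeffs : {n : ℕ} → Adj n → Mask n → List R
  μcoeffs adj S = map coeff (upTo (suc (size S)))
    where
      coeff : ℕ → R
      coeff d with size S ∸ d
      ... | k = if (k % 2 ≡ᵇ 0)
                  then (if ((k / 2) % 2 ≡ᵇ 0)
                          then fromℕ (pMatch adj S (k / 2))
                          else - fromℕ (pMatch adj S (k / 2)))
                  else 0#

  module _ (θ : R) where

    -- synthetic division by (x - θ): quotient and remainder
    divX : List R → List R × R
    divX [] = [] , 0#
    divX (a ∷ p) with divX p
    ... | q , r = (r ∷ q) , (a + θ * r)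

    -- multiplicity of θ as a root: number of times (x - θ) divides p
    -- (fuel = length p, which exceeds the degree of a nonzero p)
    multP : ℕ → List R → ℕ
    multP zero _ = 0
    multP (suc f) p with divX p
    ... | q , r = if does (r ≟ 0#) then suc (multP f q) else 0

    mult : {n : ℕ} → Adj n → Mask n → ℕ
    mult adj S = multP (length (μcoeffs adj S)) (μcoeffs adj S)

    module _ {n : ℕ} (adj : Adj n) where

      essentialᵇ : Mask n → Fin n → Bool
      essentialᵇ S u = S u ∧ (suc (mult adj (del S u)) ≡ᵇ mult adj S)

      neutralᵇ : Mask n → Fin n → Bool
      neutralᵇ S u = S u ∧ (mult adj (del S u) ≡ᵇ mult adj S)

      positiveᵇ : Mask n → Fin n → Bool
      positiveᵇ S u = S u ∧ (mult adj (del S u) ≡ᵇ suc (mult adj S))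

      specialᵇ : Mask n → Fin n → Bool
      specialᵇ S u = S u ∧ not (essentialᵇ S u) ∧
        any (λ v → S v ∧ adj u v ∧ essentialᵇ S v) (allFin n)

      Aθ : Mask n
      Aθ = specialᵇ full

      Nθ : Mask n
      Nθ = neutralᵇ full

      Pθ : Mask n
      Pθ u = positiveᵇ full u ∧ not (specialᵇ full u)

      Sθ : Adj n
      Sθ w z = not (eqᶠ w z) ∧ (adj w z ∨ Aθ w ∨ Aθ z)

      GminusA : Mask n
      GminusA w = not (Aθ w)

    D1 : {n : ℕ} → Adj n → Mask n → Fin n → Fin n → Bool
    D1 adj S u v = S u ∧ S v ∧ not (eqᶠ u v) ∧
      (mult adj (del (del S u) v) ≡ᵇ suc (mult adj S))

module _ {n : ℕ} where

  step : Adj n → Mask n → Mask n → Mask n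
  step adj T Rm w = Rm w ∨ (T w ∧ any (λ x → Rm x ∧ adj x w) (allFin n))

  iter : ℕ → (Mask n → Mask n) → Mask n → Mask n
  iter zero f m = m
  iter (suc k) f m = f (iter k f m)

  -- vertex set of the connected component of (adj, T) containing u ∈ T
  -- (vertices reachable from u by a path inside T; n rounds suffice)
  component : Adj n → Mask n → Fin n → Mask n
  component adj T u = iter n (step adj T) (λ w → T u ∧ eqᶠ w u)

{-# OPTIONS --safe #-}
-- Everything is read off Taylor expansions at θ.  Expanding μ at a vertex shows by induction that
-- μ(G)/μ(G∖u) is locally increasing at θ, which gives interlacing and, since residues then have one
-- sign, that u is positive iff some neighbour of u is essential in G∖u.  The series
-- μ(G∖u)μ(G∖v) - μ(G)μ(G∖uv) is a sum of squares, even after perturbing the variable of one further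
-- vertex; comparing leading coefficients for all perturbations shows that "dependence" of essential
-- vertices is transitive (as parallelism in a matroid) and that mult(θ,G) > 0 forces an essential
-- vertex.  Transitivity yields the stability lemma: deleting a special vertex a raises the
-- multiplicity of every G∖b by one.  Hence, with A = A_θ(G), mult(θ,G∖A) = mult(θ,G) + |A|, statuses
-- survive in G∖A, and the components of multiplicity zero are those without essential vertices.
-- In S_θ(G) a vertex of A is adjacent to everything, so adding it back lowers a non-zero multiplicity
-- by exactly one; this reduces mult(θ,S_θ(G)∖uv) to G∖A, where multiplicities add over components.
module Submission where

open import Defs
open import Algebra.Bundles using (CommutativeRing)
import Algebra.Properties.Ring as RingProperties
import Algebra.Solver.Ring
import Algebra.Solver.Ring.AlmostCommutativeRing as ACR
open import Data.Bool using (Bool; true; false; _∧_; _∨_; not; if_then_else_)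
open import Data.Bool.ListAction using (all; any)
import Data.Bool.Properties as BoolP
open import Data.Empty using (⊥; ⊥-elim)
open import Data.Fin using (Fin; zero; suc; toℕ) renaming (_≟_ to _≟ᶠ_)
import Data.Fin.Properties as FinP
open import Data.Integer as ℤ using (ℤ; +_; -[1+_])
import Data.Integer.Properties as ℤP
open import Data.List using (List; []; _∷_; _++_; map; concatMap; length; upTo; applyUpTo; filterᵇ; allFin; tabulate)
import Data.List.Properties as ListP
open import Data.Maybe using (Maybe; just; nothing)
open import Data.Nat as ℕ using (ℕ; zero; suc; z≤n; s≤s; _≡ᵇ_; _<ᵇ_; _%_; _/_)
open import Data.Nat.DivMod using (m/n≡1+[m∸n]/n)
import Data.Nat.Properties as ℕP
open import Data.Nat.Tactic.RingSolver using (solve-∀)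
open import Data.Product using (_×_; _,_; ∃; ∃-syntax; proj₁; proj₂)
open import Data.Sum using (_⊎_; inj₁; inj₂; [_,_]′)
open import Function.Bundles using (_⇔_; mk⇔; Equivalence)
open import Level using (0ℓ)
open import Relation.Binary.Definitions using (tri<; tri≈; tri>)
open import Relation.Binary.PropositionalEquality
open import Relation.Nullary using (¬_; Dec; yes; no; does)
open import Relation.Nullary.Decidable using (dec-true; dec-false)

-- No roots, limits or rational functions occur: a multiplicity is the index of the first non-zero
-- Taylor coefficient, and statements on quotients are cross-multiplied into inequalities between
-- coefficients. The leading term of a sum of squares has even degree and positive coefficient, and
-- these two facts carry the structure theory. Parity settles the situations in which the products
-- in μ(G-u) μ(G-v) - μ(G) μ(G-u-v) have different orders, the smaller one odd. It says nothing when
-- the leading terms sit in the same degree, which is the case behind the existence of an essential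
-- vertex and behind the transitivity of dependence. Replacing the variable of one vertex by x + s t
-- (with t = x - θ) keeps the difference a sum of squares for every s, while its leading coefficient
-- becomes a non-constant affine function of s, and such a function cannot keep one sign. The count
-- in S_θ(G) works only while there is multiplicity left to lower. Hence u and v are first shown to
-- be non-essential; this bounds the multiplicity of G - A - u - v from below by that of G - A, so
-- that all of A can be added back with full effect.

-- Ordered field arithmetic, a ring solver and finite sums.

module OrderedField (F : RealField) where
  open RealField F public

  commutativeRing : CommutativeRing 0ℓ 0ℓ
  commutativeRing = record
    { Carrier = R ; _≈_ = _≡_ ; _+_ = _+_ ; _*_ = _*_ ; -_ = -_ ; 0# = 0# ; 1# = 1#
    ; isCommutativeRing = record
      { isRing = record
        { +-isAbelianGroup = record
          { isGroup = record
            { isMonoid = record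
              { isSemigroup = record
                { isMagma = record { isEquivalence = isEquivalence ; ∙-cong = cong₂ _+_ }
                ; assoc = +-assoc }
              ; identity = +-identityˡ , λ x → trans (+-comm x 0#) (+-identityˡ x) }
            ; inverse = -‿inverseˡ , λ x → trans (+-comm x (- x)) (-‿inverseˡ x)
            ; ⁻¹-cong = cong -_ }
          ; comm = +-comm }
        ; *-cong = cong₂ _*_
        ; *-assoc = *-assoc
        ; *-identity = *-identityˡ , λ x → trans (*-comm x 1#) (*-identityˡ x)
        ; distrib = (λ x y z → trans (*-comm x (y + z))
                       (trans (distribʳ y z x) (cong₂ _+_ (*-comm y x) (*-comm z x))))
                  , λ x y z → distribʳ y z x }
      ; *-comm = *-comm } }

  open CommutativeRing commutativeRing using
    (+-identityʳ; zeroˡ; zeroʳ; -‿inverseʳ; distribˡ; *-identityʳ; ring) public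
  open RingProperties ring using (-‿distribˡ-*; -‿distribʳ-*; -‿involutive; -‿+-comm; -0#≈0#)

  natural : ℕ → R
  natural zero = 0#
  natural (suc k) = natural k + 1#

  -- The canonical ring homomorphism. It gives the ring solver integer coefficients, whose
  -- arithmetic computes, so that cancellations are found although the operations of `R` are opaque.
  integer : ℤ → R
  integer (+ k) = natural k
  integer -[1+ k ] = - natural (suc k)

  natural-+ : ∀ a b → natural (a ℕ.+ b) ≡ natural a + natural b
  natural-+ zero b = sym (+-identityˡ _)
  natural-+ (suc a) b = begin
    natural (a ℕ.+ b) + 1#           ≡⟨ cong (_+ 1#) (natural-+ a b) ⟩
    (natural a + natural b) + 1#     ≡⟨ +-assoc _ _ _ ⟩
    natural a + (natural b + 1#)     ≡⟨ cong (_+_ _) (+-comm _ _) ⟩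
    natural a + (1# + natural b)     ≡⟨ +-assoc _ _ _ ⟨
    (natural a + 1#) + natural b     ∎
    where open ≡-Reasoning

  natural-* : ∀ a b → natural (a ℕ.* b) ≡ natural a * natural b
  natural-* zero b = sym (zeroˡ _)
  natural-* (suc a) b = begin
    natural (b ℕ.+ a ℕ.* b)                    ≡⟨ natural-+ b _ ⟩
    natural b + natural (a ℕ.* b)              ≡⟨ cong (_+_ _) (natural-* a b) ⟩
    natural b + natural a * natural b          ≡⟨ +-comm _ _ ⟩
    natural a * natural b + natural b          ≡⟨ cong (_+_ _) (*-identityˡ _) ⟨
    natural a * natural b + 1# * natural b     ≡⟨ distribʳ _ _ _ ⟨
    (natural a + 1#) * natural b               ∎
    where open ≡-Reasoning

  integer-neg : ∀ i → integer (ℤ.- i) ≡ - integer i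
  integer-neg (+ zero) = sym -0#≈0#
  integer-neg (+ suc k) = refl
  integer-neg -[1+ k ] = sym (-‿involutive _)

  integer-⊖ : ∀ a b → integer (a ℤ.⊖ b) ≡ natural a + - natural b
  integer-⊖ a zero = sym (trans (cong (_+_ _) -0#≈0#) (+-identityʳ _))
  integer-⊖ zero (suc b) = sym (+-identityˡ _)
  integer-⊖ (suc a) (suc b) = begin
    integer (suc a ℤ.⊖ suc b)                    ≡⟨ cong integer (ℤP.[1+m]⊖[1+n]≡m⊖n a b) ⟩
    integer (a ℤ.⊖ b)                            ≡⟨ integer-⊖ a b ⟩
    natural a + - natural b                      ≡⟨ cong (_+ _) (+-identityʳ _) ⟨
    (natural a + 0#) + - natural b               ≡⟨ cong (λ z → (natural a + z) + - natural b) (-‿inverseʳ 1#) ⟨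
    (natural a + (1# + - 1#)) + - natural b      ≡⟨ cong (_+ - natural b) (+-assoc _ _ _) ⟨
    ((natural a + 1#) + - 1#) + - natural b      ≡⟨ +-assoc _ _ _ ⟩
    (natural a + 1#) + (- 1# + - natural b)      ≡⟨ cong (_+_ _) (+-comm _ _) ⟩
    (natural a + 1#) + (- natural b + - 1#)      ≡⟨ cong (_+_ _) (-‿+-comm _ _) ⟩
    (natural a + 1#) + - (natural b + 1#)        ∎
    where open ≡-Reasoning

  integer-+ : ∀ i j → integer (i ℤ.+ j) ≡ integer i + integer j
  integer-+ (+ a) (+ b) = natural-+ a b
  integer-+ (+ a) -[1+ b ] = integer-⊖ a (suc b)
  integer-+ -[1+ a ] (+ b) = trans (integer-⊖ b (suc a)) (+-comm _ _)
  integer-+ -[1+ a ] -[1+ b ] = begin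
    - natural (suc (suc (a ℕ.+ b)))          ≡⟨ cong (λ k → - natural (suc k)) (ℕP.+-suc a b) ⟨
    - natural (suc a ℕ.+ suc b)              ≡⟨ cong -_ (natural-+ (suc a) (suc b)) ⟩
    - (natural (suc a) + natural (suc b))    ≡⟨ -‿+-comm _ _ ⟨
    - natural (suc a) + - natural (suc b)    ∎
    where open ≡-Reasoning

  integer-*⁺ : ∀ a j → integer (+ a ℤ.* j) ≡ natural a * integer j
  integer-*⁺ a (+ b) = trans (cong integer (sym (ℤP.pos-* a b))) (natural-* a b)
  integer-*⁺ a -[1+ b ] = begin
    integer (+ a ℤ.* ℤ.- (+ suc b))          ≡⟨ cong integer (ℤP.neg-distribʳ-* (+ a) (+ suc b)) ⟨
    integer (ℤ.- (+ a ℤ.* + suc b))          ≡⟨ integer-neg (+ a ℤ.* + suc b) ⟩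
    - integer (+ a ℤ.* + suc b)              ≡⟨ cong -_ (integer-*⁺ a (+ suc b)) ⟩
    - (natural a * natural (suc b))          ≡⟨ -‿distribʳ-* _ _ ⟩
    natural a * - natural (suc b)            ∎
    where open ≡-Reasoning

  integer-* : ∀ i j → integer (i ℤ.* j) ≡ integer i * integer j
  integer-* (+ a) j = integer-*⁺ a j
  integer-* -[1+ a ] j = begin
    integer (ℤ.- (+ suc a) ℤ.* j)            ≡⟨ cong integer (ℤP.neg-distribˡ-* (+ suc a) j) ⟨
    integer (ℤ.- (+ suc a ℤ.* j))            ≡⟨ integer-neg (+ suc a ℤ.* j) ⟩
    - integer (+ suc a ℤ.* j)                ≡⟨ cong -_ (integer-*⁺ (suc a) j) ⟩
    - (natural (suc a) * integer j)          ≡⟨ -‿distribˡ-* _ _ ⟩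
    - natural (suc a) * integer j            ∎
    where open ≡-Reasoning

  private
    almostRing = ACR.fromCommutativeRing commutativeRing

    ℤ-coefficients : ℤ.+-*-rawRing ACR.-Raw-AlmostCommutative⟶ almostRing
    ℤ-coefficients = record
      { ⟦_⟧ = integer ; +-homo = integer-+ ; *-homo = integer-*
      ; -‿homo = integer-neg ; 0-homo = refl ; 1-homo = +-identityˡ 1# }

    coefficient-eq : ∀ i j → Maybe (integer i ≡ integer j)
    coefficient-eq i j with i ℤ.≟ j
    ... | yes i≡j = just (cong integer i≡j)
    ... | no _ = nothing

  open Algebra.Solver.Ring ℤ.+-*-rawRing almostRing ℤ-coefficients coefficient-eq public
    using (solve; _:=_; _:+_; _:*_; :-_; _:-_; con)

  infixl 6 _-_
  _-_ : R → R → R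
  x - y = x + - y

  0<⇒≢0 : ∀ {x} → 0# < x → x ≢ 0#
  0<⇒≢0 0<x refl = <-irrefl _ 0<x

  neg-positive : ∀ {x} → x < 0# → 0# < - x
  neg-positive {x} x<0 =
    subst₂ _<_ (-‿inverseʳ x) (+-identityˡ _) (+-mono-< x 0# (- x) x<0)

  neg-negative : ∀ {x} → 0# < x → - x < 0#
  neg-negative {x} 0<x =
    subst₂ _<_ (+-identityˡ _) (-‿inverseʳ x) (+-mono-< 0# x (- x) 0<x)

  +-positive : ∀ {x y} → 0# < x → 0# < y → 0# < x + y
  +-positive {x} {y} 0<x 0<y =
    <-trans _ _ _ 0<y (subst (_< x + y) (+-identityˡ y) (+-mono-< 0# x y 0<x))

  square-positive : ∀ {x} → x ≢ 0# → 0# < x * x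
  square-positive {x} x≢0 with <-trichotomy x 0#
  ... | inj₁ x<0 = subst (0# <_) (solve 1 (λ x → (:- x) :* (:- x) := x :* x) refl x)
                     (*-pos _ _ (neg-positive x<0) (neg-positive x<0))
  ... | inj₂ (inj₁ x≡0) = ⊥-elim (x≢0 x≡0)
  ... | inj₂ (inj₂ 0<x) = *-pos _ _ 0<x 0<x

  0<1 : 0# < 1#
  0<1 = subst (0# <_) (*-identityˡ 1#) (square-positive (λ 1≡0 → 0≢1 (sym 1≡0)))

  *-nonzero : ∀ {x y} → x ≢ 0# → y ≢ 0# → x * y ≢ 0#
  *-nonzero {x} {y} x≢0 y≢0 xy≡0 with *-inverse x x≢0
  ... | x⁻¹ , x⁻¹x≡1 = y≢0 (begin
    y                 ≡⟨ *-identityˡ y ⟨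
    1# * y            ≡⟨ cong (_* y) x⁻¹x≡1 ⟨
    (x⁻¹ * x) * y     ≡⟨ *-assoc _ _ _ ⟩
    x⁻¹ * (x * y)     ≡⟨ cong (x⁻¹ *_) xy≡0 ⟩
    x⁻¹ * 0#          ≡⟨ zeroʳ _ ⟩
    0#                ∎)
    where open ≡-Reasoning

  -- As a function of s the left-hand side is affine with slope β e, which is non-zero. Later s is
  -- the weight of a perturbed vertex and τ is chosen so as to violate a sign condition.
  solve-affine : ∀ α τ {β e} → β ≢ 0# → e ≢ 0# → ∃ λ s → (α + s * β) * e ≡ τ
  solve-affine α τ {β} {e} β≢0 e≢0 with *-inverse β β≢0 | *-inverse e e≢0
  ... | β⁻¹ , β⁻¹β≡1 | e⁻¹ , e⁻¹e≡1 = (τ * e⁻¹ - α) * β⁻¹ , (begin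
    (α + (τ * e⁻¹ - α) * β⁻¹ * β) * e      ≡⟨ cong (λ z → (α + z) * e) (*-assoc _ _ _) ⟩
    (α + (τ * e⁻¹ - α) * (β⁻¹ * β)) * e    ≡⟨ cong (λ z → (α + (τ * e⁻¹ - α) * z) * e) β⁻¹β≡1 ⟩
    (α + (τ * e⁻¹ - α) * 1#) * e           ≡⟨ cong (λ z → (α + z) * e) (*-identityʳ _) ⟩
    (α + (τ * e⁻¹ - α)) * e                ≡⟨ solve 4 (λ α τ e e⁻¹ → (α :+ (τ :* e⁻¹ :- α)) :* e := τ :* (e⁻¹ :* e)) refl α τ e e⁻¹ ⟩
    τ * (e⁻¹ * e)                          ≡⟨ cong (τ *_) e⁻¹e≡1 ⟩
    τ * 1#                                 ≡⟨ *-identityʳ τ ⟩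
    τ                                      ∎)
    where open ≡-Reasoning

  NonNegative : R → Set
  NonNegative x = x ≡ 0# ⊎ 0# < x

  +-nonNegative : ∀ {x y} → NonNegative x → NonNegative y → NonNegative (x + y)
  +-nonNegative {y = y} (inj₁ refl) q = subst NonNegative (sym (+-identityˡ y)) q
  +-nonNegative {x} (inj₂ p) (inj₁ refl) = inj₂ (subst (0# <_) (sym (+-identityʳ x)) p)
  +-nonNegative (inj₂ p) (inj₂ q) = inj₂ (+-positive p q)

  +-positiveˡ : ∀ {x y} → 0# < x → NonNegative y → 0# < x + y
  +-positiveˡ {x} p (inj₁ refl) = subst (0# <_) (sym (+-identityʳ x)) p
  +-positiveˡ p (inj₂ q) = +-positive p q

  +-positiveʳ : ∀ {x y} → NonNegative x → 0# < y → 0# < x + y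
  +-positiveʳ {x} {y} p q = subst (0# <_) (+-comm y x) (+-positiveˡ q p)

  ∑ : ∀ {n} → (Fin n → R) → R
  ∑ {zero} h = 0#
  ∑ {suc n} h = h zero + ∑ (λ i → h (suc i))

  ∑-cong : ∀ {n} {g h : Fin n → R} → (∀ i → g i ≡ h i) → ∑ g ≡ ∑ h
  ∑-cong {zero} eq = refl
  ∑-cong {suc n} eq = cong₂ _+_ (eq zero) (∑-cong (λ i → eq (suc i)))

  ∑-zero : ∀ {n} {h : Fin n → R} → (∀ i → h i ≡ 0#) → ∑ h ≡ 0#
  ∑-zero {zero} eq = refl
  ∑-zero {suc n} eq = trans (cong₂ _+_ (eq zero) (∑-zero (λ i → eq (suc i)))) (+-identityˡ 0#)

  ∑-distrib-+ : ∀ {n} (g h : Fin n → R) → ∑ (λ i → g i + h i) ≡ ∑ g + ∑ h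
  ∑-distrib-+ {zero} g h = sym (+-identityˡ 0#)
  ∑-distrib-+ {suc n} g h =
    trans (cong (_+_ _) (∑-distrib-+ (λ i → g (suc i)) (λ i → h (suc i))))
      (solve 4 (λ a b c d → (a :+ b) :+ (c :+ d) := (a :+ c) :+ (b :+ d)) refl
        (g zero) (h zero) (∑ (λ i → g (suc i))) (∑ (λ i → h (suc i))))

  *-distribˡ-∑ : ∀ {n} c (h : Fin n → R) → c * ∑ h ≡ ∑ (λ i → c * h i)
  *-distribˡ-∑ {zero} c h = zeroʳ c
  *-distribˡ-∑ {suc n} c h =
    trans (distribˡ _ _ _) (cong (_+_ _) (*-distribˡ-∑ c (λ i → h (suc i))))

  *-distribʳ-∑ : ∀ {n} c (h : Fin n → R) → ∑ h * c ≡ ∑ (λ i → h i * c)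
  *-distribʳ-∑ c h = trans (*-comm _ c) (trans (*-distribˡ-∑ c h) (∑-cong (λ i → *-comm c (h i))))

  neg-distrib-∑ : ∀ {n} (h : Fin n → R) → - ∑ h ≡ ∑ (λ i → - h i)
  neg-distrib-∑ {zero} h = -0#≈0#
  neg-distrib-∑ {suc n} h =
    trans (sym (-‿+-comm _ _)) (cong (_+_ _) (neg-distrib-∑ (λ i → h (suc i))))

  ∑-nonNegative : ∀ {n} {h : Fin n → R} → (∀ i → NonNegative (h i)) → NonNegative (∑ h)
  ∑-nonNegative {zero} p = inj₁ refl
  ∑-nonNegative {suc n} p = +-nonNegative (p zero) (∑-nonNegative (λ i → p (suc i)))

  ∑-positive : ∀ {n} {h : Fin n → R} → (∀ i → NonNegative (h i)) → ∀ j → 0# < h j → 0# < ∑ h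
  ∑-positive p zero q = +-positiveˡ q (∑-nonNegative (λ i → p (suc i)))
  ∑-positive p (suc j) q = +-positiveʳ (p zero) (∑-positive (λ i → p (suc i)) j q)

-- Formal power series in t = x - θ: orders, signs of leading terms, monotone quotients.

module PowerSeries (F : RealField) (θ : RealField.R F) where
  open OrderedField F

  Series : Set
  Series = ℕ → R

  infix 4 _≈_
  _≈_ : Series → Series → Set
  f ≈ g = ∀ k → f k ≡ g k

  constant : R → Series
  constant c zero = c
  constant c (suc _) = 0#

  -- A series is the Taylor expansion in t = x - θ; X y multiplies by θ + y t,
  -- so X 1# is multiplication by x.
  X : R → Series → Series
  X y f zero = θ * f zero
  X y f (suc k) = θ * f (suc k) + y * f k

  tail : Series → Series
  tail f k = f (suc k)

  infixl 7 _⊛_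
  -- The Cauchy product, by recursion along f = f 0 + t · `tail f`.
  _⊛_ : Series → Series → Series
  (f ⊛ g) zero = f zero * g zero
  (f ⊛ g) (suc k) = f zero * g (suc k) + (tail f ⊛ g) k

  X-cong : ∀ {y f g} → f ≈ g → X y f ≈ X y g
  X-cong eq zero = cong (θ *_) (eq zero)
  X-cong eq (suc k) = cong₂ (λ a b → θ * a + _ * b) (eq (suc k)) (eq k)

  ⊛-cong : ∀ {f f′ g g′} → f ≈ f′ → g ≈ g′ → f ⊛ g ≈ f′ ⊛ g′
  ⊛-cong p q zero = cong₂ _*_ (p zero) (q zero)
  ⊛-cong p q (suc k) =
    cong₂ _+_ (cong₂ _*_ (p zero) (q (suc k))) (⊛-cong (λ i → p (suc i)) q k)

  ⊛-linearˡ : ∀ a b f h g k →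
    ((λ i → a * f i + b * h i) ⊛ g) k ≡ a * (f ⊛ g) k + b * (h ⊛ g) k
  ⊛-linearˡ a b f h g zero =
    solve 5 (λ a b f h g → (a :* f :+ b :* h) :* g := a :* (f :* g) :+ b :* (h :* g)) refl a b _ _ _
  ⊛-linearˡ a b f h g (suc k) =
    trans (cong (_+_ _) (⊛-linearˡ a b (tail f) (tail h) g k))
      (solve 7 (λ a b f h g p q → (a :* f :+ b :* h) :* g :+ (a :* p :+ b :* q)
                  := a :* (f :* g :+ p) :+ b :* (h :* g :+ q)) refl a b _ _ _ _ _)

  ⊛-Xˡ : ∀ y f g → X y f ⊛ g ≈ X y (f ⊛ g)
  ⊛-Xˡ y f g zero = *-assoc _ _ _
  ⊛-Xˡ y f g (suc k) =
    trans (cong (_+_ _) (⊛-linearˡ θ y (tail f) f g k))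
      (solve 6 (λ θ f g p y q → θ :* f :* g :+ (θ :* p :+ y :* q) := θ :* (f :* g :+ p) :+ y :* q)
        refl θ _ _ _ _ _)

  ⊛-Xʳ : ∀ y f g → f ⊛ X y g ≈ X y (f ⊛ g)
  ⊛-Xʳ y f g zero = solve 3 (λ f θ g → f :* (θ :* g) := θ :* (f :* g)) refl _ _ _
  ⊛-Xʳ y f g (suc zero) =
    solve 6 (λ f θ y g₁ g₀ f₁ → f :* (θ :* g₁ :+ y :* g₀) :+ f₁ :* (θ :* g₀)
               := θ :* (f :* g₁ :+ f₁ :* g₀) :+ y :* (f :* g₀)) refl _ _ _ _ _ _
  ⊛-Xʳ y f g (suc (suc k)) =
    trans (cong (_+_ _) (⊛-Xʳ y (tail f) g (suc k)))
      (solve 7 (λ f θ y g₁ g₀ p q → f :* (θ :* g₁ :+ y :* g₀) :+ (θ :* p :+ y :* q)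
               := θ :* (f :* g₁ :+ p) :+ y :* (f :* g₀ :+ q)) refl _ _ _ _ _ _ _)

  ⊛-subˡ : ∀ f h g k → ((λ i → f i - h i) ⊛ g) k ≡ (f ⊛ g) k - (h ⊛ g) k
  ⊛-subˡ f h g zero = solve 3 (λ f h g → (f :- h) :* g := f :* g :- h :* g) refl _ _ _
  ⊛-subˡ f h g (suc k) =
    trans (cong (_+_ _) (⊛-subˡ (tail f) (tail h) g k))
      (solve 5 (λ f h g p q → (f :- h) :* g :+ (p :- q) := (f :* g :+ p) :- (h :* g :+ q)) refl _ _ _ _ _)

  ⊛-subʳ : ∀ f g h k → (f ⊛ (λ i → g i - h i)) k ≡ (f ⊛ g) k - (f ⊛ h) k
  ⊛-subʳ f g h zero = solve 3 (λ f g h → f :* (g :- h) := f :* g :- f :* h) refl _ _ _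
  ⊛-subʳ f g h (suc k) =
    trans (cong (_+_ _) (⊛-subʳ (tail f) g h k))
      (solve 5 (λ f g h p q → f :* (g :- h) :+ (p :- q) := (f :* g :+ p) :- (f :* h :+ q)) refl _ _ _ _ _)

  ⊛-∑ˡ : ∀ {n} (h : Fin n → Series) g k → ((λ i → ∑ (λ v → h v i)) ⊛ g) k ≡ ∑ (λ v → (h v ⊛ g) k)
  ⊛-∑ˡ h g zero = *-distribʳ-∑ (g 0) (λ v → h v 0)
  ⊛-∑ˡ h g (suc k) =
    trans (cong₂ _+_ (*-distribʳ-∑ (g (suc k)) (λ v → h v 0)) (⊛-∑ˡ (λ v → tail (h v)) g k))
      (sym (∑-distrib-+ (λ v → h v 0 * g (suc k)) (λ v → (tail (h v) ⊛ g) k)))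

  ⊛-∑ʳ : ∀ {n} f (h : Fin n → Series) k → (f ⊛ (λ i → ∑ (λ v → h v i))) k ≡ ∑ (λ v → (f ⊛ h v) k)
  ⊛-∑ʳ f h zero = *-distribˡ-∑ (f 0) (λ v → h v 0)
  ⊛-∑ʳ f h (suc k) =
    trans (cong₂ _+_ (*-distribˡ-∑ (f 0) (λ v → h v (suc k))) (⊛-∑ʳ (tail f) h k))
      (sym (∑-distrib-+ (λ v → f 0 * h v (suc k)) (λ v → (tail f ⊛ h v) k)))

  Vanish : ℕ → Series → Set
  Vanish a f = ∀ i → i ℕ.< a → f i ≡ 0#

  Order : Series → ℕ → Set
  Order f m = Vanish m f × f m ≢ 0#

  vanish-mono : ∀ {a b f} → a ℕ.≤ b → Vanish b f → Vanish a f
  vanish-mono a≤b v i i<a = v i (ℕP.<-≤-trans i<a a≤b)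

  order-resp : ∀ {f g m} → f ≈ g → Order f m → Order g m
  order-resp eq (v , nz) = (λ i i<m → trans (sym (eq i)) (v i i<m)) , λ z → nz (trans (eq _) z)

  order-≤ : ∀ {f m k} → Order f m → f k ≢ 0# → m ℕ.≤ k
  order-≤ {m = m} {k} (v , _) nz with m ℕ.≤? k
  ... | yes m≤k = m≤k
  ... | no m≰k = ⊥-elim (nz (v k (ℕP.≰⇒> m≰k)))

  order-unique : ∀ {f a b} → Order f a → Order f b → a ≡ b
  order-unique p q = ℕP.≤-antisym (order-≤ p (proj₂ q)) (order-≤ q (proj₂ p))

  first-nonzero : ∀ N f → Vanish N f ⊎ ∃ λ m → m ℕ.< N × Order f m
  first-nonzero zero f = inj₁ λ _ ()
  first-nonzero (suc N) f with first-nonzero N f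
  ... | inj₂ (m , m<N , o) = inj₂ (m , ℕP.m<n⇒m<1+n m<N , o)
  ... | inj₁ v with f N ≟ 0#
  ...   | no nz = inj₂ (N , ℕP.≤-refl , v , nz)
  ...   | yes z = inj₁ λ i i<1+N → [ v i , (λ { refl → z }) ]′ (ℕP.m<1+n⇒m<n∨m≡n i<1+N)

  ⊛-vanish : ∀ a b {f g} → Vanish a f → Vanish b g → Vanish (a ℕ.+ b) (f ⊛ g)
  ⊛-vanish zero b {f} p q zero lt = trans (cong (f 0 *_) (q 0 lt)) (zeroʳ _)
  ⊛-vanish (suc a) b {g = g} p q zero lt = trans (cong (_* g 0) (p 0 (s≤s z≤n))) (zeroˡ _)
  ⊛-vanish zero b {f} p q (suc k) lt =
    trans (cong₂ _+_ (trans (cong (f 0 *_) (q (suc k) lt)) (zeroʳ _))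
                     (⊛-vanish zero b {tail f} (λ _ ()) q k (ℕP.<⇒≤ lt)))
          (+-identityˡ 0#)
  ⊛-vanish (suc a) b {f} {g} p q (suc k) (s≤s lt) =
    trans (cong₂ _+_ (trans (cong (_* g (suc k)) (p 0 (s≤s z≤n))) (zeroˡ _))
                     (⊛-vanish a b {tail f} (λ i i<a → p (suc i) (s≤s i<a)) q k lt))
          (+-identityˡ 0#)

  ⊛-leading : ∀ a b {f g} → Vanish a f → Vanish b g → (f ⊛ g) (a ℕ.+ b) ≡ f a * g b
  ⊛-leading zero zero p q = refl
  ⊛-leading zero (suc b) {f} {g} p q =
    trans (cong (_+_ _) (⊛-vanish zero (suc b) {tail f} (λ _ ()) q b ℕP.≤-refl)) (+-identityʳ _)
  ⊛-leading (suc a) b {f} {g} p q =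
    trans (cong₂ _+_ (trans (cong (_* g (suc (a ℕ.+ b))) (p 0 (s≤s z≤n))) (zeroˡ _))
                     (⊛-leading a b {tail f} (λ i i<a → p (suc i) (s≤s i<a)) q))
          (+-identityˡ _)

  ⊛-identityˡ : ∀ {f} g → f ≈ constant 1# → f ⊛ g ≈ g
  ⊛-identityˡ {f} g f≈1 zero = trans (cong (_* g 0) (f≈1 0)) (*-identityˡ _)
  ⊛-identityˡ {f} g f≈1 (suc k) =
    trans (cong₂ _+_ (trans (cong (_* g (suc k)) (f≈1 0)) (*-identityˡ _))
                     (⊛-vanish (suc k) 0 {tail f} (λ i _ → f≈1 (suc i)) (λ _ ()) k
                        (s≤s (ℕP.m≤m+n k 0))))
          (+-identityʳ _)

  order-⊛ : ∀ {f g a b} → Order f a → Order g b → Order (f ⊛ g) (a ℕ.+ b)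
  order-⊛ {f} {g} {a} {b} (p , p≢0) (q , q≢0) =
    ⊛-vanish a b p q , λ z → *-nonzero p≢0 q≢0 (trans (sym (⊛-leading a b p q)) z)

  -- Truncation at N makes the zero series decidable.
  NonNegativeUpTo : ℕ → Series → Set
  NonNegativeUpTo N f = Vanish N f ⊎ ∃ λ j → Vanish (j ℕ.+ j) f × 0# < f (j ℕ.+ j)

  nonNegativeUpTo-resp : ∀ {N f g} → f ≈ g → NonNegativeUpTo N f → NonNegativeUpTo N g
  nonNegativeUpTo-resp eq (inj₁ v) = inj₁ λ i lt → trans (sym (eq i)) (v i lt)
  nonNegativeUpTo-resp eq (inj₂ (j , v , p)) =
    inj₂ (j , (λ i lt → trans (sym (eq i)) (v i lt)) , subst (0# <_) (eq _) p)

  vanish-+ : ∀ {a f g} → Vanish a f → Vanish a g → Vanish a (λ k → f k + g k)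
  vanish-+ p q i lt = trans (cong₂ _+_ (p i lt) (q i lt)) (+-identityˡ 0#)

  -- Positive leading coefficients cannot cancel: the sum leads in the smaller degree, and in case
  -- of a tie the two coefficients add. A leading degree at or beyond N, met by a summand vanishing
  -- up to N, is absorbed into the vanishing case.
  +-nonNegativeUpTo : ∀ {N f g} → NonNegativeUpTo N f → NonNegativeUpTo N g →
    NonNegativeUpTo N (λ k → f k + g k)
  +-nonNegativeUpTo (inj₁ p) (inj₁ q) = inj₁ (vanish-+ p q)
  +-nonNegativeUpTo {N} {f} {g} (inj₁ p) (inj₂ (j , q , pos)) with j ℕ.+ j ℕ.<? N
  ... | yes lt = inj₂ (j , vanish-+ (vanish-mono (ℕP.<⇒≤ lt) p) q
                     , +-positiveʳ (inj₁ (p _ lt)) pos)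
  ... | no ≮ = inj₁ (vanish-+ p (vanish-mono (ℕP.≮⇒≥ ≮) q))
  +-nonNegativeUpTo {N} {f} {g} (inj₂ (j , q , pos)) (inj₁ p) with j ℕ.+ j ℕ.<? N
  ... | yes lt = inj₂ (j , vanish-+ q (vanish-mono (ℕP.<⇒≤ lt) p)
                     , +-positiveˡ pos (inj₁ (p _ lt)))
  ... | no ≮ = inj₁ (vanish-+ (vanish-mono (ℕP.≮⇒≥ ≮) q) p)
  +-nonNegativeUpTo (inj₂ (i , p , pos)) (inj₂ (j , q , pos′)) with ℕP.<-cmp i j
  ... | tri< i<j _ _ = inj₂ (i , vanish-+ p (vanish-mono (ℕP.<⇒≤ lt) q) , +-positiveˡ pos (inj₁ (q _ lt)))
    where lt = ℕP.+-mono-< i<j i<j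
  ... | tri≈ _ refl _ = inj₂ (i , vanish-+ p q , +-positive pos pos′)
  ... | tri> _ _ j<i = inj₂ (j , vanish-+ (vanish-mono (ℕP.<⇒≤ lt) p) q , +-positiveʳ (inj₁ (p _ lt)) pos′)
    where lt = ℕP.+-mono-< j<i j<i

  ∑-nonNegativeUpTo : ∀ {n N} (h : Fin n → Series) → (∀ v → NonNegativeUpTo N (h v)) →
    NonNegativeUpTo N (λ k → ∑ (λ v → h v k))
  ∑-nonNegativeUpTo {zero} h p = inj₁ λ _ _ → refl
  ∑-nonNegativeUpTo {suc n} h p =
    +-nonNegativeUpTo (p zero) (∑-nonNegativeUpTo (λ v → h (suc v)) (λ v → p (suc v)))

  square-nonNegativeUpTo : ∀ N f → NonNegativeUpTo N (f ⊛ f)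
  square-nonNegativeUpTo N f with first-nonzero N f
  ... | inj₁ v = inj₁ (vanish-mono (ℕP.m≤m+n N N) (⊛-vanish N N v v))
  ... | inj₂ (m , _ , v , nz) =
    inj₂ (m , ⊛-vanish m m v v , subst (0# <_) (sym (⊛-leading m m v v)) (square-positive nz))

  leading-not-negative : ∀ {N f} → NonNegativeUpTo (suc N) f → Vanish N f → ¬ (f N < 0#)
  leading-not-negative (inj₁ v) _ f<0 = <-irrefl _ (subst (_< 0#) (v _ ℕP.≤-refl) f<0)
  leading-not-negative {N} {f} (inj₂ (j , v , pos)) w f<0 with ℕP.<-cmp (j ℕ.+ j) N
  ... | tri< lt _ _ = 0<⇒≢0 pos (w _ lt)
  ... | tri≈ _ refl _ = <-irrefl _ (<-trans _ _ _ pos f<0)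
  ... | tri> _ _ gt = <-irrefl _ (subst (_< 0#) (v _ gt) f<0)

  odd≢even : ∀ i j → suc (i ℕ.+ i) ≢ j ℕ.+ j
  odd≢even zero (suc j) eq with trans (ℕP.suc-injective eq) (ℕP.+-suc j j)
  ... | ()
  odd≢even (suc i) (suc j) eq =
    odd≢even i j (ℕP.suc-injective (ℕP.suc-injective
      (trans (cong (λ k → suc (suc k)) (sym (ℕP.+-suc i i))) (trans eq (cong suc (ℕP.+-suc j j))))))

  -- The first non-zero coefficient would have even degree. The truncation is one past the degree
  -- examined, so that the vanishing case covers it too.
  odd-leading-zero : ∀ i {f} → NonNegativeUpTo (suc (suc (i ℕ.+ i))) f →
    Vanish (suc (i ℕ.+ i)) f → f (suc (i ℕ.+ i)) ≡ 0#
  odd-leading-zero i (inj₁ v) _ = v _ ℕP.≤-refl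
  odd-leading-zero i (inj₂ (j , v , pos)) w with ℕP.<-cmp (j ℕ.+ j) (suc (i ℕ.+ i))
  ... | tri< lt _ _ = ⊥-elim (0<⇒≢0 pos (w _ lt))
  ... | tri≈ _ eq _ = ⊥-elim (odd≢even i j (sym eq))
  ... | tri> _ _ gt = v _ gt

  -- p / q has at θ a simple pole with negative residue, or is regular there with positive
  -- derivative; both cases say that, after cancelling tᵏ, the Wronskian is positive at θ.
  record Increasing (p q : Series) : Set where
    constructor increasing
    field
      common : ℕ
      vanishˡ : Vanish common p
      vanishʳ : Vanish common q
      wronskian : 0# < p (suc common) * q common - p common * q (suc common)

  -- Derivatives add. When the values of `common` differ, the quotient with the larger one
  -- contributes nothing to the Wronskian at the smaller index, because its numerator and q both
  -- vanish there.
  increasing-+ : ∀ {p p′ q} → Increasing p q → Increasing p′ q → Increasing (λ k → p k + p′ k) q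
  increasing-+ {p} {p′} {q} (increasing k vp vq w) (increasing k′ vp′ vq′ w′) with ℕP.<-cmp k k′
  ... | tri< lt _ _ = increasing k (vanish-+ vp (vanish-mono (ℕP.<⇒≤ lt) vp′)) vq
      (subst (0# <_) eq w)
    where
      eq : p (suc k) * q k - p k * q (suc k) ≡ (p (suc k) + p′ (suc k)) * q k - (p k + p′ k) * q (suc k)
      eq rewrite vp′ k lt | vq′ k lt =
        solve 4 (λ a b c d → a :* con (+ 0) :- b :* c := (a :+ d) :* con (+ 0) :- (b :+ con (+ 0)) :* c) refl
          _ _ _ _
  ... | tri≈ _ refl _ = increasing k (vanish-+ vp vp′) vq (subst (0# <_)
      (solve 6 (λ a b a′ b′ c d → (a :* c :- b :* d) :+ (a′ :* c :- b′ :* d) := (a :+ a′) :* c :- (b :+ b′) :* d)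
        refl (p (suc k)) (p k) (p′ (suc k)) (p′ k) (q k) (q (suc k))) (+-positive w w′))
  ... | tri> _ _ gt = increasing k′ (vanish-+ (vanish-mono (ℕP.<⇒≤ gt) vp) vp′) vq′
      (subst (0# <_) eq w′)
    where
      eq : p′ (suc k′) * q k′ - p′ k′ * q (suc k′) ≡
           (p (suc k′) + p′ (suc k′)) * q k′ - (p k′ + p′ k′) * q (suc k′)
      eq rewrite vp k′ gt | vq k′ gt =
        solve 4 (λ a b c d → a :* con (+ 0) :- b :* c := (d :+ a) :* con (+ 0) :- (con (+ 0) :+ b) :* c) refl
          _ _ _ _

  increasing-resp : ∀ {p p′ q} → p ≈ p′ → Increasing p q → Increasing p′ q
  increasing-resp {q = q} eq (increasing k vp vq w) = increasing k (λ i lt → trans (sym (eq i)) (vp i lt)) vq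
    (subst (0# <_) (cong₂ (λ a b → a * q k - b * q (suc k)) (eq (suc k)) (eq k)) w)

  -- The quotient is x, with derivative 1; the Wronskian at the order of q is the square of its
  -- leading coefficient.
  increasing-X : ∀ {q m} → Order q m → Increasing (X 1# q) q
  increasing-X {q} {zero} (v , nz) = increasing 0 (λ _ ()) v
    (subst (0# <_) (trans (cong (_* q 0) (sym (*-identityˡ _)))
      (solve 4 (λ θ a b u → u :* a :* a := (θ :* b :+ u :* a) :* a :- θ :* a :* b) refl θ (q 0) (q 1) 1#))
      (square-positive nz))
  increasing-X {q} {suc m} (v , nz) = increasing (suc m) vX v (subst (0# <_) eq (square-positive nz))
    where
      vX : Vanish (suc m) (X 1# q)
      vX zero _ = trans (cong (θ *_) (v 0 (s≤s z≤n))) (zeroʳ θ)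
      vX (suc i) lt = trans (cong₂ (λ a b → θ * a + 1# * b) (v (suc i) lt) (v i (ℕP.<⇒≤ lt)))
        (solve 2 (λ θ u → θ :* con (+ 0) :+ u :* con (+ 0) := con (+ 0)) refl θ 1#)
      eq : q (suc m) * q (suc m) ≡ X 1# q (suc (suc m)) * q (suc m) - X 1# q (suc m) * q (suc (suc m))
      eq rewrite v m ℕP.≤-refl = trans (cong (_* q (suc m)) (sym (*-identityˡ _)))
        (solve 4 (λ θ a b u → u :* a :* a := (θ :* b :+ u :* a) :* a :- (θ :* a :+ u :* con (+ 0)) :* b) refl
          θ (q (suc m)) (q (suc (suc m))) 1#)

  -- With f also -1/f increases locally, at zeros and poles as well: both have the same Wronskian.
  increasing-reciprocal : ∀ {p q} → Increasing p q → Increasing (λ k → - q k) p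
  increasing-reciprocal {p} {q} (increasing k vp vq w) = increasing k
    (λ i lt → trans (cong -_ (vq i lt)) (solve 0 (:- con (+ 0) := con (+ 0)) refl)) vp
    (subst (0# <_) (solve 4 (λ a b c d → a :* b :- c :* d := (:- d) :* c :- (:- b) :* a) refl
      (p (suc k)) (q k) (p k) (q (suc k))) w)

  increasing-∑ : ∀ {n p q} (h : Fin n → Series) → Increasing p q →
    (∀ v → (∀ k → h v k ≡ 0#) ⊎ Increasing (h v) q) → Increasing (λ k → p k + ∑ (λ v → h v k)) q
  increasing-∑ {zero} h P Q = increasing-resp (λ k → sym (+-identityʳ _)) P
  increasing-∑ {suc n} {p} {q} h P Q =
    increasing-resp (λ k → +-assoc _ _ _)
      (increasing-∑ {p = λ k → p k + h zero k} (λ v → h (suc v)) (first (Q zero)) (λ v → Q (suc v)))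
    where
      first : (∀ k → h zero k ≡ 0#) ⊎ Increasing (h zero) q → Increasing (λ k → p k + h zero k) q
      first (inj₁ z) = increasing-resp (λ k → sym (trans (cong (_+_ _) (z k)) (+-identityʳ _))) P
      first (inj₂ H) = increasing-+ P H

  -- When a and b are the multiplicities before and after deleting a vertex, the constructors are
  -- the statuses essential, neutral and positive, in this order.
  data Interlace (a b : ℕ) : Set where
    lower : a ≡ suc b → Interlace a b
    equal : a ≡ b → Interlace a b
    upper : b ≡ suc a → Interlace a b

  -- A non-zero Wronskian forbids that p and q both vanish at `common`. If one of them does, only
  -- one product of the Wronskian survives, and it forces the next coefficient of that series to be
  -- non-zero.
  increasing-interlace : ∀ {p q a b} → Increasing p q → Order p a → Order q b → Interlace a b
  increasing-interlace {p} {q} (increasing k vp vq w) op oq with q k ≟ 0# | p k ≟ 0#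
  ... | no qk≢0 | no pk≢0 = equal (trans (order-unique op (vp , pk≢0)) (order-unique (vq , qk≢0) oq))
  ... | no qk≢0 | yes pk≡0 = lower (trans (order-unique op
        ((λ i lt → [ vp i , (λ { refl → pk≡0 }) ]′ (ℕP.m<1+n⇒m<n∨m≡n lt)) , nz)) (cong suc (order-unique (vq , qk≢0) oq)))
    where
      nz : p (suc k) ≢ 0#
      nz z = 0<⇒≢0 w (trans (cong₂ (λ a b → a * q k - b * q (suc k)) z pk≡0)
        (solve 2 (λ a b → con (+ 0) :* a :- con (+ 0) :* b := con (+ 0)) refl _ _))
  ... | yes qk≡0 | no pk≢0 = upper (trans (order-unique oq
        ((λ i lt → [ vq i , (λ { refl → qk≡0 }) ]′ (ℕP.m<1+n⇒m<n∨m≡n lt)) , nz)) (cong suc (order-unique (vp , pk≢0) op)))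
    where
      nz : q (suc k) ≢ 0#
      nz z = 0<⇒≢0 w (trans (cong₂ (λ a b → p (suc k) * a - p k * b) qk≡0 z)
        (solve 2 (λ a b → a :* con (+ 0) :- b :* con (+ 0) := con (+ 0)) refl _ _))
  ... | yes qk≡0 | yes pk≡0 = ⊥-elim (0<⇒≢0 w (trans (cong₂ (λ a b → p (suc k) * a - b * q (suc k)) qk≡0 pk≡0)
        (solve 2 (λ a b → a :* con (+ 0) :- con (+ 0) :* b := con (+ 0)) refl _ _)))

  -- The residue of q / p at a zero of p is positive.
  increasing-residue : ∀ {p q j} → Increasing p q → Order p (suc j) → NonNegative (q j * p (suc j))
  increasing-residue {p} {q} {j} (increasing k vp vq w) (v , nz) with ℕP.<-cmp j k
  ... | tri< j<k _ _ = inj₁ (trans (cong (_* p (suc j)) (vq j j<k)) (zeroˡ _))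
  ... | tri≈ _ refl _ = inj₂ (subst (0# <_) (trans (cong (λ z → p (suc j) * q j - z * q (suc j)) (v j ℕP.≤-refl))
        (solve 3 (λ a b c → a :* b :- con (+ 0) :* c := b :* a) refl _ _ _)) w)
  ... | tri> _ _ k<j = ⊥-elim (0<⇒≢0 w (trans (cong₂ (λ a b → a * q k - b * q (suc k)) (v (suc k) (s≤s k<j)) (v k (ℕP.m<n⇒m<1+n k<j)))
        (solve 2 (λ a b → con (+ 0) :* a :- con (+ 0) :* b := con (+ 0)) refl _ _)))

-- Equality tests, finite sums of natural numbers and counting in lists.

module _ {n : ℕ} where

  eqᶠ-refl : ∀ (i : Fin n) → eqᶠ i i ≡ true
  eqᶠ-refl i = dec-true (i ≟ᶠ i) refl

  eqᶠ-≢ : ∀ {i j : Fin n} → i ≢ j → eqᶠ i j ≡ false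
  eqᶠ-≢ {i} {j} i≢j = dec-false (i ≟ᶠ j) i≢j

  eqᶠ-sym : ∀ (i j : Fin n) → eqᶠ i j ≡ eqᶠ j i
  eqᶠ-sym i j with i ≟ᶠ j
  ... | yes refl = sym (eqᶠ-refl i)
  ... | no i≢j = sym (eqᶠ-≢ (λ j≡i → i≢j (sym j≡i)))

  eqᶠ-true : ∀ {i j : Fin n} → eqᶠ i j ≡ true → i ≡ j
  eqᶠ-true {i} {j} eq with i ≟ᶠ j
  ... | yes i≡j = i≡j

∑ℕ : ∀ {n} → (Fin n → ℕ) → ℕ
∑ℕ {zero} h = 0
∑ℕ {suc n} h = h zero ℕ.+ ∑ℕ (λ i → h (suc i))

∑ℕ-cong : ∀ {n} {g h : Fin n → ℕ} → (∀ i → g i ≡ h i) → ∑ℕ g ≡ ∑ℕ h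
∑ℕ-cong {zero} eq = refl
∑ℕ-cong {suc n} eq = cong₂ ℕ._+_ (eq zero) (∑ℕ-cong (λ i → eq (suc i)))

∑ℕ-zero : ∀ {n} {h : Fin n → ℕ} → (∀ i → h i ≡ 0) → ∑ℕ h ≡ 0
∑ℕ-zero {zero} eq = refl
∑ℕ-zero {suc n} eq = cong₂ ℕ._+_ (eq zero) (∑ℕ-zero (λ i → eq (suc i)))

+-interchange : ∀ a b c d → (a ℕ.+ b) ℕ.+ (c ℕ.+ d) ≡ (a ℕ.+ c) ℕ.+ (b ℕ.+ d)
+-interchange = solve-∀

∑ℕ-distrib-+ : ∀ {n} (g h : Fin n → ℕ) → ∑ℕ (λ i → g i ℕ.+ h i) ≡ ∑ℕ g ℕ.+ ∑ℕ h
∑ℕ-distrib-+ {zero} g h = refl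
∑ℕ-distrib-+ {suc n} g h =
  trans (cong (g zero ℕ.+ h zero ℕ.+_) (∑ℕ-distrib-+ (λ i → g (suc i)) (λ i → h (suc i))))
    (+-interchange (g zero) (h zero) _ _)

∑ℕ-single : ∀ {n} (u : Fin n) (h : Fin n → ℕ) → ∑ℕ (λ i → if eqᶠ i u then h i else 0) ≡ h u
∑ℕ-single {suc n} zero h =
  trans (cong (h zero ℕ.+_) (∑ℕ-zero {n} (λ _ → refl))) (ℕP.+-identityʳ _)
∑ℕ-single (suc u) h = trans (∑ℕ-cong shift) (∑ℕ-single u (λ i → h (suc i)))
  where
    shift : ∀ i → (if eqᶠ (suc i) (suc u) then h (suc i) else 0) ≡ (if eqᶠ i u then h (suc i) else 0)
    shift i with i ≟ᶠ u
    ... | yes _ = refl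
    ... | no _ = refl

sumBy : {A : Set} → (A → ℕ) → List A → ℕ
sumBy g [] = 0
sumBy g (x ∷ xs) = g x ℕ.+ sumBy g xs

sumBy-cong : {A : Set} {g h : A → ℕ} → (∀ x → g x ≡ h x) → ∀ xs → sumBy g xs ≡ sumBy h xs
sumBy-cong eq [] = refl
sumBy-cong eq (x ∷ xs) = cong₂ ℕ._+_ (eq x) (sumBy-cong eq xs)

sumBy-zero : {A : Set} {h : A → ℕ} → (∀ x → h x ≡ 0) → ∀ xs → sumBy h xs ≡ 0
sumBy-zero eq [] = refl
sumBy-zero eq (x ∷ xs) = cong₂ ℕ._+_ (eq x) (sumBy-zero eq xs)

sumBy-distrib-+ : {A : Set} (g h : A → ℕ) → ∀ xs →
  sumBy (λ x → g x ℕ.+ h x) xs ≡ sumBy g xs ℕ.+ sumBy h xs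
sumBy-distrib-+ g h [] = refl
sumBy-distrib-+ g h (x ∷ xs) =
  trans (cong (_ ℕ.+_) (sumBy-distrib-+ g h xs)) (+-interchange (g x) (h x) _ _)

sumBy-++ : {A : Set} (g : A → ℕ) → ∀ xs ys → sumBy g (xs ++ ys) ≡ sumBy g xs ℕ.+ sumBy g ys
sumBy-++ g [] ys = refl
sumBy-++ g (x ∷ xs) ys = trans (cong (g x ℕ.+_) (sumBy-++ g xs ys)) (sym (ℕP.+-assoc (g x) _ _))

sumBy-concatMap : {A B : Set} (g : B → ℕ) (f : A → List B) → ∀ xs →
  sumBy g (concatMap f xs) ≡ sumBy (λ x → sumBy g (f x)) xs
sumBy-concatMap g f [] = refl
sumBy-concatMap g f (x ∷ xs) =
  trans (sumBy-++ g (f x) (concatMap f xs)) (cong (sumBy g (f x) ℕ.+_) (sumBy-concatMap g f xs))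

sumBy-tabulate : {A : Set} (g : A → ℕ) → ∀ {n} (f : Fin n → A) → sumBy g (tabulate f) ≡ ∑ℕ (λ i → g (f i))
sumBy-tabulate g {zero} f = refl
sumBy-tabulate g {suc n} f = cong (g (f zero) ℕ.+_) (sumBy-tabulate g (λ i → f (suc i)))

module _ {A : Set} where

  countᵇ : (A → Bool) → List A → ℕ
  countᵇ P xs = length (filterᵇ P xs)

  countᵇ-∷ : ∀ P x xs → countᵇ P (x ∷ xs) ≡ (if P x then 1 else 0) ℕ.+ countᵇ P xs
  countᵇ-∷ P x xs with P x
  ... | true = refl
  ... | false = refl

  countᵇ-cong : ∀ {P Q : A → Bool} → (∀ x → P x ≡ Q x) → ∀ xs → countᵇ P xs ≡ countᵇ Q xs
  countᵇ-cong eq [] = refl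
  countᵇ-cong {P} {Q} eq (x ∷ xs) = trans (countᵇ-∷ P x xs) (trans
    (cong₂ (λ b k → (if b then 1 else 0) ℕ.+ k) (eq x) (countᵇ-cong eq xs)) (sym (countᵇ-∷ Q x xs)))

  countᵇ-false : ∀ {P : A → Bool} → (∀ x → P x ≡ false) → ∀ xs → countᵇ P xs ≡ 0
  countᵇ-false eq [] = refl
  countᵇ-false {P} eq (x ∷ xs) = trans (countᵇ-∷ P x xs)
    (cong₂ (λ b k → (if b then 1 else 0) ℕ.+ k) (eq x) (countᵇ-false eq xs))

  countᵇ-++ : ∀ P xs ys → countᵇ P (xs ++ ys) ≡ countᵇ P xs ℕ.+ countᵇ P ys
  countᵇ-++ P [] ys = refl
  countᵇ-++ P (x ∷ xs) ys = trans (countᵇ-∷ P x (xs ++ ys)) (trans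
    (cong ((if P x then 1 else 0) ℕ.+_) (countᵇ-++ P xs ys)) (trans (sym (ℕP.+-assoc (if P x then 1 else 0) (countᵇ P xs) (countᵇ P ys)))
    (cong (ℕ._+ countᵇ P ys) (sym (countᵇ-∷ P x xs)))))

  countᵇ-map : ∀ P (f : A → A) xs → countᵇ P (map f xs) ≡ countᵇ (λ x → P (f x)) xs
  countᵇ-map P f [] = refl
  countᵇ-map P f (x ∷ xs) = trans (countᵇ-∷ P (f x) (map f xs)) (trans
    (cong (_ ℕ.+_) (countᵇ-map P f xs)) (sym (countᵇ-∷ (λ y → P (f y)) x xs)))

  countᵇ-sumBy : ∀ P xs → countᵇ P xs ≡ sumBy (λ x → if P x then 1 else 0) xs
  countᵇ-sumBy P [] = refl
  countᵇ-sumBy P (x ∷ xs) = trans (countᵇ-∷ P x xs) (cong (_ ℕ.+_) (countᵇ-sumBy P xs))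

  all-∧ : ∀ (p q : A → Bool) xs → all (λ x → p x ∧ q x) xs ≡ all p xs ∧ all q xs
  all-∧ p q [] = refl
  all-∧ p q (x ∷ xs) rewrite all-∧ p q xs with p x | q x
  ... | true | true = refl
  ... | true | false = sym (BoolP.∧-zeroʳ (all p xs))
  ... | false | _ = refl

-- Counting matchings along a list of edges.

module _ {n : ℕ} where

  Edge : Set
  Edge = Fin n × Fin n

  -- The number of r-matchings in L all of whose edges satisfy q.
  matchings : (Edge → Bool) → List Edge → ℕ → ℕ
  matchings q L zero = 1
  matchings q [] (suc r) = 0
  matchings q (e ∷ L) (suc r) =
    matchings q L (suc r) ℕ.+ (if q e then matchings (λ f → q f ∧ disjointE e f) L r else 0)

  matchings-cong : ∀ {q q′ : Edge → Bool} → (∀ e → q e ≡ q′ e) → ∀ L r → matchings q L r ≡ matchings q′ L r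
  matchings-cong eq L zero = refl
  matchings-cong eq [] (suc r) = refl
  matchings-cong eq (e ∷ L) (suc r) = cong₂ ℕ._+_ (matchings-cong eq L (suc r))
    (cong₂ (λ b k → if b then k else 0) (eq e)
      (matchings-cong (λ f → cong (_∧ disjointE e f) (eq f)) L r))

  matchings-empty : ∀ {q : Edge → Bool} → (∀ e → q e ≡ false) → ∀ L r → matchings q L (suc r) ≡ 0
  matchings-empty eq [] r = refl
  matchings-empty eq (e ∷ L) r rewrite eq e = trans (ℕP.+-identityʳ _) (matchings-empty eq L r)

  matchings-filter : ∀ (p q : Edge → Bool) L r → matchings q (filterᵇ p L) r ≡ matchings (λ e → p e ∧ q e) L r
  matchings-filter p q L zero = refl
  matchings-filter p q [] (suc r) = refl
  matchings-filter p q (e ∷ L) (suc r) with p e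
  ... | false = trans (matchings-filter p q L (suc r)) (sym (ℕP.+-identityʳ _))
  ... | true = cong₂ ℕ._+_ (matchings-filter p q L (suc r))
    (cong (λ k → if q e then k else 0) (trans (matchings-filter p _ L r)
      (matchings-cong (λ f → sym (BoolP.∧-assoc (p f) (q f) _)) L r)))

  -- The predicate q records what the edges chosen so far demand of the later ones. Choosing e
  -- strengthens it by `disjointE e`, which is exactly the condition `isMatching` imposes on the
  -- rest.
  sublists-matchings : ∀ q L r →
    countᵇ (λ M → (length M ≡ᵇ r) ∧ (all q M ∧ isMatching M)) (sublists {n} L) ≡ matchings q L r
  sublists-matchings q [] zero = refl
  sublists-matchings q [] (suc r) = refl
  sublists-matchings q (e ∷ L) r =
    trans (countᵇ-++ _ (sublists {n} L) (map (e ∷_) (sublists {n} L)))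
      (trans (cong₂ ℕ._+_ (sublists-matchings q L r) (countᵇ-map _ (e ∷_) (sublists {n} L))) (with-e r))
    where
      with-e : ∀ r → matchings q L r ℕ.+ countᵇ (λ M → (suc (length M) ≡ᵇ r) ∧
                 ((q e ∧ all q M) ∧ (all (disjointE e) M ∧ isMatching M))) (sublists {n} L)
               ≡ matchings q (e ∷ L) r
      with-e zero = cong suc (countᵇ-false (λ _ → refl) (sublists {n} L))
      with-e (suc r) with q e
      ... | false = cong (matchings q L (suc r) ℕ.+_)
                      (countᵇ-false (λ M → BoolP.∧-zeroʳ (length M ≡ᵇ r)) (sublists {n} L))
      ... | true = cong (matchings q L (suc r) ℕ.+_) (trans
        (countᵇ-cong (λ M → cong ((length M ≡ᵇ r) ∧_) (trans (sym (BoolP.∧-assoc (all q M) _ _))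
            (cong (_∧ isMatching M) (sym (all-∧ q (disjointE e) M))))) (sublists {n} L))
        (sublists-matchings (λ f → q f ∧ disjointE e f) L r))

  disjointE-sym : ∀ (e f : Edge) → disjointE e f ≡ disjointE f e
  disjointE-sym (a , b) (c , d)
    rewrite eqᶠ-sym a c | eqᶠ-sym a d | eqᶠ-sym b c | eqᶠ-sym b d
    with eqᶠ c a | eqᶠ d a | eqᶠ c b
  ... | true | _ | _ = refl
  ... | false | true | true = refl
  ... | false | true | false = refl
  ... | false | false | true = refl
  ... | false | false | false = refl

  incident : Fin n → Edge → Bool
  incident u (a , b) = eqᶠ a u ∨ eqᶠ b u

  incident-disjoint : ∀ u e f → incident u e ≡ true → incident u f ≡ true → disjointE e f ≡ false
  incident-disjoint u (a , b) (c , d) p q with a ≟ᶠ u | b ≟ᶠ u | c ≟ᶠ u | d ≟ᶠ u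
  ... | yes refl | _ | yes refl | _ rewrite eqᶠ-refl a = refl
  ... | yes refl | _ | no _ | yes refl rewrite eqᶠ-refl a | BoolP.∨-zeroʳ (eqᶠ a c) = refl
  ... | no _ | yes refl | yes refl | _ rewrite eqᶠ-refl b | BoolP.∨-zeroʳ (eqᶠ a d) | BoolP.∨-zeroʳ (eqᶠ a b) = refl
  ... | no _ | yes refl | no _ | yes refl
    rewrite eqᶠ-refl b | BoolP.∨-zeroʳ (eqᶠ b c) | BoolP.∨-zeroʳ (eqᶠ a b) | BoolP.∨-zeroʳ (eqᶠ a c) = refl

  private
    extension : (Edge → Bool) → Edge → List Edge → ℕ → ℕ
    extension q e L zero = 0
    extension q e L (suc r) = if q e then matchings (λ f → q f ∧ disjointE e f) L r else 0

    matchings-∷ : ∀ q e L r → matchings q (e ∷ L) r ≡ matchings q L r ℕ.+ extension q e L r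
    matchings-∷ q e L zero = refl
    matchings-∷ q e L (suc r) = refl

    extension-false : ∀ q e L r → q e ≡ false → extension q e L r ≡ 0
    extension-false q e L zero eq = refl
    extension-false q e L (suc r) eq rewrite eq = refl

    if-zero : ∀ b {k} → (b ≡ true → k ≡ 0) → (if b then k else 0) ≡ 0
    if-zero true f = f refl
    if-zero false f = refl

  -- Two edges at u are never disjoint, so a matching contains at most one of them; matchings are
  -- sorted by that edge, if there is one.
  matchings-vertex : ∀ q u L r → matchings q L (suc r) ≡
    matchings (λ e → q e ∧ not (incident u e)) L (suc r) ℕ.+
    sumBy (λ e → if incident u e ∧ q e then matchings (λ f → q f ∧ disjointE e f) L r else 0) L
  matchings-vertex q u [] r = refl
  matchings-vertex q u (e ∷ L) r = begin
    matchings q L (suc r) ℕ.+ N₀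
      ≡⟨ cong (ℕ._+ N₀) (matchings-vertex q u L r) ⟩
    (M ℕ.+ A) ℕ.+ N₀
      ≡⟨ cong ((M ℕ.+ A) ℕ.+_) (key r) ⟩
    (M ℕ.+ A) ℕ.+ ((N₁ r ℕ.+ N₂ r) ℕ.+ B r)
      ≡⟨ rearrange M A (N₁ r) (N₂ r) (B r) ⟩
    (M ℕ.+ N₁ r) ℕ.+ (N₂ r ℕ.+ (A ℕ.+ B r))
      ≡⟨ cong (λ k → (M ℕ.+ N₁ r) ℕ.+ (N₂ r ℕ.+ k)) (sumBy-distrib-+ _ _ L) ⟨
    (M ℕ.+ N₁ r) ℕ.+ (N₂ r ℕ.+ sumBy (λ f → term L r f ℕ.+ extra r f) L)
      ≡⟨ cong (λ k → (M ℕ.+ N₁ r) ℕ.+ (N₂ r ℕ.+ k)) (sumBy-cong split L) ⟨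
    (M ℕ.+ N₁ r) ℕ.+ (N₂ r ℕ.+ sumBy (term (e ∷ L) r) L) ∎
    where
      open ≡-Reasoning
      term : List Edge → ℕ → Edge → ℕ
      term L′ r f = if incident u f ∧ q f then matchings (λ g → q g ∧ disjointE f g) L′ r else 0
      extra : ℕ → Edge → ℕ
      extra r f = if incident u f ∧ q f then extension (λ g → q g ∧ disjointE f g) e L r else 0
      -- `N₀` counts the matchings through the head e. Among these, `N₁` counts those that avoid u,
      -- `N₂` those in which e itself covers u, and `B` those in which a later edge covers u.
      N₀ = if q e then matchings (λ f → q f ∧ disjointE e f) L r else 0
      N₁ N₂ B : ℕ → ℕ
      N₁ r = if q e ∧ not (incident u e) then matchings (λ f → (q f ∧ not (incident u f)) ∧ disjointE e f) L r else 0
      N₂ r = term (e ∷ L) r e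
      B r = sumBy (extra r) L
      M = matchings (λ e → q e ∧ not (incident u e)) L (suc r)
      A = sumBy (term L r) L
      rearrange : ∀ m a p q b → (m ℕ.+ a) ℕ.+ ((p ℕ.+ q) ℕ.+ b) ≡ (m ℕ.+ p) ℕ.+ (q ℕ.+ (a ℕ.+ b))
      rearrange = solve-∀
      split : ∀ f → term (e ∷ L) r f ≡ term L r f ℕ.+ extra r f
      split f with incident u f ∧ q f
      ... | true = matchings-∷ (λ g → q g ∧ disjointE f g) e L r
      ... | false = refl
      extra-zero : (∀ f → incident u f ≡ true → q e ∧ disjointE f e ≡ false) → ∀ r → B r ≡ 0
      extra-zero h r = sumBy-zero (λ f → if-zero (incident u f ∧ q f)
        (λ t → extension-false (λ g → q g ∧ disjointE f g) e L r
           (h f (BoolP.∧-conicalˡ (incident u f) (q f) t)))) L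
      key : ∀ r → (if q e then matchings (λ f → q f ∧ disjointE e f) L r else 0) ≡ (N₁ r ℕ.+ N₂ r) ℕ.+ B r
      key r with q e in qe | incident u e in ie
      ... | false | true = sym (extra-zero (λ f _ → cong (_∧ disjointE f e) qe) r)
      ... | false | false = sym (extra-zero (λ f _ → cong (_∧ disjointE f e) qe) r)
      -- The list in `N₂` still starts with e, which adds nothing since e is not disjoint from
      -- itself; `B` is zero because e already covers u.
      ... | true | true = sym (trans (cong₂ ℕ._+_ (trans (matchings-∷ _ e L r)
          (cong (matchings (λ f → q f ∧ disjointE e f) L r ℕ.+_)
            (extension-false (λ f → q f ∧ disjointE e f) e L r
              (trans (cong (q e ∧_) (incident-disjoint u e e ie ie)) (BoolP.∧-zeroʳ (q e))))))
          (extra-zero (λ f uf → trans (cong (q e ∧_) (incident-disjoint u f e uf ie)) (BoolP.∧-zeroʳ (q e))) r))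
          (trans (ℕP.+-identityʳ _) (ℕP.+-identityʳ _)))
      key zero | true | false = sym (cong suc (sumBy-zero (λ f → if-zero (incident u f ∧ q f) (λ _ → refl)) L))
      key (suc r) | true | false = trans (matchings-vertex (λ f → q f ∧ disjointE e f) u L r)
        (cong₂ ℕ._+_ (trans (matchings-cong (λ f → shuffle (q f) (disjointE e f) (not (incident u f))) L (suc r))
                       (sym (ℕP.+-identityʳ _)))
          (sumBy-cong match L))
        where
          shuffle : ∀ a b c → (a ∧ b) ∧ c ≡ (a ∧ c) ∧ b
          shuffle false b c = refl
          shuffle true b c = BoolP.∧-comm b c
          match : ∀ f → (if incident u f ∧ (q f ∧ disjointE e f)
                           then matchings (λ g → (q g ∧ disjointE e g) ∧ disjointE f g) L r else 0)
                        ≡ extra (suc r) f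
          match f rewrite qe | disjointE-sym f e with incident u f | q f | disjointE e f
          ... | false | _ | _ = refl
          ... | true | false | _ = refl
          ... | true | true | false = refl
          ... | true | true | true =
            matchings-cong (λ g → shuffle (q g) (disjointE e g) (disjointE f g)) L r

-- Vertex deletion and the size of a vertex set.

∧-true : ∀ {a b} → a ∧ b ≡ true → a ≡ true × b ≡ true
∧-true {true} {true} _ = refl , refl

false≢true : ∀ {a : Set} {b} → b ≡ false → b ≡ true → a
false≢true refl ()

≡ᵇ-true : ∀ {a b} → (a ≡ᵇ b) ≡ true → a ≡ b
≡ᵇ-true {a} {b} t = ℕP.≡ᵇ⇒≡ a b (subst Data.Bool.T (sym t) _)

≡ᵇ-intro : ∀ {a b} → a ≡ b → (a ≡ᵇ b) ≡ true
≡ᵇ-intro {a} {b} eq = dec-true (a ℕP.≟ b) eq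

module _ {n : ℕ} where

  del-self : ∀ (S : Mask n) u → del S u u ≡ false
  del-self S u rewrite eqᶠ-refl u = BoolP.∧-zeroʳ (S u)

  del-≢ : ∀ (S : Mask n) {u i} → i ≢ u → del S u i ≡ S i
  del-≢ S {u} {i} i≢u rewrite eqᶠ-≢ i≢u = BoolP.∧-identityʳ (S i)

  del-keep : ∀ (S : Mask n) {u i} → i ≢ u → S i ≡ true → del S u i ≡ true
  del-keep S i≢u Si = trans (del-≢ S i≢u) Si

  del-∈ : ∀ (S : Mask n) {u i} → del S u i ≡ true → S i ≡ true × i ≢ u
  del-∈ S {u} {i} t = proj₁ (∧-true t) , λ { refl → false≢true (del-self S u) t }

  del-cong : ∀ {S S′ : Mask n} → (∀ i → S i ≡ S′ i) → ∀ u i → del S u i ≡ del S′ u i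
  del-cong eq u i = cong (_∧ not (eqᶠ i u)) (eq i)

  del-swap : ∀ (S : Mask n) u v i → del (del S u) v i ≡ del (del S v) u i
  del-swap S u v i = trans (BoolP.∧-assoc (S i) _ _) (trans
    (cong (S i ∧_) (BoolP.∧-comm (not (eqᶠ i u)) _)) (sym (BoolP.∧-assoc (S i) _ _)))

  empty-or-∈ : ∀ (S : Mask n) → (∃ λ u → S u ≡ true) ⊎ (∀ u → S u ≡ false)
  empty-or-∈ S with FinP.any? (λ u → S u BoolP.≟ true)
  ... | yes p = inj₁ p
  ... | no ¬p = inj₂ λ u → BoolP.¬-not (λ t → ¬p (u , t))

  size-∑ : ∀ (S : Mask n) → size S ≡ ∑ℕ (λ i → if S i then 1 else 0)
  size-∑ S = trans (countᵇ-sumBy S (allFin n)) (sumBy-tabulate (λ i → if S i then 1 else 0) (λ i → i))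

  size-cong : ∀ {S S′ : Mask n} → (∀ i → S i ≡ S′ i) → size S ≡ size S′
  size-cong eq = countᵇ-cong eq (allFin n)

  size-empty : ∀ {S : Mask n} → (∀ i → S i ≡ false) → size S ≡ 0
  size-empty eq = countᵇ-false eq (allFin n)

  size-del : ∀ (S : Mask n) u → S u ≡ true → size S ≡ suc (size (del S u))
  size-del S u Su = begin
    size S                                              ≡⟨ size-∑ S ⟩
    ∑ℕ (λ i → if S i then 1 else 0)                     ≡⟨ ∑ℕ-cong split ⟩
    ∑ℕ (λ i → (if eqᶠ i u then 1 else 0) ℕ.+ (if del S u i then 1 else 0))
      ≡⟨ ∑ℕ-distrib-+ (λ i → if eqᶠ i u then 1 else 0) (λ i → if del S u i then 1 else 0) ⟩
    ∑ℕ (λ i → if eqᶠ i u then 1 else 0) ℕ.+ ∑ℕ (λ i → if del S u i then 1 else 0)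
      ≡⟨ cong₂ ℕ._+_ (∑ℕ-single u (λ _ → 1)) (sym (size-∑ (del S u))) ⟩
    suc (size (del S u)) ∎
    where
      open ≡-Reasoning
      split : ∀ i → (if S i then 1 else 0) ≡ (if eqᶠ i u then 1 else 0) ℕ.+ (if del S u i then 1 else 0)
      split i with i ≟ᶠ u
      ... | yes refl rewrite Su = refl
      ... | no _ rewrite BoolP.∧-identityʳ (S i) = refl

  size-zero : ∀ (S : Mask n) → size S ≡ 0 → ∀ u → S u ≡ false
  size-zero S eq u with S u in Su
  ... | false = refl
  ... | true with trans (sym eq) (size-del S u Su)
  ...   | ()

-- Matching numbers of induced subgraphs and their vertex recurrence.

module _ {n : ℕ} (adj : Adj n) where

  inside : Mask n → Edge → Bool
  inside S (i , j) = S i ∧ S j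

  private
    filterᵇ-concatMap : ∀ {A B : Set} (p : B → Bool) (f : A → List B) xs →
      filterᵇ p (concatMap f xs) ≡ concatMap (λ x → filterᵇ p (f x)) xs
    filterᵇ-concatMap p f [] = refl
    filterᵇ-concatMap p f (x ∷ xs) = trans (ListP.filter-++ _ (f x) (concatMap f xs))
      (cong (filterᵇ p (f x) ++_) (filterᵇ-concatMap p f xs))

  -- All induced subgraphs come to share the edge list of the whole graph; the vertex set moves into
  -- the predicate, where deleting a vertex is easy to follow.
  edges-filter : ∀ S → edges adj S ≡ filterᵇ (inside S) (edges adj full)
  edges-filter S = sym (trans (filterᵇ-concatMap (inside S) _ (allFin n)) (ListP.concatMap-cong
    (λ i → trans (filterᵇ-concatMap (inside S) _ (allFin n)) (ListP.concatMap-cong (cell i) (allFin n))) (allFin n)))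
    where
      cell : ∀ i j → filterᵇ (inside S) (if adj i j ∧ (toℕ i <ᵇ toℕ j) then (i , j) ∷ [] else []) ≡
        (if S i ∧ S j ∧ adj i j ∧ (toℕ i <ᵇ toℕ j) then (i , j) ∷ [] else [])
      cell i j with adj i j ∧ (toℕ i <ᵇ toℕ j)
      ... | false rewrite BoolP.∧-zeroʳ (S j) | BoolP.∧-zeroʳ (S i) = refl
      ... | true rewrite BoolP.∧-identityʳ (S j) with S i ∧ S j
      ...   | true = refl
      ...   | false = refl

  pMatch-matchings : ∀ S r → pMatch adj S r ≡ matchings (inside S) (edges adj full) r
  pMatch-matchings S r = begin
    pMatch adj S r
      ≡⟨ countᵇ-cong (λ M → cong ((length M ≡ᵇ r) ∧_) (cong (_∧ isMatching M) (sym (all-true M))))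
           (sublists {n} (edges adj S)) ⟩
    countᵇ (λ M → (length M ≡ᵇ r) ∧ (all (λ _ → true) M ∧ isMatching M)) (sublists {n} (edges adj S))
      ≡⟨ sublists-matchings (λ _ → true) (edges adj S) r ⟩
    matchings (λ _ → true) (edges adj S) r
      ≡⟨ cong (λ L → matchings (λ _ → true) L r) (edges-filter S) ⟩
    matchings (λ _ → true) (filterᵇ (inside S) (edges adj full)) r
      ≡⟨ matchings-filter (inside S) (λ _ → true) (edges adj full) r ⟩
    matchings (λ e → inside S e ∧ true) (edges adj full) r
      ≡⟨ matchings-cong (λ e → BoolP.∧-identityʳ (inside S e)) (edges adj full) r ⟩
    matchings (inside S) (edges adj full) r ∎
    where
      open ≡-Reasoning
      all-true : ∀ (M : List Edge) → all (λ _ → true) M ≡ true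
      all-true [] = refl
      all-true (e ∷ M) = all-true M

  pMatch-zero : ∀ S → pMatch adj S 0 ≡ 1
  pMatch-zero S = pMatch-matchings S 0

  pMatch-empty : ∀ {S} → (∀ u → S u ≡ false) → ∀ r → pMatch adj S (suc r) ≡ 0
  pMatch-empty {S} eq r = trans (pMatch-matchings S (suc r))
    (matchings-empty (λ { (i , j) → cong (_∧ S j) (eq i) }) (edges adj full) r)

  module _ (symmetric : ∀ u v → adj u v ≡ adj v u) (irreflexive : ∀ u → adj u u ≡ false) where

    -- An (r+1)-matching either avoids u or consists of one edge u v and an r-matching that avoids
    -- both ends. What remains is to turn the sum over listed edges at u into a sum over neighbours.
    pMatch-vertex : ∀ S u r → S u ≡ true → pMatch adj S (suc r) ≡
      pMatch adj (del S u) (suc r) ℕ.+ ∑ℕ (λ v → if S v ∧ adj u v then pMatch adj (del (del S u) v) r else 0)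
    pMatch-vertex S u r Su = begin
      pMatch adj S (suc r)
        ≡⟨ pMatch-matchings S (suc r) ⟩
      matchings (inside S) L (suc r)
        ≡⟨ matchings-vertex (inside S) u L r ⟩
      matchings (λ e → inside S e ∧ not (incident u e)) L (suc r) ℕ.+ sumBy g L
        ≡⟨ cong₂ ℕ._+_ (trans (matchings-cong (λ { (i , j) → delete-vertex (S i) (S j) (eqᶠ i u) (eqᶠ j u) }) L (suc r))
             (sym (pMatch-matchings (del S u) (suc r)))) sum-edges ⟩
      pMatch adj (del S u) (suc r) ℕ.+ ∑ℕ (λ v → if S v ∧ adj u v then pMatch adj (del (del S u) v) r else 0) ∎
      where
        open ≡-Reasoning
        L = edges adj full
        g : Edge → ℕ
        g e = if incident u e ∧ inside S e then matchings (λ f → inside S f ∧ disjointE e f) L r else 0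
        delete-vertex : ∀ a b c d → (a ∧ b) ∧ not (c ∨ d) ≡ (a ∧ not c) ∧ (b ∧ not d)
        delete-vertex false b c d = refl
        delete-vertex true b true d = BoolP.∧-zeroʳ b
        delete-vertex true b false d = refl
        p : Fin n → ℕ
        p v = pMatch adj (del (del S u) v) r
        -- Each edge is listed once, smaller end first: `out` collects the edges at u in which u
        -- comes first, `into` those in which it comes second. For each neighbour exactly one of the
        -- two is present.
        out into : Fin n → ℕ
        out j = if S j ∧ adj u j ∧ (toℕ u <ᵇ toℕ j) then p j else 0
        into i = if S i ∧ adj u i ∧ (toℕ i <ᵇ toℕ u) then p i else 0
        cell : Fin n → Fin n → ℕ
        cell i j = if adj i j ∧ (toℕ i <ᵇ toℕ j) then g (i , j) else 0
        reorder : ∀ c d a b x y → (a ∧ b) ∧ not (x ∨ y ∨ c ∨ d) ≡ ((a ∧ not x) ∧ not c) ∧ ((b ∧ not y) ∧ not d)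
        reorder c d false b x y = refl
        reorder c d true b true y = BoolP.∧-zeroʳ b
        reorder c d true false false true = sym (BoolP.∧-zeroʳ (not c))
        reorder c d true true false true = sym (BoolP.∧-zeroʳ (not c))
        reorder true d true false false false = refl
        reorder false d true false false false = refl
        reorder true d true true false false = refl
        reorder false d true true false false = refl
        at-out : ∀ j → matchings (λ f → inside S f ∧ disjointE (u , j) f) L r ≡ p j
        at-out j = trans (matchings-cong (λ { (c , d) → trans
            (cong (λ z → (S c ∧ S d) ∧ not z) (cong₂ _∨_ (eqᶠ-sym u c) (cong₂ _∨_ (eqᶠ-sym u d)
               (cong₂ _∨_ (eqᶠ-sym j c) (eqᶠ-sym j d)))))
            (reorder (eqᶠ c j) (eqᶠ d j) (S c) (S d) (eqᶠ c u) (eqᶠ d u)) }) L r)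
          (sym (pMatch-matchings (del (del S u) j) r))
        at-into : ∀ i → matchings (λ f → inside S f ∧ disjointE (i , u) f) L r ≡ p i
        at-into i = trans (matchings-cong (λ f → cong (inside S f ∧_) (swap-ends f)) L r) (at-out i)
          where
            ∨-swap : ∀ a b c d → a ∨ b ∨ c ∨ d ≡ c ∨ d ∨ a ∨ b
            ∨-swap a b c d = trans (sym (BoolP.∨-assoc a b (c ∨ d))) (trans (BoolP.∨-comm (a ∨ b) (c ∨ d)) (BoolP.∨-assoc c d (a ∨ b)))
            swap-ends : ∀ f → disjointE (i , u) f ≡ disjointE (u , i) f
            swap-ends (c , d) = cong not (∨-swap (eqᶠ i c) (eqᶠ i d) (eqᶠ u c) (eqᶠ u d))
        cell-split : ∀ i j → cell i j ≡ (if eqᶠ i u then out j else 0) ℕ.+ (if eqᶠ j u then into i else 0)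
        cell-split i j with i ≟ᶠ u | j ≟ᶠ u
        ... | yes refl | yes refl rewrite irreflexive i | BoolP.∧-zeroʳ (S i) = refl
        ... | no _ | no _ with adj i j ∧ (toℕ i <ᵇ toℕ j)
        ...   | true = refl
        ...   | false = refl
        cell-split i j | yes refl | no _ rewrite Su | at-out j with adj i j ∧ (toℕ i <ᵇ toℕ j) | S j
        ...   | true | true = sym (ℕP.+-identityʳ _)
        ...   | true | false = refl
        ...   | false | true = refl
        ...   | false | false = refl
        cell-split i j | no _ | yes refl rewrite Su | at-into i | symmetric j i
          with adj i j ∧ (toℕ i <ᵇ toℕ j) | S i
        ...   | true | true = refl
        ...   | true | false = refl
        ...   | false | true = refl
        ...   | false | false = refl
        vertex-split : ∀ v → out v ℕ.+ into v ≡ (if S v ∧ adj u v then p v else 0)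
        vertex-split v with S v | adj u v in uv
        ... | false | _ = refl
        ... | true | false = refl
        ... | true | true with ℕP.<-cmp (toℕ u) (toℕ v)
        ...   | tri< lt _ ≯ rewrite dec-true (toℕ u ℕP.<? toℕ v) lt | dec-false (toℕ v ℕP.<? toℕ u) ≯ = ℕP.+-identityʳ _
        ...   | tri> ≮ _ gt rewrite dec-false (toℕ u ℕP.<? toℕ v) ≮ | dec-true (toℕ v ℕP.<? toℕ u) gt = refl
        ...   | tri≈ _ eq _ with FinP.toℕ-injective eq
        ...     | refl = false≢true (irreflexive u) uv
        sum-cell : ∀ b e → sumBy g (if b then e ∷ [] else []) ≡ (if b then g e else 0)
        sum-cell true e = ℕP.+-identityʳ _
        sum-cell false e = refl
        if-distrib-∑ : ∀ b (h : Fin n → ℕ) → ∑ℕ (λ j → if b then h j else 0) ≡ (if b then ∑ℕ h else 0)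
        if-distrib-∑ true h = refl
        if-distrib-∑ false h = ∑ℕ-zero {n} (λ _ → refl)
        entry : Fin n → Fin n → List Edge
        entry i j = if adj i j ∧ (toℕ i <ᵇ toℕ j) then (i , j) ∷ [] else []
        row : Fin n → List Edge
        row i = concatMap (entry i) (allFin n)
        sum-edges : sumBy g L ≡ ∑ℕ (λ v → if S v ∧ adj u v then p v else 0)
        sum-edges = begin
          sumBy g L
            ≡⟨ sumBy-concatMap g row (allFin n) ⟩
          sumBy (λ i → sumBy g (row i)) (allFin n)
            ≡⟨ sumBy-tabulate (λ i → sumBy g (row i)) (λ i → i) ⟩
          ∑ℕ (λ i → sumBy g (row i))
            ≡⟨ ∑ℕ-cong (λ i → trans (sumBy-concatMap g (entry i) (allFin n))
                 (trans (sumBy-tabulate (λ j → sumBy g (entry i j)) (λ j → j))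
                 (∑ℕ-cong (λ j → trans (sum-cell (adj i j ∧ (toℕ i <ᵇ toℕ j)) (i , j)) (cell-split i j))))) ⟩
          ∑ℕ (λ i → ∑ℕ (λ j → (if eqᶠ i u then out j else 0) ℕ.+ (if eqᶠ j u then into i else 0)))
            ≡⟨ ∑ℕ-cong (λ i → trans (∑ℕ-distrib-+ (λ j → if eqᶠ i u then out j else 0) (λ j → if eqᶠ j u then into i else 0))
                 (cong₂ ℕ._+_ (if-distrib-∑ (eqᶠ i u) out) (∑ℕ-single u (λ _ → into i)))) ⟩
          ∑ℕ (λ i → (if eqᶠ i u then ∑ℕ out else 0) ℕ.+ into i)
            ≡⟨ ∑ℕ-distrib-+ (λ i → if eqᶠ i u then ∑ℕ out else 0) into ⟩
          ∑ℕ (λ i → if eqᶠ i u then ∑ℕ out else 0) ℕ.+ ∑ℕ into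
            ≡⟨ cong (ℕ._+ ∑ℕ into) (∑ℕ-single u (λ _ → ∑ℕ out)) ⟩
          ∑ℕ out ℕ.+ ∑ℕ into
            ≡⟨ ∑ℕ-distrib-+ out into ⟨
          ∑ℕ (λ v → out v ℕ.+ into v)
            ≡⟨ ∑ℕ-cong vertex-split ⟩
          ∑ℕ (λ v → if S v ∧ adj u v then p v else 0) ∎

    neighbour-≢ : ∀ {u v} → adj u v ≡ true → v ≢ u
    neighbour-≢ {u} uv refl = false≢true (irreflexive u) uv

    size-del-neighbour : ∀ S u v → S u ≡ true → S v ∧ adj u v ≡ true →
      size S ≡ suc (suc (size (del (del S u) v)))
    size-del-neighbour S u v Su t = trans (size-del S u Su)
      (cong suc (size-del (del S u) v (del-keep S (neighbour-≢ (proj₂ (∧-true t))) (proj₁ (∧-true t)))))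

    -- An r-matching covers 2r vertices. The recurrence removes two vertices for each edge, so the
    -- strict inequality is inherited.
    pMatch-vanish : ∀ N S r → size S ≡ N → N ℕ.< r ℕ.+ r → pMatch adj S r ≡ 0
    pMatch-vanish N S (suc r) sz lt with empty-or-∈ S
    ... | inj₂ none = pMatch-empty none r
    ... | inj₁ (u , Su) with trans (sym (size-del S u Su)) sz
    pMatch-vanish (suc N) S (suc r) sz lt | inj₁ (u , Su) | eq =
      trans (pMatch-vertex S u r Su) (cong₂ ℕ._+_
        (pMatch-vanish N (del S u) (suc r) (ℕP.suc-injective eq) (ℕP.<⇒≤ lt)) (∑ℕ-zero zero-term))
      where
        zero-term : ∀ v → (if S v ∧ adj u v then pMatch adj (del (del S u) v) r else 0) ≡ 0
        zero-term v with S v ∧ adj u v in t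
        ... | false = refl
        ... | true = pMatch-vanish′ N (del (del S u) v) r
              (ℕP.suc-injective (trans (sym (size-del-neighbour S u v Su t)) sz))
              (ℕ.s<s⁻¹ (subst (suc N ℕ.<_) (cong suc (ℕP.+-suc r r)) lt))
          where
            pMatch-vanish′ : ∀ N S r → suc (size S) ≡ N → N ℕ.< suc (r ℕ.+ r) → pMatch adj S r ≡ 0
            pMatch-vanish′ (suc N) S r sz lt = pMatch-vanish N S r (ℕP.suc-injective sz) (ℕ.s<s⁻¹ lt)

-- Taylor coefficients from synthetic division, and polynomials indexed by codegree.

module Taylor (F : RealField) (θ : RealField.R F) where
  open OrderedField F
  open PowerSeries F θ

  -- The successive remainders on division by x - θ are the Taylor coefficients at θ, so `multP`
  -- tests these one after the other.
  taylor : List R → Series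
  taylor p zero = proj₂ (divX F θ p)
  taylor p (suc k) = taylor (proj₁ (divX F θ p)) k

  private
    divX-∷ : ∀ a p → divX F θ (a ∷ p) ≡
      (proj₂ (divX F θ p) ∷ proj₁ (divX F θ p) , a + θ * proj₂ (divX F θ p))
    divX-∷ a p with divX F θ p
    ... | q , r = refl

    multP-suc : ∀ f p → multP F θ (suc f) p ≡
      (if does (proj₂ (divX F θ p) ≟ 0#) then suc (multP F θ f (proj₁ (divX F θ p))) else 0)
    multP-suc f p with divX F θ p
    ... | q , r = refl

  taylor-[] : ∀ k → taylor [] k ≡ 0#
  taylor-[] zero = refl
  taylor-[] (suc k) = taylor-[] k

  taylor-∷ : ∀ a p k → taylor (a ∷ p) k ≡ constant a k + X 1# (taylor p) k
  taylor-∷ a p zero = cong proj₂ (divX-∷ a p)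
  taylor-∷ a p (suc k) = trans (cong (λ d → taylor (proj₁ d) k) (divX-∷ a p))
    (trans (taylor-∷ (proj₂ (divX F θ p)) (proj₁ (divX F θ p)) k) (shift k))
    where
      shift : ∀ k → constant (proj₂ (divX F θ p)) k + X 1# (taylor (proj₁ (divX F θ p))) k ≡
              0# + (θ * taylor p (suc k) + 1# * taylor p k)
      shift zero = trans (trans (+-comm _ _) (cong (_+_ _) (sym (*-identityˡ _)))) (sym (+-identityˡ _))
      shift (suc k) = refl

  -- The fuel has to cover m divisions without remainder and the one that stops the loop.
  multP-order : ∀ m f p → Order (taylor p) m → m ℕ.< f → multP F θ f p ≡ m
  multP-order zero (suc f) p (_ , nz) _ =
    trans (multP-suc f p) (cong (λ b → if b then suc (multP F θ f (proj₁ (divX F θ p))) else 0)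
      (dec-false (proj₂ (divX F θ p) ≟ 0#) nz))
  multP-order (suc m) (suc f) p (v , nz) (s≤s lt) =
    trans (multP-suc f p) (trans (cong (λ b → if b then suc (multP F θ f (proj₁ (divX F θ p))) else 0)
      (dec-true (proj₂ (divX F θ p) ≟ 0#) (v 0 (s≤s z≤n))))
      (cong suc (multP-order m f (proj₁ (divX F θ p)) ((λ i i<m → v (suc i) (s≤s i<m)) , nz) lt)))

  -- The polynomial e 0 xᴺ + e 1 xᴺ⁻¹ + … + e N: coefficients are indexed by codegree,
  -- which is what the matching polynomials of G and of its vertex deletions share.
  horner : (ℕ → R) → ℕ → Series
  horner e zero k = constant (e 0) k
  horner e (suc N) k = constant (e (suc N)) k + X 1# (horner e N) k

  X-zero : ∀ k → X 1# (λ _ → 0#) k ≡ 0#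
  X-zero zero = zeroʳ θ
  X-zero (suc k) = solve 2 (λ a b → a :* con (+ 0) :+ b :* con (+ 0) := con (+ 0)) refl θ 1#

  taylor-horner : ∀ e N → taylor (applyUpTo (λ d → e (N ℕ.∸ d)) (suc N)) ≈ horner e N
  taylor-horner e zero k = trans (taylor-∷ (e 0) [] k)
    (trans (cong (_+_ _) (trans (X-cong taylor-[] k) (X-zero k))) (+-identityʳ _))
  taylor-horner e (suc N) k =
    trans (taylor-∷ _ _ k) (cong (_+_ _) (X-cong (taylor-horner e N) k))

  constant-zero : ∀ {c} → c ≡ 0# → ∀ k → constant c k ≡ 0#
  constant-zero eq zero = eq
  constant-zero eq (suc k) = refl

  horner-zero : ∀ {e} → (∀ k → e k ≡ 0#) → ∀ N k → horner e N k ≡ 0#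
  horner-zero eq zero k = constant-zero (eq 0) k
  horner-zero eq (suc N) zero = trans (cong₂ (λ a b → a + θ * b) (eq (suc N)) (horner-zero eq N 0))
    (solve 1 (λ a → con (+ 0) :+ a :* con (+ 0) := con (+ 0)) refl θ)
  horner-zero eq (suc N) (suc k) =
    trans (cong₂ (λ a b → 0# + (θ * a + 1# * b)) (horner-zero eq N (suc k)) (horner-zero eq N k))
      (solve 2 (λ a b → con (+ 0) :+ (a :* con (+ 0) :+ b :* con (+ 0)) := con (+ 0)) refl θ 1#)

  horner-degree : ∀ e N k → N ℕ.< k → horner e N k ≡ 0#
  horner-degree e zero (suc k) lt = refl
  horner-degree e (suc N) (suc k) (s≤s lt) =
    trans (cong₂ (λ a b → 0# + (θ * a + 1# * b)) (horner-degree e N (suc k) (ℕP.m<n⇒m<1+n lt)) (horner-degree e N k lt))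
      (solve 2 (λ a b → con (+ 0) :+ (a :* con (+ 0) :+ b :* con (+ 0)) := con (+ 0)) refl θ 1#)

  horner-leading : ∀ e N → horner e N N ≡ e 0
  horner-leading e zero = refl
  horner-leading e (suc N) =
    trans (cong₂ (λ a b → 0# + (θ * a + 1# * b)) (horner-degree e N (suc N) ℕP.≤-refl) (horner-leading e N))
      (trans (solve 2 (λ a b → con (+ 0) :+ (a :* con (+ 0) :+ b) := b) refl θ _) (*-identityˡ _))

  X-sub : ∀ y f g k → X y (λ i → f i - g i) k ≡ X y f k - X y g k
  X-sub y f g zero = solve 3 (λ a b c → a :* (b :- c) := a :* b :- a :* c) refl _ _ _
  X-sub y f g (suc k) = solve 6 (λ a b c y d e → a :* (b :- c) :+ y :* (d :- e) := (a :* b :+ y :* d) :- (a :* c :+ y :* e)) refl _ _ _ _ _ _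

  X-∑ : ∀ {n} y (h : Fin n → Series) k → X y (λ i → ∑ (λ v → h v i)) k ≡ ∑ (λ v → X y (h v) k)
  X-∑ y h zero = *-distribˡ-∑ θ (λ v → h v 0)
  X-∑ y h (suc k) = trans (cong₂ _+_ (*-distribˡ-∑ θ (λ v → h v (suc k))) (*-distribˡ-∑ y (λ v → h v k)))
    (sym (∑-distrib-+ (λ v → θ * h v (suc k)) (λ v → y * h v k)))

  constant-sub : ∀ a b k → constant (a - b) k ≡ constant a k - constant b k
  constant-sub a b zero = refl
  constant-sub a b (suc k) = solve 0 (con (+ 0) := con (+ 0) :- con (+ 0)) refl

  constant-∑ : ∀ {n} (h : Fin n → R) k → constant (∑ h) k ≡ ∑ (λ v → constant (h v) k)
  constant-∑ h zero = refl
  constant-∑ {n} h (suc k) = sym (∑-zero {n} (λ _ → refl))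

  -- The polynomial of degree N - 1, read as zero for N = 0. Deleting u and a neighbour lowers the
  -- degree N + 1 of the recurrence by two.
  delayed : (ℕ → R) → ℕ → Series
  delayed d zero k = 0#
  delayed d (suc N) = horner d N

  delayed-step : ∀ d N k → delayed d (suc N) k ≡ constant (d N) k + X 1# (delayed d N) k
  delayed-step d zero k = sym (trans (cong (_+_ _) (X-zero k)) (+-identityʳ _))
  delayed-step d (suc N) k = refl

  -- Since degrees count from the top, the vertex recurrence relates coefficients at k + 2 and k
  -- whatever the degree is; codegrees 0 and 1 do not see the deleted edges.
  horner-recurrence : ∀ {n} e e′ (d : Fin n → ℕ → R) → e 0 ≡ e′ 0 → e 1 ≡ e′ 1 →
    (∀ k → e (suc (suc k)) ≡ e′ (suc (suc k)) - ∑ (λ v → d v k)) →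
    ∀ N k → horner e (suc N) k ≡ horner e′ (suc N) k - ∑ (λ v → delayed (d v) N k)
  horner-recurrence {n} e e′ d p q r zero k = trans
    (cong₂ _+_ (cong (λ c → constant c k) q) (X-cong (λ k → cong (λ c → constant c k) p) k))
    (sym (trans (cong (λ z → horner e′ 1 k - z) (∑-zero {n} (λ _ → refl)))
      (solve 1 (λ a → a :- con (+ 0) := a) refl (horner e′ 1 k))))
  horner-recurrence {n} e e′ d p q r (suc N) k = begin
    constant (e (suc (suc N))) k + X 1# (horner e (suc N)) k
      ≡⟨ cong₂ _+_ (trans (cong (λ c → constant c k) (r N)) (trans (constant-sub _ _ k)
           (cong (λ z → constant (e′ (suc (suc N))) k - z) (constant-∑ (λ v → d v N) k))))
           (trans (X-cong (horner-recurrence e e′ d p q r N) k) (trans (X-sub 1# _ _ k)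
           (cong (λ z → X 1# (horner e′ (suc N)) k - z) (X-∑ 1# (λ v → delayed (d v) N) k)))) ⟩
    (c′ - ∑ (λ v → constant (d v N) k)) + (x′ - ∑ (λ v → X 1# (delayed (d v) N) k))
      ≡⟨ solve 4 (λ a b c d → (a :- b) :+ (c :- d) := (a :+ c) :- (b :+ d)) refl c′ _ x′ _ ⟩
    (c′ + x′) - (∑ (λ v → constant (d v N) k) + ∑ (λ v → X 1# (delayed (d v) N) k))
      ≡⟨ cong (λ z → (c′ + x′) - z) (trans
           (sym (∑-distrib-+ (λ v → constant (d v N) k) (λ v → X 1# (delayed (d v) N) k)))
           (∑-cong (λ v → sym (delayed-step (d v) N k)))) ⟩
    (c′ + x′) - ∑ (λ v → delayed (d v) (suc N) k) ∎
    where
      open ≡-Reasoning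
      c′ = constant (e′ (suc (suc N))) k
      x′ = X 1# (horner e′ (suc N)) k

  -- The coefficient of codegree k: (-1)^(k/2) p(k/2) for even k and 0 for odd k, written just as in
  -- `μcoeffs`.
  signed : (ℕ → ℕ) → ℕ → R
  signed p k = if (k % 2 ≡ᵇ 0)
    then (if ((k / 2) % 2 ≡ᵇ 0) then fromℕ F (p (k / 2)) else - fromℕ F (p (k / 2)))
    else 0#

  neg-zero : - 0# ≡ 0#
  neg-zero = solve 0 (:- con (+ 0) := con (+ 0)) refl

  suc-parity : ∀ h → (suc h % 2 ≡ᵇ 0) ≡ not (h % 2 ≡ᵇ 0)
  suc-parity zero = refl
  suc-parity (suc zero) = refl
  suc-parity (suc (suc h)) = suc-parity h

  signed-step : ∀ p k → signed p (suc (suc k)) ≡ - signed (λ r → p (suc r)) k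
  signed-step p k rewrite m/n≡1+[m∸n]/n {suc (suc k)} {2} (s≤s (s≤s z≤n)) | suc-parity (k / 2)
    with k % 2 ≡ᵇ 0 | (k / 2) % 2 ≡ᵇ 0
  ... | false | _ = sym neg-zero
  ... | true | true = refl
  ... | true | false = solve 1 (λ a → a := :- (:- a)) refl _

  fromℕ-+ : ∀ a b → fromℕ F (a ℕ.+ b) ≡ fromℕ F a + fromℕ F b
  fromℕ-+ zero b = sym (+-identityˡ _)
  fromℕ-+ (suc a) b = trans (cong (_+_ 1#) (fromℕ-+ a b)) (sym (+-assoc _ _ _))

  fromℕ-∑ : ∀ {n} (h : Fin n → ℕ) → fromℕ F (∑ℕ h) ≡ ∑ (λ v → fromℕ F (h v))
  fromℕ-∑ {zero} h = refl
  fromℕ-∑ {suc n} h = trans (fromℕ-+ (h zero) _) (cong (_+_ _) (fromℕ-∑ (λ v → h (suc v))))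

  signed-cong : ∀ {p p′} → (∀ r → p r ≡ p′ r) → ∀ k → signed p k ≡ signed p′ k
  signed-cong eq k rewrite eq (k / 2) = refl

  signed-zero : ∀ k p → (∀ r → k ℕ.≤ r ℕ.+ r → p r ≡ 0) → signed p k ≡ 0#
  signed-zero zero p eq = cong (fromℕ F) (eq 0 z≤n)
  signed-zero (suc zero) p eq = refl
  signed-zero (suc (suc k)) p eq = trans (signed-step p k) (trans (cong -_
    (signed-zero k (λ r → p (suc r)) (λ r le → eq (suc r) (s≤s (subst (suc k ℕ.≤_) (sym (ℕP.+-suc r r)) (s≤s le))))))
    neg-zero)

  signed-+ : ∀ {n} p (h : Fin n → ℕ → ℕ) k →
    signed (λ r → p r ℕ.+ ∑ℕ (λ v → h v r)) k ≡ signed p k + ∑ (λ v → signed (h v) k)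
  signed-+ {n} p h k with k % 2 ≡ᵇ 0 | (k / 2) % 2 ≡ᵇ 0
  ... | false | _ = sym (trans (cong (_+_ _) (∑-zero {n} (λ _ → refl))) (+-identityˡ 0#))
  ... | true | true = trans (fromℕ-+ (p (k / 2)) _) (cong (_+_ _) (fromℕ-∑ (λ v → h v (k / 2))))
  ... | true | false = trans (cong -_ (trans (fromℕ-+ (p (k / 2)) _) (cong (_+_ _) (fromℕ-∑ (λ v → h v (k / 2))))))
    (trans (solve 2 (λ a b → :- (a :+ b) := :- a :+ :- b) refl _ _)
      (cong (_+_ _) (neg-distrib-∑ (λ v → fromℕ F (h v (k / 2))))))

-- The matching polynomial as a Taylor series.

module MatchingSeries (F : RealField) (θ : RealField.R F) {n : ℕ} (adj : Adj n)
  (symmetric : ∀ u v → adj u v ≡ adj v u) (irreflexive : ∀ u → adj u u ≡ false) where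
  open OrderedField F
  open PowerSeries F θ
  open Taylor F θ
  open Taylor F θ public using (neg-zero)

  coefficient : Mask n → ℕ → R
  coefficient S = signed (pMatch adj S)

  coefficient-zero : ∀ S → coefficient S 0 ≡ 1#
  coefficient-zero S = trans (cong (fromℕ F) (pMatch-zero adj S)) (+-identityʳ 1#)

  abstract
    -- The Taylor expansion at θ of the matching polynomial of the subgraph induced on S.
    μ : Mask n → Series
    μ S = horner (coefficient S) (size S)

    μ-taylor : ∀ S → taylor (μcoeffs F adj S) ≈ μ S
    μ-taylor S k = trans (cong (λ p → taylor p k) (trans
      (ListP.map-cong {g = λ d → coefficient S (size S ℕ.∸ d)} (λ d → refl) (upTo (suc (size S))))
      (ListP.map-applyUpTo (λ d → d) (λ d → coefficient S (size S ℕ.∸ d)) (suc (size S)))))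
      (taylor-horner (coefficient S) (size S) k)

    m : Mask n → ℕ
    m = mult F θ adj

    -- The bridge from the sealed `m` to the multiplicity in the theorem; the sealing keeps matching
    -- numbers from being unfolded in later proofs.
    m-mult : ∀ S → m S ≡ mult F θ adj S
    m-mult S = refl

    -- The polynomial is monic, so its Taylor coefficient of degree `size S` is 1; the first
    -- non-zero one therefore has index at most `size S`, which the fuel of `mult` exceeds.
    order-μ : ∀ S → Order (μ S) (m S)
    order-μ S with first-nonzero (suc (size S)) (μ S)
    ... | inj₁ v = ⊥-elim (0≢1 (trans (sym (v (size S) ℕP.≤-refl))
            (trans (horner-leading (coefficient S) (size S)) (coefficient-zero S))))
    ... | inj₂ (m , m<N , o) = subst (Order (μ S)) (sym (multP-order m _ (μcoeffs F adj S)
            (order-resp (λ k → sym (μ-taylor S k)) o)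
            (subst (m ℕ.<_) (sym (trans (ListP.length-map _ (upTo (suc (size S)))) (ListP.length-upTo (suc (size S))))) m<N))) o

    μ-empty : ∀ {S} → (∀ u → S u ≡ false) → μ S ≈ constant 1#
    μ-empty {S} eq k = trans (cong (λ N → horner (coefficient S) N k) (size-empty eq))
      (cong (λ c → constant c k) (coefficient-zero S))

    μ-recurrence : ∀ S u → S u ≡ true → ∀ k → μ S k ≡
      X 1# (μ (del S u)) k - ∑ (λ v → if S v ∧ adj u v then μ (del (del S u) v) k else 0#)
    μ-recurrence S u Su k = begin
      horner e (size S) k
        ≡⟨ cong (λ z → horner e z k) (size-del S u Su) ⟩
      horner e (suc N) k
        ≡⟨ horner-recurrence e e′ d (trans (coefficient-zero S) (sym (coefficient-zero (del S u)))) refl recurrence N k ⟩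
      horner e′ (suc N) k - ∑ (λ v → delayed (d v) N k)
        ≡⟨ cong₂ _-_ (trans (cong (_+ X 1# (horner e′ N) k) (constant-zero top k)) (+-identityˡ _)) (∑-cong term) ⟩
      X 1# (μ (del S u)) k - ∑ (λ v → if S v ∧ adj u v then μ (del (del S u) v) k else 0#) ∎
      where
        open ≡-Reasoning
        N : ℕ
        N = size (del S u)
        e e′ : ℕ → R
        e = coefficient S
        e′ = coefficient (del S u)
        d : Fin n → ℕ → R
        d v j = if S v ∧ adj u v then coefficient (del (del S u) v) j else 0#
        if-signed : ∀ b p j → signed (λ r → if b then p r else 0) j ≡ (if b then signed p j else 0#)
        if-signed true p j = refl
        if-signed false p j = signed-zero j (λ _ → 0) (λ _ _ → refl)
        recurrence : ∀ j → e (suc (suc j)) ≡ e′ (suc (suc j)) - ∑ (λ v → d v j)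
        recurrence j = begin
          e (suc (suc j))
            ≡⟨ signed-step (pMatch adj S) j ⟩
          - signed (λ r → pMatch adj S (suc r)) j
            ≡⟨ cong -_ (signed-cong (λ r → pMatch-vertex adj symmetric irreflexive S u r Su) j) ⟩
          - signed (λ r → pMatch adj (del S u) (suc r) ℕ.+ ∑ℕ (λ v → h v r)) j
            ≡⟨ cong -_ (signed-+ (λ r → pMatch adj (del S u) (suc r)) h j) ⟩
          - (signed (λ r → pMatch adj (del S u) (suc r)) j + ∑ (λ v → signed (h v) j))
            ≡⟨ solve 2 (λ a b → :- (a :+ b) := :- a :- b) refl _ _ ⟩
          - signed (λ r → pMatch adj (del S u) (suc r)) j - ∑ (λ v → signed (h v) j)
            ≡⟨ cong₂ _-_ (sym (signed-step (pMatch adj (del S u)) j))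
                 (∑-cong (λ v → if-signed (S v ∧ adj u v) (pMatch adj (del (del S u) v)) j)) ⟩
          e′ (suc (suc j)) - ∑ (λ v → d v j) ∎
          where
            h : Fin n → ℕ → ℕ
            h v r = if S v ∧ adj u v then pMatch adj (del (del S u) v) r else 0
        -- Only N vertices are left after deleting u, so the coefficient of codegree N + 1 vanishes,
        -- and padding to degree N + 1 is multiplication by x.
        top : e′ (suc N) ≡ 0#
        top = signed-zero (suc N) (pMatch adj (del S u)) (λ r le → pMatch-vanish adj symmetric irreflexive N (del S u) r refl le)
        term : ∀ v → delayed (d v) N k ≡ (if S v ∧ adj u v then μ (del (del S u) v) k else 0#)
        term v with S v ∧ adj u v in t
        ... | true = cong (λ z → delayed (coefficient (del (del S u) v)) z k)
              (ℕP.suc-injective (trans (sym (size-del S u Su)) (size-del-neighbour adj symmetric irreflexive S u v Su t)))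
        ... | false with N
        ...   | zero = refl
        ...   | suc N′ = horner-zero (λ _ → refl) N′ k

-- The series depends only on the induced subgraph.

module _ {n : ℕ} where

  size-del-≤ : ∀ (S : Mask n) u {N} → S u ≡ true → size S ℕ.≤ suc N → size (del S u) ℕ.≤ N
  size-del-≤ S u {N} Su le = ℕ.s≤s⁻¹ (subst (ℕ._≤ suc N) (size-del S u Su) le)

  size-positive : ∀ (S : Mask n) u → S u ≡ true → ¬ (size S ℕ.≤ 0)
  size-positive S u Su le with subst (ℕ._≤ 0) (size-del S u Su) le
  ... | ()

module Agreement (F : RealField) (θ : RealField.R F) {n : ℕ} (adj adj′ : Adj n)
  (symmetric : ∀ u v → adj u v ≡ adj v u) (irreflexive : ∀ u → adj u u ≡ false)
  (symmetric′ : ∀ u v → adj′ u v ≡ adj′ v u) (irreflexive′ : ∀ u → adj′ u u ≡ false) where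
  open OrderedField F
  open PowerSeries F θ
  open MatchingSeries F θ adj symmetric irreflexive
  open MatchingSeries F θ adj′ symmetric′ irreflexive′ using ()
    renaming (μ to μ′; μ-empty to μ-empty′; μ-recurrence to μ-recurrence′; order-μ to order-μ′; m to m′)

  -- Both sides obey the same recurrence. Masks being functions, this is needed even for two
  -- pointwise equal masks; with two adjacencies it also compares G with S_θ(G) away from A.
  μ-agree : ∀ N S S′ → size S ℕ.≤ N → (∀ i → S i ≡ S′ i) →
    (∀ i j → S i ≡ true → S j ≡ true → adj i j ≡ adj′ i j) → μ S ≈ μ′ S′
  μ-agree N S S′ sz eq agree k with empty-or-∈ S
  ... | inj₂ none = trans (μ-empty none k) (sym (μ-empty′ (λ u → trans (sym (eq u)) (none u)) k))
  μ-agree zero S S′ sz eq agree k | inj₁ (u , Su) = ⊥-elim (size-positive S u Su sz)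
  μ-agree (suc N) S S′ sz eq agree k | inj₁ (u , Su) =
    trans (μ-recurrence S u Su k) (trans (cong₂ _-_
      (X-cong (μ-agree N (del S u) (del S′ u) (size-del-≤ S u Su sz) (del-cong eq u)
        (λ i j p q → agree i j (proj₁ (del-∈ S p)) (proj₁ (del-∈ S q)))) k)
      (∑-cong term)) (sym (μ-recurrence′ S′ u (trans (sym (eq u)) Su) k)))
    where
      term : ∀ v → (if S v ∧ adj u v then μ (del (del S u) v) k else 0#) ≡
                   (if S′ v ∧ adj′ u v then μ′ (del (del S′ u) v) k else 0#)
      term v with S v in Sv
      ... | false = cong (λ b → if b ∧ adj′ u v then μ′ (del (del S′ u) v) k else 0#) (trans (sym Sv) (eq v))
      ... | true rewrite sym (eq v) | Sv | sym (agree u v Su Sv) with adj u v in uv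
      ...   | false = refl
      ...   | true = μ-agree N (del (del S u) v) (del (del S′ u) v)
              (ℕP.<⇒≤ (subst (ℕ._≤ N) (size-del (del S u) v (del-keep S (neighbour-≢ adj symmetric irreflexive uv) Sv))
                 (size-del-≤ S u Su sz)))
              (del-cong (del-cong eq u) v)
              (λ i j p q → agree i j (proj₁ (del-∈ S (proj₁ (del-∈ (del S u) p)))) (proj₁ (del-∈ S (proj₁ (del-∈ (del S u) q)))))
              k

  m-agree : ∀ {S S′} → (∀ i → S i ≡ S′ i) → (∀ i j → S i ≡ true → S j ≡ true → adj i j ≡ adj′ i j) → m S ≡ m′ S′
  m-agree {S} {S′} eq agree =
    order-unique (order-resp (μ-agree (size S) S S′ ℕP.≤-refl eq agree) (order-μ S)) (order-μ′ S′)

-- Interlacing, and residues at a vertex.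

module Multiplicity (F : RealField) (θ : RealField.R F) {n : ℕ} (adj : Adj n)
  (symmetric : ∀ u v → adj u v ≡ adj v u) (irreflexive : ∀ u → adj u u ≡ false) where
  open OrderedField F
  open PowerSeries F θ
  open MatchingSeries F θ adj symmetric irreflexive

  μ-cong : ∀ {S S′} → (∀ i → S i ≡ S′ i) → μ S ≈ μ S′
  μ-cong {S} {S′} eq = Agreement.μ-agree F θ adj adj symmetric irreflexive symmetric irreflexive
    (size S) S S′ ℕP.≤-refl eq (λ _ _ _ _ → refl)

  m-cong : ∀ {S S′} → (∀ i → S i ≡ S′ i) → m S ≡ m S′
  m-cong {S} {S′} eq = order-unique (order-resp (μ-cong eq) (order-μ S)) (order-μ S′)

  m-swap : ∀ S u v → m (del (del S u) v) ≡ m (del (del S v) u)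
  m-swap S u v = m-cong (del-swap S u v)

  m-empty : ∀ {S} → (∀ u → S u ≡ false) → m S ≡ 0
  m-empty {S} none = order-unique (order-μ S)
    (order-resp (λ k → sym (μ-empty none k)) ((λ _ ()) , λ 1≡0 → 0≢1 (sym 1≡0)))

  -- Dividing the recurrence by μ(S-u) gives x minus the sum of μ(S-u-v)/μ(S-u). By induction each
  -- term of this sum is the reciprocal of an increasing quotient.
  μ-increasing : ∀ N S u → size S ℕ.≤ N → S u ≡ true → Increasing (μ S) (μ (del S u))
  μ-increasing zero S u sz Su = ⊥-elim (size-positive S u Su sz)
  μ-increasing (suc N) S u sz Su =
    increasing-resp (λ k → sym (trans (μ-recurrence S u Su k) (cong (_+_ _) (neg-distrib-∑ (λ v → c v k)))))
      (increasing-∑ (λ v k → - c v k) (increasing-X (order-μ (del S u))) term)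
    where
      c : Fin n → Series
      c v k = if S v ∧ adj u v then μ (del (del S u) v) k else 0#
      term : ∀ v → (∀ k → - c v k ≡ 0#) ⊎ Increasing (λ k → - c v k) (μ (del S u))
      term v with S v ∧ adj u v in t
      ... | false = inj₁ (λ _ → neg-zero)
      ... | true = inj₂ (increasing-reciprocal (μ-increasing N (del S u) v (size-del-≤ S u Su sz)
              (del-keep S (neighbour-≢ adj symmetric irreflexive (proj₂ (∧-true t))) (proj₁ (∧-true t)))))

  interlace : ∀ S u → S u ≡ true → Interlace (m S) (m (del S u))
  interlace S u Su = increasing-interlace (μ-increasing (size S) S u ℕP.≤-refl Su) (order-μ S) (order-μ (del S u))

  vanish-below : ∀ {j} S → j ℕ.≤ m S → Vanish j (μ S)
  vanish-below S le = vanish-mono le (proj₁ (order-μ S))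

  nonzero-at : ∀ {j} S → m S ≡ j → μ S j ≢ 0#
  nonzero-at S refl = proj₂ (order-μ S)

  X-vanish : ∀ y {f} j → Vanish (suc j) f → X y f j ≡ 0#
  X-vanish y zero v = trans (cong (θ *_) (v 0 ℕP.≤-refl)) (zeroʳ θ)
  X-vanish y (suc j) v = trans (cong₂ (λ a b → θ * a + y * b) (v (suc j) ℕP.≤-refl) (v j (ℕP.n≤1+n _)))
    (solve 2 (λ a b → a :* con (+ 0) :+ b :* con (+ 0) := con (+ 0)) refl θ y)

  -- All terms of the recurrence that have a pole at θ relative to μ (del S u) have residues
  -- of the same sign, so they cannot cancel.
  essential-neighbour⇒positive : ∀ S u v → S u ≡ true → S v ≡ true → adj u v ≡ true →
    suc (m (del (del S u) v)) ≡ m (del S u) → m (del S u) ≡ suc (m S)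
  essential-neighbour⇒positive S u v Su Sv uv eq = conclude (interlace S u Su)
    where
      j = m (del (del S u) v)
      q = μ (del S u)
      order-q : Order q (suc j)
      order-q = subst (Order q) (sym eq) (order-μ (del S u))
      c : Fin n → R
      c w = if S w ∧ adj u w then μ (del (del S u) w) j else 0#
      residue : ∀ w → NonNegative (c w * q (suc j))
      residue w with S w ∧ adj u w in t
      ... | false = inj₁ (zeroˡ _)
      ... | true = increasing-residue (μ-increasing (size (del S u)) (del S u) w ℕP.≤-refl
              (del-keep S (neighbour-≢ adj symmetric irreflexive (proj₂ (∧-true t))) (proj₁ (∧-true t)))) order-q
      residue-v : 0# < c v * q (suc j)
      residue-v with residue v
      ... | inj₂ pos = pos
      ... | inj₁ zro = ⊥-elim (*-nonzero (subst (λ b → (if b then μ (del (del S u) v) j else 0#) ≢ 0#)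
              (sym (cong₂ _∧_ Sv uv)) (proj₂ (order-μ (del (del S u) v)))) (proj₂ order-q) zro)
      -- The term x μ(S-u) has order at least j + 1 and drops out of degree j. Multiplying by the
      -- leading coefficient of q turns every remaining summand into a residue of known sign.
      value : μ S j * q (suc j) ≡ - ∑ (λ w → c w * q (suc j))
      value = trans (cong (_* q (suc j)) (trans (μ-recurrence S u Su j)
          (cong (_+ - ∑ c) (X-vanish 1# j (proj₁ order-q)))))
        (trans (solve 2 (λ a b → (con (+ 0) :+ :- a) :* b := :- (a :* b)) refl (∑ c) (q (suc j)))
          (cong -_ (*-distribʳ-∑ (q (suc j)) c)))
      nonzero : μ S j ≢ 0#
      nonzero z = 0<⇒≢0 (∑-positive residue v residue-v) (trans
        (solve 1 (λ a → a := :- (:- a)) refl _)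
        (trans (cong -_ (trans (sym value) (trans (cong (_* q (suc j)) z) (zeroˡ _)))) neg-zero))
      m≤j : m S ℕ.≤ j
      m≤j = order-≤ (order-μ S) nonzero
      conclude : Interlace (m S) (m (del S u)) → m (del S u) ≡ suc (m S)
      conclude (upper p) = p
      conclude (lower p) = ⊥-elim (ℕP.<-irrefl refl (ℕP.≤-trans (ℕP.≤-trans (ℕP.n≤1+n _)
        (ℕP.≤-reflexive (trans (cong suc eq) (sym p)))) m≤j))
      conclude (equal p) = ⊥-elim (ℕP.<-irrefl refl (ℕP.≤-trans (ℕP.≤-reflexive (trans eq (sym p))) m≤j))

  -- Without such a neighbour every term of the recurrence would vanish in degree `m S`, and then so
  -- would μ S, against its order.
  positive⇒essential-neighbour : ∀ S u → S u ≡ true → m (del S u) ≡ suc (m S) →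
    ∃ λ v → S v ≡ true × adj u v ≡ true × suc (m (del (del S u) v)) ≡ m (del S u)
  positive⇒essential-neighbour S u Su eq
    with FinP.any? (λ v → (S v ∧ adj u v ∧ (suc (m (del (del S u) v)) ≡ᵇ m (del S u))) BoolP.≟ true)
  ... | yes (v , t) = v , proj₁ (∧-true t) , proj₁ (∧-true (proj₂ (∧-true {S v} t)))
        , ≡ᵇ-true (proj₂ (∧-true {adj u v} (proj₂ (∧-true {S v} t))))
  ... | no none = ⊥-elim (proj₂ (order-μ S) (trans (μ-recurrence S u Su (m S))
        (trans (cong₂ _-_ (X-vanish 1# (m S) (vanish-below (del S u) (ℕP.≤-reflexive (sym eq)))) (∑-zero term))
          (-‿inverseʳ 0#))))
    where
      regular : ∀ v → S v ≡ true → adj u v ≡ true → suc (m S) ℕ.≤ m (del (del S u) v)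
      regular v Sv uv with interlace (del S u) v (del-keep S (neighbour-≢ adj symmetric irreflexive uv) Sv)
      ... | lower p = ⊥-elim (none (v , cong₂ _∧_ Sv (cong₂ _∧_ uv
              (≡ᵇ-intro (sym p)))))
      ... | equal p = ℕP.≤-reflexive (trans (sym eq) p)
      ... | upper p = ℕP.≤-trans (ℕP.≤-reflexive (sym eq)) (ℕP.≤-trans (ℕP.n≤1+n _) (ℕP.≤-reflexive (sym p)))
      term : ∀ v → (if S v ∧ adj u v then μ (del (del S u) v) (m S) else 0#) ≡ 0#
      term v with S v ∧ adj u v in t
      ... | false = refl
      ... | true = vanish-below (del (del S u) v) (regular v (proj₁ (∧-true t)) (proj₂ (∧-true t))) (m S) ℕP.≤-refl

  -- Rayleigh differences as sums of squares.

  ⊛-zeroˡ : ∀ f g k → (∀ i → f i ≡ 0#) → (f ⊛ g) k ≡ 0#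
  ⊛-zeroˡ f g k z = ⊛-vanish (suc k) 0 (λ i _ → z i) (λ _ ()) k (s≤s (ℕP.m≤m+n k 0))

  ⊛-zeroʳ : ∀ f g k → (∀ i → g i ≡ 0#) → (f ⊛ g) k ≡ 0#
  ⊛-zeroʳ f g k z = ⊛-vanish 0 (suc k) {f} (λ _ ()) (λ i _ → z i) k ℕP.≤-refl

  -- One argument for the plain and the perturbed matching polynomial: all it takes is a vertex
  -- recurrence, and the weights `y u` cancel when Δ is expanded.
  module Rayleigh (Φ : Mask n → Series) (y : Fin n → R)
    (Φ-cong : ∀ {S S′} → (∀ i → S i ≡ S′ i) → Φ S ≈ Φ S′)
    (Φ-recurrence : ∀ S u → S u ≡ true → ∀ k → Φ S k ≡
      X (y u) (Φ (del S u)) k - ∑ (λ v → if S v ∧ adj u v then Φ (del (del S u) v) k else 0#)) where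

    Δ : Mask n → Fin n → Fin n → Series
    Δ S u v k = (Φ (del S u) ⊛ Φ (del S v)) k - (Φ S ⊛ Φ (del (del S u) v)) k

    -- The contribution of a first step from u to w: a square if w has reached v, and otherwise the
    -- difference for w and v with u removed.
    Δ-term : Mask n → Fin n → Fin n → Fin n → Series
    Δ-term S u v w k = if S w ∧ adj u w
      then (if eqᶠ w v then (Φ (del (del S u) v) ⊛ Φ (del (del S u) v)) k else Δ (del S u) w v k) else 0#

    -- Iterating this writes Δ S u v as a sum of squares over the paths from u to v (Heilmann–Lieb).
    Δ-expand : ∀ S u v → S u ≡ true → u ≢ v → ∀ k → Δ S u v k ≡ ∑ (λ w → Δ-term S u v w k)
    Δ-expand S u v Su u≢v k = begin
      (P ⊛ Φ (del S v)) k - (Φ S ⊛ Q) k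
        ≡⟨ cong₂ _-_ (⊛-cong {P} (λ _ → refl) expand-v k) (⊛-cong {g = Q} (Φ-recurrence S u Su) (λ _ → refl) k) ⟩
      (P ⊛ (λ i → X (y u) Q i - ∑ (λ w → B w i))) k - ((λ i → X (y u) P i - ∑ (λ w → A w i)) ⊛ Q) k
        ≡⟨ cong₂ _-_ (trans (⊛-subʳ P (X (y u) Q) (λ i → ∑ (λ w → B w i)) k)
                        (cong₂ _-_ (⊛-Xʳ (y u) P Q k) (⊛-∑ʳ P B k)))
                     (trans (⊛-subˡ (X (y u) P) (λ i → ∑ (λ w → A w i)) Q k)
                        (cong₂ _-_ (⊛-Xˡ (y u) P Q k) (⊛-∑ˡ A Q k))) ⟩
      (X (y u) (P ⊛ Q) k - ∑ (λ w → (P ⊛ B w) k)) - (X (y u) (P ⊛ Q) k - ∑ (λ w → (A w ⊛ Q) k))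
        ≡⟨ solve 3 (λ x a b → (x :- b) :- (x :- a) := a :+ :- b) refl (X (y u) (P ⊛ Q) k) _ _ ⟩
      ∑ (λ w → (A w ⊛ Q) k) + - ∑ (λ w → (P ⊛ B w) k)
        ≡⟨ cong (_+_ _) (neg-distrib-∑ (λ w → (P ⊛ B w) k)) ⟩
      ∑ (λ w → (A w ⊛ Q) k) + ∑ (λ w → - (P ⊛ B w) k)
        ≡⟨ ∑-distrib-+ (λ w → (A w ⊛ Q) k) (λ w → - (P ⊛ B w) k) ⟨
      ∑ (λ w → (A w ⊛ Q) k - (P ⊛ B w) k)
        ≡⟨ ∑-cong collect ⟩
      ∑ (λ w → Δ-term S u v w k) ∎
      where
        open ≡-Reasoning
        P = Φ (del S u)
        Q = Φ (del (del S u) v)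
        A B : Fin n → Series
        A w i = if S w ∧ adj u w then Φ (del (del S u) w) i else 0#
        B w i = if del S v w ∧ adj u w then Φ (del (del (del S u) w) v) i else 0#
        expand-v : ∀ i → Φ (del S v) i ≡ X (y u) Q i - ∑ (λ w → B w i)
        expand-v i = trans (Φ-recurrence (del S v) u (del-keep S u≢v Su) i) (cong₂ _-_
          (X-cong (Φ-cong (del-swap S v u)) i)
          (∑-cong (λ w → cong (λ z → if del S v w ∧ adj u w then z else 0#)
            (Φ-cong (λ x → trans (del-cong (del-swap S v u) w x) (del-swap (del S u) v w x)) i))))
        collect : ∀ w → (A w ⊛ Q) k - (P ⊛ B w) k ≡ Δ-term S u v w k
        collect w with w ≟ᶠ v
        ... | yes refl rewrite BoolP.∧-zeroʳ (S w) with S w ∧ adj u w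
        ...   | true = trans (cong (λ z → (Q ⊛ Q) k - z) (⊛-zeroʳ P (λ _ → 0#) k (λ _ → refl)))
                  (solve 1 (λ a → a :- con (+ 0) := a) refl _)
        ...   | false = trans (cong₂ _-_ (⊛-zeroˡ (λ _ → 0#) Q k (λ _ → refl)) (⊛-zeroʳ P (λ _ → 0#) k (λ _ → refl))) (-‿inverseʳ 0#)
        collect w | no _ rewrite BoolP.∧-identityʳ (S w) with S w ∧ adj u w
        ...   | true = refl
        ...   | false = trans (cong₂ _-_ (⊛-zeroˡ (λ _ → 0#) Q k (λ _ → refl)) (⊛-zeroʳ P (λ _ → 0#) k (λ _ → refl))) (-‿inverseʳ 0#)

    Δ-nonNegative : ∀ N b S u v → size S ℕ.≤ b → S u ≡ true → S v ≡ true → u ≢ v → NonNegativeUpTo N (Δ S u v)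
    Δ-nonNegative N zero S u v sz Su Sv u≢v = ⊥-elim (size-positive S u Su sz)
    Δ-nonNegative N (suc b) S u v sz Su Sv u≢v =
      nonNegativeUpTo-resp (λ k → sym (Δ-expand S u v Su u≢v k)) (∑-nonNegativeUpTo (Δ-term S u v) term)
      where
        term : ∀ w → NonNegativeUpTo N (Δ-term S u v w)
        term w with S w ∧ adj u w in t
        ... | false = inj₁ (λ _ _ → refl)
        ... | true with w ≟ᶠ v
        ...   | yes _ = square-nonNegativeUpTo N _
        ...   | no w≢v = Δ-nonNegative N b (del S u) w v (size-del-≤ S u Su sz)
                (del-keep S (neighbour-≢ adj symmetric irreflexive (proj₂ (∧-true t))) (proj₁ (∧-true t)))
                (del-keep S (λ v≡u → u≢v (sym v≡u)) Sv) w≢v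

    -- The four numbers are mere lower bounds for the orders. As a + b = c + d, the displayed
    -- difference is the coefficient of Δ in that degree, and all lower ones vanish.
    Δ-leading : ∀ S u v → S u ≡ true → S v ≡ true → u ≢ v → ∀ a b c d →
      Vanish a (Φ (del S u)) → Vanish b (Φ (del S v)) → Vanish c (Φ S) → Vanish d (Φ (del (del S u) v)) →
      a ℕ.+ b ≡ c ℕ.+ d → ¬ (Φ (del S u) a * Φ (del S v) b - Φ S c * Φ (del (del S u) v) d < 0#)
    Δ-leading S u v Su Sv u≢v a b c d va vb vc vd eq neg =
      leading-not-negative (Δ-nonNegative (suc (a ℕ.+ b)) (size S) S u v ℕP.≤-refl Su Sv u≢v)
        (λ i lt → trans (cong₂ _-_ (⊛-vanish a b va vb i lt) (⊛-vanish c d vc vd i (subst (i ℕ.<_) eq lt))) (-‿inverseʳ 0#))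
        (subst (_< 0#) (sym (cong₂ _-_ (⊛-leading a b va vb)
          (trans (cong (Φ S ⊛ Φ (del (del S u) v)) eq) (⊛-leading c d vc vd)))) neg)

  module Unweighted = Rayleigh μ (λ _ → 1#) μ-cong μ-recurrence

  -- The product of smaller order supplies the leading term of Δ, and a sum of squares cannot lead
  -- in odd degree.
  odd-left : ∀ S u v → S u ≡ true → S v ≡ true → u ≢ v → ∀ i → m (del S u) ℕ.+ m (del S v) ≡ suc (i ℕ.+ i) →
    ¬ (m (del S u) ℕ.+ m (del S v) ℕ.< m S ℕ.+ m (del (del S u) v))
  odd-left S u v Su Sv u≢v i odd lt = nz (trans (solve 1 (λ a → a := a :- con (+ 0)) refl _)
      (trans (cong (λ z → (μ (del S u) ⊛ μ (del S v)) (suc (i ℕ.+ i)) - z) (sym (w _ (subst (ℕ._< m S ℕ.+ m (del (del S u) v)) odd lt))))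
        (odd-leading-zero i (Unweighted.Δ-nonNegative (suc (suc (i ℕ.+ i))) (size S) S u v ℕP.≤-refl Su Sv u≢v)
          (λ k k< → trans (cong₂ _-_ (v′ k k<) (w k (ℕP.<-trans k< (subst (ℕ._< m S ℕ.+ m (del (del S u) v)) odd lt)))) (-‿inverseʳ 0#)))))
    where
      o = subst (Order (μ (del S u) ⊛ μ (del S v))) odd (order-⊛ (order-μ (del S u)) (order-μ (del S v)))
      v′ = proj₁ o
      nz = proj₂ o
      w : Vanish (m S ℕ.+ m (del (del S u) v)) (μ S ⊛ μ (del (del S u) v))
      w = proj₁ (order-⊛ (order-μ S) (order-μ (del (del S u) v)))

  -- The same parity obstruction, now with the leading term coming from the subtracted product.
  odd-right : ∀ S u v → S u ≡ true → S v ≡ true → u ≢ v → ∀ i → m S ℕ.+ m (del (del S u) v) ≡ suc (i ℕ.+ i) →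
    ¬ (m S ℕ.+ m (del (del S u) v) ℕ.< m (del S u) ℕ.+ m (del S v))
  odd-right S u v Su Sv u≢v i odd lt = nz (trans (solve 1 (λ a → a := :- (con (+ 0) :- a)) refl _)
      (trans (cong (λ z → - (z - (μ S ⊛ μ (del (del S u) v)) (suc (i ℕ.+ i)))) (sym (w _ (subst (ℕ._< m (del S u) ℕ.+ m (del S v)) odd lt))))
        (trans (cong -_ (odd-leading-zero i (Unweighted.Δ-nonNegative (suc (suc (i ℕ.+ i))) (size S) S u v ℕP.≤-refl Su Sv u≢v)
          (λ k k< → trans (cong₂ _-_ (w k (ℕP.<-trans k< (subst (ℕ._< m (del S u) ℕ.+ m (del S v)) odd lt))) (v′ k k<)) (-‿inverseʳ 0#)))) neg-zero)))
    where
      o = subst (Order (μ S ⊛ μ (del (del S u) v))) odd (order-⊛ (order-μ S) (order-μ (del (del S u) v)))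
      v′ = proj₁ o
      nz = proj₂ o
      w : Vanish (m (del S u) ℕ.+ m (del S v)) (μ (del S u) ⊛ μ (del S v))
      w = proj₁ (order-⊛ (order-μ (del S u)) (order-μ (del S v)))

  -- The matching polynomial with one perturbed variable.

  -- Multiplication by t.
  shift : Series → Series
  shift f zero = 0#
  shift f (suc k) = f k

  shift-cong : ∀ {f g} → f ≈ g → shift f ≈ shift g
  shift-cong eq zero = refl
  shift-cong eq (suc k) = eq k

  shift-vanish : ∀ {a f} → Vanish a f → Vanish (suc a) (shift f)
  shift-vanish v zero _ = refl
  shift-vanish v (suc i) (s≤s lt) = v i lt

  -- The matching polynomial in which the variable of the vertex z is x + s t.
  module Weighted (z : Fin n) (s : R) where

    -- With one variable per vertex the matching polynomial is affine in the variable of z, with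
    -- slope μ(S-z); raising that variable by s t adds s t μ(S-z).
    Φ : Mask n → Series
    Φ S k = μ S k + (if S z then s * shift (μ (del S z)) k else 0#)

    Φ-cong : ∀ {S S′} → (∀ i → S i ≡ S′ i) → Φ S ≈ Φ S′
    Φ-cong eq k = cong₂ _+_ (μ-cong eq k) (cong₂ (λ b a → if b then s * a else 0#) (eq z) (shift-cong (μ-cong (del-cong eq z)) k))

    Φ-out : ∀ {S} → S z ≡ false → Φ S ≈ μ S
    Φ-out {S} Sz k = trans (cong (λ b → μ S k + (if b then s * shift (μ (del S z)) k else 0#)) Sz) (+-identityʳ _)

    Φ-in : ∀ {S} → S z ≡ true → ∀ k → Φ S k ≡ μ S k + s * shift (μ (del S z)) k
    Φ-in {S} Sz k = cong (λ b → μ S k + (if b then s * shift (μ (del S z)) k else 0#)) Sz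

    -- At z the variable is x + s t = θ + (1 + s) t.
    weight : Fin n → R
    weight u = if eqᶠ u z then 1# + s else 1#

    Φ-recurrence-out : ∀ S u → S u ≡ true → S z ≡ false → ∀ k → Φ S k ≡
      X 1# (Φ (del S u)) k - ∑ (λ v → if S v ∧ adj u v then Φ (del (del S u) v) k else 0#)
    Φ-recurrence-out S u Su Sz k = trans (Φ-out Sz k) (trans (μ-recurrence S u Su k) (cong₂ _-_
      (X-cong (λ i → sym (Φ-out {del S u} (cong (_∧ not (eqᶠ z u)) Sz) i)) k)
      (∑-cong (λ v → cong (λ a → if S v ∧ adj u v then a else 0#)
        (sym (Φ-out {del (del S u) v} (cong (λ b → (b ∧ not (eqᶠ z u)) ∧ not (eqᶠ z v)) Sz) k))))))

    -- Both summands of Φ S can be expanded at u. A neighbour v = z is missing from the second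
    -- expansion, in accordance with Φ having no extra term once z is deleted.
    Φ-recurrence-in : ∀ S u → S u ≡ true → S z ≡ true → u ≢ z → ∀ k → Φ S k ≡
      X 1# (Φ (del S u)) k - ∑ (λ v → if S v ∧ adj u v then Φ (del (del S u) v) k else 0#)
    Φ-recurrence-in S u Su Sz u≢z k = begin
      Φ S k
        ≡⟨ Φ-in Sz k ⟩
      μ S k + s * shift (μ (del S z)) k
        ≡⟨ cong₂ (λ a b → a + s * b) (μ-recurrence S u Su k)
             (trans (shift-cong (μ-recurrence (del S z) u (del-keep S u≢z Su)) k) (shift-sub-∑ (X 1# (μ (del (del S z) u))) B k)) ⟩
      (X 1# f k - ∑ (λ v → A v k)) + s * (shift (X 1# (μ (del (del S z) u))) k - ∑ (λ v → shift (B v) k))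
        ≡⟨ solve 5 (λ a b s c d → (a :- b) :+ s :* (c :- d) := (a :+ s :* c) :- (b :+ s :* d)) refl _ _ _ _ _ ⟩
      (X 1# f k + s * shift (X 1# (μ (del (del S z) u))) k) - (∑ (λ v → A v k) + s * ∑ (λ v → shift (B v) k))
        ≡⟨ cong₂ (λ a b → a - (∑ (λ v → A v k) + b))
             (cong (λ a → X 1# f k + s * a) (shift-cong (X-cong (μ-cong (del-swap S z u))) k))
             (*-distribˡ-∑ s (λ v → shift (B v) k)) ⟩
      (X 1# f k + s * shift (X 1# g) k) - (∑ (λ v → A v k) + ∑ (λ v → s * shift (B v) k))
        ≡⟨ cong₂ _-_ (X-shift k) (trans (sym (∑-distrib-+ (λ v → A v k) (λ v → s * shift (B v) k))) (∑-cong (term k))) ⟩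
      X 1# (λ i → f i + s * shift g i) k - ∑ (λ v → if S v ∧ adj u v then Φ (del (del S u) v) k else 0#)
        ≡⟨ cong (_+ - ∑ (λ v → if S v ∧ adj u v then Φ (del (del S u) v) k else 0#))
             (X-cong (λ i → sym (Φ-in (del-keep S (λ z≡u → u≢z (sym z≡u)) Sz) i)) k) ⟩
      X 1# (Φ (del S u)) k - ∑ (λ v → if S v ∧ adj u v then Φ (del (del S u) v) k else 0#) ∎
      where
        open ≡-Reasoning
        f = μ (del S u)
        g = μ (del (del S u) z)
        A B : Fin n → Series
        A v i = if S v ∧ adj u v then μ (del (del S u) v) i else 0#
        B v i = if del S z v ∧ adj u v then μ (del (del (del S z) u) v) i else 0#
        shift-sub-∑ : ∀ a (h : Fin n → Series) k → shift (λ i → a i - ∑ (λ v → h v i)) k ≡ shift a k - ∑ (λ v → shift (h v) k)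
        shift-sub-∑ a h zero = sym (trans (cong (λ z → 0# - z) (∑-zero {n} (λ _ → refl))) (-‿inverseʳ 0#))
        shift-sub-∑ a h (suc k) = refl
        X-shift : ∀ k → X 1# f k + s * shift (X 1# g) k ≡ X 1# (λ i → f i + s * shift g i) k
        X-shift zero = solve 3 (λ a b s → a :* b :+ s :* con (+ 0) := a :* (b :+ s :* con (+ 0))) refl θ _ s
        X-shift (suc zero) = solve 6 (λ a b c d s e → (a :* b :+ c :* d) :+ s :* (a :* e) := a :* (b :+ s :* e) :+ c :* (d :+ s :* con (+ 0))) refl θ _ 1# _ s _
        X-shift (suc (suc k)) = solve 7 (λ a b c d s e h → (a :* b :+ c :* d) :+ s :* (a :* e :+ c :* h) := a :* (b :+ s :* e) :+ c :* (d :+ s :* h)) refl θ _ 1# _ s _ _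
        shift-zero : ∀ k → shift (λ _ → 0#) k ≡ 0#
        shift-zero zero = refl
        shift-zero (suc k) = refl
        no-weight : ∀ a k → a + s * shift (λ _ → 0#) k ≡ a
        no-weight a k = trans (cong (λ b → a + s * b) (shift-zero k)) (trans (cong (_+_ a) (zeroʳ s)) (+-identityʳ a))
        term : ∀ k v → A v k + s * shift (B v) k ≡ (if S v ∧ adj u v then Φ (del (del S u) v) k else 0#)
        term k v with v ≟ᶠ z
        ... | yes refl rewrite BoolP.∧-zeroʳ (S v) with S v ∧ adj u v
        ...   | true = trans (no-weight _ k) (sym (Φ-out {del (del S u) v} (del-self (del S u) v) k))
        ...   | false = no-weight 0# k
        term k v | no v≢z rewrite BoolP.∧-identityʳ (S v) with S v ∧ adj u v
        ...   | true = trans (cong (λ a → μ (del (del S u) v) k + s * a) (shift-cong (μ-cong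
                    (λ x → trans (del-cong (del-swap S z u) v x) (del-swap (del S u) z v x))) k))
                  (sym (Φ-in (del-keep (del S u) (λ z≡v → v≢z (sym z≡v)) (del-keep S (λ z≡u → u≢z (sym z≡u)) Sz)) k))
        ...   | false = no-weight 0# k

    Φ-recurrence : ∀ S u → S u ≡ true → ∀ k → Φ S k ≡
      X (weight u) (Φ (del S u)) k - ∑ (λ v → if S v ∧ adj u v then Φ (del (del S u) v) k else 0#)
    Φ-recurrence S u Su k with u ≟ᶠ z
    ... | yes refl = begin
      Φ S k
        ≡⟨ Φ-in Su k ⟩
      μ S k + s * shift f k
        ≡⟨ cong (_+ s * shift f k) (μ-recurrence S z Su k) ⟩
      (X 1# f k - ∑ (λ v → if S v ∧ adj z v then μ (del (del S z) v) k else 0#)) + s * shift f k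
        ≡⟨ solve 3 (λ a b c → (a :- b) :+ c := (a :+ c) :- b) refl _ _ _ ⟩
      (X 1# f k + s * shift f k) - ∑ (λ v → if S v ∧ adj z v then μ (del (del S z) v) k else 0#)
        ≡⟨ cong₂ _-_ (trans (X-+ k) (X-cong (λ i → sym (Φ-out (del-self S z) i)) k))
             (∑-cong (λ v → cong (λ a → if S v ∧ adj z v then a else 0#)
               (sym (Φ-out {del (del S z) v} (cong (_∧ not (eqᶠ z v)) (del-self S z)) k)))) ⟩
      X (1# + s) (Φ (del S z)) k - ∑ (λ v → if S v ∧ adj z v then Φ (del (del S z) v) k else 0#) ∎
      where
        open ≡-Reasoning
        f = μ (del S z)
        X-+ : ∀ k → X 1# f k + s * shift f k ≡ X (1# + s) f k
        X-+ zero = trans (cong (_+_ _) (zeroʳ s)) (+-identityʳ _)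
        X-+ (suc k) = solve 5 (λ a b c d s → (a :* b :+ c :* d) :+ s :* d := a :* b :+ (c :+ s) :* d) refl θ _ 1# _ s
    ... | no u≢z with S z BoolP.≟ true
    ...   | yes Sz = Φ-recurrence-in S u Su Sz u≢z k
    ...   | no ¬Sz = Φ-recurrence-out S u Su (BoolP.¬-not ¬Sz) k

    open Rayleigh Φ weight Φ-cong Φ-recurrence public

    Φ-vanish : ∀ {S a b} → S z ≡ true → a ℕ.≤ m S → b ℕ.≤ m (del S z) → a ℕ.≤ suc b → Vanish a (Φ S)
    Φ-vanish {S} Sz p q r i lt = trans (Φ-in Sz i) (trans (cong₂ (λ a b → a + s * b) (vanish-below S p i lt)
      (shift-vanish (vanish-below (del S z) q) i (ℕP.<-≤-trans lt r))) (trans (+-identityˡ _) (zeroʳ s)))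

    -- The perturbation only starts in degree m(S-z) + 1. This decides which factors of a leading
    -- coefficient are independent of s.
    Φ-unweighted : ∀ {S} j → S z ≡ true → j ℕ.≤ m (del S z) → Φ S j ≡ μ S j
    Φ-unweighted {S} j Sz le = trans (Φ-in Sz j) (trans (cong (λ b → μ S j + s * b)
      (shift-vanish (vanish-below (del S z) le) j ℕP.≤-refl)) (trans (cong (_+_ _) (zeroʳ s)) (+-identityʳ _)))

-- Existence of essential vertices, dependence, and stability under deleting a special vertex.

module Stability (F : RealField) (θ : RealField.R F) {n : ℕ} (adj : Adj n)
  (symmetric : ∀ u v → adj u v ≡ adj v u) (irreflexive : ∀ u → adj u u ≡ false) where
  open OrderedField F
  open PowerSeries F θ
  open MatchingSeries F θ adj symmetric irreflexive
  open Multiplicity F θ adj symmetric irreflexive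

  m-rotate : ∀ S a b c → m (del (del (del S a) b) c) ≡ m (del (del (del S b) c) a)
  m-rotate S a b c = m-cong (λ i → trans (del-cong (del-swap S a b) c i) (del-swap (del S b) a c i))

  interlace-≤ : ∀ {a b} → Interlace a b → a ℕ.≤ suc b
  interlace-≤ (lower refl) = ℕP.≤-refl
  interlace-≤ (equal refl) = ℕP.n≤1+n _
  interlace-≤ (upper refl) = ℕP.m≤n⇒m≤1+n (ℕP.n≤1+n _)

  interlace-≥ : ∀ {a b} → Interlace a b → b ℕ.≤ suc a
  interlace-≥ (lower refl) = ℕP.m≤n⇒m≤1+n (ℕP.n≤1+n _)
  interlace-≥ (equal refl) = ℕP.n≤1+n _
  interlace-≥ (upper refl) = ℕP.≤-refl

  m-del-≥ : ∀ {j} S u → S u ≡ true → suc j ℕ.≤ m S → j ℕ.≤ m (del S u)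
  m-del-≥ S u Su le = ℕ.s≤s⁻¹ (ℕP.≤-trans le (interlace-≤ (interlace S u Su)))

  m-del-≤ : ∀ {j} S u → S u ≡ true → m S ℕ.≤ j → m (del S u) ℕ.≤ suc j
  m-del-≤ S u Su le = ℕP.≤-trans (interlace-≥ (interlace S u Su)) (s≤s le)

  m-undel-≤ : ∀ {j} S u → S u ≡ true → m (del S u) ℕ.≤ j → m S ℕ.≤ suc j
  m-undel-≤ S u Su le = ℕP.≤-trans (interlace-≤ (interlace S u Su)) (s≤s le)

  -- If c ceased to be essential, the leading term of Δ S b c would have odd degree.
  neutral-preserves-essential : ∀ S b c → S b ≡ true → S c ≡ true → b ≢ c →
    m (del S b) ≡ m S → suc (m (del S c)) ≡ m S → suc (m (del (del S b) c)) ≡ m S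
  neutral-preserves-essential S b c Sb Sc b≢c neutral essential
    with suc (m (del (del S b) c)) ℕ.≤? m S
  ... | yes le = ℕP.≤-antisym le (ℕP.≤-trans (ℕP.≤-reflexive (sym neutral))
          (interlace-≤ (interlace (del S b) c (del-keep S (λ c≡b → b≢c (sym c≡b)) Sc))))
  ... | no ≰ = ⊥-elim (odd-left S b c Sb Sc b≢c (m (del S c))
          (cong (ℕ._+ m (del S c)) (trans neutral (sym essential)))
          (ℕP.<-≤-trans (ℕP.+-monoʳ-< (m (del S b)) (ℕP.≤-reflexive essential))
            (ℕP.+-mono-≤ (ℕP.≤-reflexive neutral) (ℕ.s≤s⁻¹ (ℕP.≰⇒> ≰)))))

  -- For neutral b this is the parity argument. For positive b interlacing suffices: m(S-b-c) is at
  -- most m(S-c) + 1 = m S and at least m(S-b) - 1 = m S.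
  nonessential-preserves-essential : ∀ S b c → S b ≡ true → S c ≡ true → b ≢ c →
    m S ℕ.≤ m (del S b) → suc (m (del S c)) ≡ m S → suc (m (del (del S b) c)) ≡ m (del S b)
  nonessential-preserves-essential S b c Sb Sc b≢c nonessential essential with interlace S b Sb
  ... | lower p = ⊥-elim (ℕP.<-irrefl refl (ℕP.≤-trans (ℕP.≤-reflexive (sym p)) nonessential))
  ... | equal p = trans (neutral-preserves-essential S b c Sb Sc b≢c (sym p) essential) p
  ... | upper p = ℕP.≤-antisym
          (subst (λ k → suc k ℕ.≤ m (del S b)) (m-swap S c b)
            (ℕP.≤-trans (s≤s (m-del-≤ (del S c) b (del-keep S b≢c Sb) ℕP.≤-refl))
              (ℕP.≤-reflexive (trans (cong suc essential) (sym p)))))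
          (interlace-≤ (interlace (del S b) c (del-keep S (λ c≡b → b≢c (sym c≡b)) Sc)))

  -- The essential neighbour c is still essential once a is deleted, so its residue forces a pole.
  special⇒positive : ∀ S a c → S a ≡ true → S c ≡ true → adj a c ≡ true →
    m S ℕ.≤ m (del S a) → suc (m (del S c)) ≡ m S → m (del S a) ≡ suc (m S)
  special⇒positive S a c Sa Sc ac nonessential essential =
    essential-neighbour⇒positive S a c Sa Sc ac
      (nonessential-preserves-essential S a c Sa Sc
        (λ a≡c → neighbour-≢ adj symmetric irreflexive ac (sym a≡c)) nonessential essential)

  private
    minus-one : ∀ x → x + - (x + 1#) < 0#
    minus-one x = subst (_< 0#) (solve 2 (λ x o → :- o := x :+ :- (x :+ o)) refl x 1#) (neg-negative 0<1)

  -- Otherwise every vertex is positive, and then the leading coefficient of Δ S u w is affine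
  -- and non-constant in the weight of z, so it takes negative values.
  essential-exists : ∀ N S → size S ℕ.≤ N → ∀ j → m S ≡ suc j → ∃ λ w → S w ≡ true × suc (m (del S w)) ≡ m S
  essential-exists N S sz j mS with FinP.any? (λ w → (S w ∧ (suc (m (del S w)) ≡ᵇ m S)) BoolP.≟ true)
  ... | yes (w , t) = w , proj₁ (∧-true t) , ≡ᵇ-true (proj₂ (∧-true {S w} t))
  ... | no none with empty-or-∈ S
  ...   | inj₂ empty with trans (sym mS) (m-empty empty)
  ...     | ()
  essential-exists zero S sz j mS | no none | inj₁ (u , Su) = ⊥-elim (size-positive S u Su sz)
  essential-exists (suc N) S sz j mS | no none | inj₁ (u , Su) = ⊥-elim impossible
    where
      nonessential : ∀ w → S w ≡ true → suc (m (del S w)) ≢ m S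
      nonessential w Sw eq = none (w , cong₂ _∧_ Sw (≡ᵇ-intro eq))
      -- For neutral x, induction gives w essential in S - x. Then m(S-x) = m(S-w) = j + 1 and
      -- m(S-x-w) = j, so Δ S x w would lead in the odd degree 2j + 1.
      not-neutral : ∀ x → S x ≡ true → m S ≢ m (del S x)
      not-neutral x Sx neutral with essential-exists N (del S x) (size-del-≤ S x Sx sz) j (trans (sym neutral) mS)
      ... | w , t , eq with del-∈ S t
      ...   | Sw , w≢x = odd-right S x w Sx Sw (λ x≡w → w≢x (sym x≡w)) j
              (cong₂ ℕ._+_ mS mxw)
              (ℕP.<-≤-trans (ℕP.+-monoʳ-< (m S) (subst (ℕ._< m (del S w)) (sym mxw) (ℕP.≤-reflexive (sym mw))))
                (ℕP.+-monoˡ-≤ (m (del S w)) (ℕP.≤-reflexive neutral)))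
        where
          mxw : m (del (del S x) w) ≡ j
          mxw = ℕP.suc-injective (trans eq (trans (sym neutral) mS))
          mw : m (del S w) ≡ suc j
          mw with interlace S w Sw
          ... | lower p = ⊥-elim (nonessential w Sw (sym p))
          ... | equal p = trans (sym p) mS
          ... | upper p = ⊥-elim (ℕP.<-irrefl refl (ℕP.≤-trans (ℕP.≤-reflexive (trans (cong suc (sym mS)) (sym p)))
                  (m-undel-≤ (del S w) x (del-keep S (λ x≡w → w≢x (sym x≡w)) Sx)
                    (ℕP.≤-reflexive (trans (m-swap S w x) mxw)))))
      positive : ∀ x → S x ≡ true → m (del S x) ≡ suc (suc j)
      positive x Sx with interlace S x Sx
      ... | lower p = ⊥-elim (nonessential x Sx (sym p))
      ... | equal p = ⊥-elim (not-neutral x Sx p)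
      ... | upper p = trans p (cong suc mS)
      impossible : ⊥
      impossible with essential-exists N (del S u) (size-del-≤ S u Su sz) (suc j) (positive u Su)
      ... | w , uw , eqw with del-∈ S uw
      ...   | Sw , w≢u with essential-exists N (del (del S u) w)
                (ℕP.<⇒≤ (subst (ℕ._≤ N) (size-del (del S u) w uw) (size-del-≤ S u Su sz))) j
                (ℕP.suc-injective (trans eqw (positive u Su)))
      ...     | z , uwz , eqz with del-∈ (del S u) uwz
      ...       | uz , z≢w with del-∈ S uz
      ...         | Sz , z≢u = contradict (solve-affine α 1# (nonzero-at _ mwuz) (nonzero-at S mS))
        where
          wz : del S w z ≡ true
          wz = del-keep S z≢w Sz
          muw : m (del (del S u) w) ≡ suc j
          muw = ℕP.suc-injective (trans eqw (positive u Su))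
          mwuz : m (del (del (del S u) w) z) ≡ j
          mwuz = ℕP.suc-injective (trans eqz muw)
          pair-≥ : ∀ x → S x ≡ true → del S x z ≡ true → suc j ℕ.≤ m (del (del S x) z)
          pair-≥ x Sx xz = m-del-≥ (del S x) z xz (ℕP.≤-reflexive (sym (positive x Sx)))
          -- `Φ (del S u)` has no term of degree j + 1, as u is positive. Hence Δ has minus the
          -- other product there, in which Φ(S-u-w) contributes α + s β; the slope β is non-zero
          -- because z lowers the multiplicity to j. The choice of s makes the value -1.
          α = μ (del (del S u) w) (suc j)
          β = μ (del (del (del S u) w) z) j
          contradict : (∃ λ s → (α + s * β) * μ S (suc j) ≡ 1#) → ⊥
          contradict (s , eq) = W.Δ-leading S u w Su Sw (λ u≡w → w≢u (sym u≡w)) (suc j) (suc j) (suc j) (suc j)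
              (W.Φ-vanish uz (ℕP.<⇒≤ (ℕP.≤-reflexive (sym (positive u Su)))) (pair-≥ u Su uz) (ℕP.n≤1+n _))
              (W.Φ-vanish wz (ℕP.<⇒≤ (ℕP.≤-reflexive (sym (positive w Sw)))) (pair-≥ w Sw wz) (ℕP.n≤1+n _))
              (W.Φ-vanish Sz (ℕP.≤-reflexive (sym mS)) (ℕP.≤-reflexive (sym (positive z Sz))) (ℕP.m≤n⇒m≤1+n (ℕP.n≤1+n _)))
              (W.Φ-vanish uwz (ℕP.≤-reflexive (sym muw)) (ℕP.≤-reflexive (sym mwuz)) ℕP.≤-refl)
              refl
              (subst (_< 0#) (sym value) (neg-negative 0<1))
            where
              module W = Weighted z s
              value : W.Φ (del S u) (suc j) * W.Φ (del S w) (suc j) - W.Φ S (suc j) * W.Φ (del (del S u) w) (suc j) ≡ - 1#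
              value = trans (cong₂ (λ a b → a * W.Φ (del S w) (suc j) - b)
                  (trans (W.Φ-unweighted (suc j) uz (pair-≥ u Su uz))
                    (vanish-below (del S u) (ℕP.≤-reflexive (sym (positive u Su))) (suc j) ℕP.≤-refl))
                  (trans (cong₂ _*_ (W.Φ-unweighted (suc j) Sz (ℕP.<⇒≤ (ℕP.≤-reflexive (sym (positive z Sz))))) (W.Φ-in uwz (suc j)))
                    (trans (*-comm _ _) eq)))
                (solve 2 (λ a o → con (+ 0) :* a :- o := :- o) refl _ 1#)

  -- Being dependent (deleting both lowers the multiplicity by at most one) is transitive
  -- among essential vertices: the leading coefficient of Δ K c w is affine and non-constant
  -- in the weight of b.
  dependence-transitive : ∀ K b c w j → K b ≡ true → K c ≡ true → K w ≡ true → b ≢ c → b ≢ w → c ≢ w →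
    m K ≡ suc (suc j) → m (del K b) ≡ suc j → m (del K c) ≡ suc j → m (del K w) ≡ suc j →
    suc j ℕ.≤ m (del (del K c) b) → suc j ℕ.≤ m (del (del K w) b) → m (del (del K c) w) ≢ j
  dependence-transitive K b c w j Kb Kc Kw b≢c b≢w c≢w mK mb mc mw mcb mwb mcw =
    -- If deleting c and w lowered the multiplicity to j, the factor multiplying the affine function
    -- of s would be non-zero. The target p + 1 then makes the leading coefficient of Δ equal to -1.
    contradict (solve-affine (μ K (suc (suc j))) (p + 1#) (nonzero-at (del K b) mb) (nonzero-at _ mcw))
    where
      p = μ (del K c) (suc j) * μ (del K w) (suc j)
      cb : del K c b ≡ true
      cb = del-keep K b≢c Kb
      wb : del K w b ≡ true
      wb = del-keep K b≢w Kb
      cw : del K c w ≡ true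
      cw = del-keep K (λ w≡c → c≢w (sym w≡c)) Kw
      cwb : del (del K c) w b ≡ true
      cwb = del-keep (del K c) b≢w cb
      mcwb : j ℕ.≤ m (del (del (del K c) w) b)
      mcwb = subst (j ℕ.≤_) (m-swap (del K c) b w)
        (m-del-≥ (del (del K c) b) w (del-keep (del K c) (λ w≡b → b≢w (sym w≡b)) cw) mcb)
      contradict : (∃ λ s → (μ K (suc (suc j)) + s * μ (del K b) (suc j)) * μ (del (del K c) w) j ≡ p + 1#) → ⊥
      contradict (s , eq) = W.Δ-leading K c w Kc Kw c≢w (suc j) (suc j) (suc (suc j)) j
          (W.Φ-vanish cb (ℕP.≤-reflexive (sym mc)) mcb (ℕP.n≤1+n _))
          (W.Φ-vanish wb (ℕP.≤-reflexive (sym mw)) mwb (ℕP.n≤1+n _))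
          (W.Φ-vanish Kb (ℕP.≤-reflexive (sym mK)) (ℕP.≤-reflexive (sym mb)) ℕP.≤-refl)
          (W.Φ-vanish cwb (ℕP.≤-reflexive (sym mcw)) mcwb (ℕP.n≤1+n _))
          (cong suc (ℕP.+-suc j j))
          (subst (_< 0#) (sym value) (minus-one p))
        where
          module W = Weighted b s
          value : W.Φ (del K c) (suc j) * W.Φ (del K w) (suc j) - W.Φ K (suc (suc j)) * W.Φ (del (del K c) w) j ≡ p + - (p + 1#)
          value = cong₂ _-_ (cong₂ _*_ (W.Φ-unweighted (suc j) cb mcb) (W.Φ-unweighted (suc j) wb mwb))
            (trans (cong₂ _*_ (W.Φ-in Kb (suc (suc j))) (W.Φ-unweighted j cwb mcwb)) eq)

  -- Interlacing from both sides: m(S-b) = m S - 1 and m(S-a) = m S + 1 leave only m S in between.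
  essential-del-special : ∀ S a b → S a ≡ true → S b ≡ true → b ≢ a →
    m (del S a) ≡ suc (m S) → suc (m (del S b)) ≡ m S → m (del (del S a) b) ≡ suc (m (del S b))
  essential-del-special S a b Sa Sb b≢a positive essential = ℕP.≤-antisym
    (subst (ℕ._≤ suc (m (del S b))) (m-swap S b a)
      (m-del-≤ (del S b) a (del-keep S (λ a≡b → b≢a (sym a≡b)) Sa) ℕP.≤-refl))
    (m-del-≥ (del S a) b (del-keep S b≢a Sb) (ℕP.≤-reflexive (trans (cong suc essential) (sym positive))))

  -- If a were essential in S ∖ b, then b would be dependent on every neighbour of a that is
  -- essential in S ∖ a, while c essential in S provides two independent such neighbours.
  special-stable : ∀ S a c b → S a ≡ true → S c ≡ true → adj a c ≡ true → m S ℕ.≤ m (del S a) →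
    suc (m (del S c)) ≡ m S → S b ≡ true → b ≢ a → m (del (del S a) b) ≡ suc (m (del S b))
  special-stable S a c b Sa Sc ac nonessential essential Sb b≢a with m S ℕ.≤? m (del S b)
  ... | no ≰ = essential-del-special S a b Sa Sb b≢a
          (special⇒positive S a c Sa Sc ac nonessential essential)
          (ℕP.≤-antisym (ℕP.≰⇒> ≰) (interlace-≤ (interlace S b Sb)))
  ... | yes b-nonessential with m (del S b) ℕ.≤? m (del (del S b) a)
  -- The vertex c stays essential in S - b, so a still has an essential neighbour there.
  ...   | yes a-nonessential = trans (m-swap S a b) (special⇒positive (del S b) a c
            (del-keep S (λ a≡b → b≢a (sym a≡b)) Sa) (del-keep S c≢b Sc) ac a-nonessential
            (nonessential-preserves-essential S b c Sb Sc (λ b≡c → c≢b (sym b≡c)) b-nonessential essential))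
    where
      c≢b : c ≢ b
      c≢b refl = ℕP.<-irrefl refl (ℕP.≤-trans (ℕP.≤-reflexive essential) b-nonessential)
  -- In S - c the vertex a is still positive, so it has a neighbour w that is essential in S - c -
  -- a. The two independent neighbours are c and w.
  ...   | no a-essential = ⊥-elim (impossible
            (positive⇒essential-neighbour (del S c) a (del-keep S a≢c Sa) (trans (m-swap S c a) mac)))
    where
      j = m (del S c)
      K = del S a
      positive : m K ≡ suc (m S)
      positive = special⇒positive S a c Sa Sc ac nonessential essential
      c≢b : c ≢ b
      c≢b refl = ℕP.<-irrefl refl (ℕP.≤-trans (ℕP.≤-reflexive essential) b-nonessential)
      c≢a : c ≢ a
      c≢a = neighbour-≢ adj symmetric irreflexive ac
      a≢c : a ≢ c
      a≢c a≡c = c≢a (sym a≡c)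
      ba : del S b a ≡ true
      ba = del-keep S (λ a≡b → b≢a (sym a≡b)) Sa
      mac : m (del K c) ≡ suc j
      mac = essential-del-special S a c Sa Sc c≢a positive essential
      mK : m K ≡ suc (suc j)
      mK = trans positive (cong suc (sym essential))
      mab : m (del K b) ≡ suc j
      mab = ℕP.≤-antisym
        (subst (ℕ._≤ suc j) (m-swap S b a) (ℕ.s≤s⁻¹ (ℕP.≤-trans (ℕP.≰⇒> a-essential)
          (ℕP.≤-trans (interlace-≥ (interlace S b Sb)) (ℕP.≤-reflexive (cong suc (sym essential)))))))
        (m-del-≥ K b (del-keep S b≢a Sb) (ℕP.≤-reflexive (sym mK)))
      -- Otherwise v would be essential in S - b - a, and then its residue would make a positive in
      -- S - b.
      dependent : ∀ v → S v ≡ true → v ≢ b → adj a v ≡ true → suc j ℕ.≤ m (del (del K v) b)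
      dependent v Sv v≢b av with suc j ℕ.≤? m (del (del (del S b) a) v)
      ... | yes le = subst (suc j ℕ.≤_) (m-rotate S b a v) le
      ... | no ≰ = ⊥-elim (a-essential (ℕP.<⇒≤ (ℕP.≤-reflexive (sym
              (essential-neighbour⇒positive (del S b) a v ba (del-keep S v≢b Sv) av
                (ℕP.≤-antisym (subst (suc (m (del (del (del S b) a) v)) ℕ.≤_) (sym mba) (ℕP.≰⇒> ≰))
                  (interlace-≤ (interlace (del (del S b) a) v
                    (del-keep (del S b) (neighbour-≢ adj symmetric irreflexive av) (del-keep S v≢b Sv))))))))))
        where
          mba : m (del (del S b) a) ≡ suc j
          mba = trans (m-swap S b a) mab
      impossible : (∃ λ w → del S c w ≡ true × adj a w ≡ true × suc (m (del (del (del S c) a) w)) ≡ m (del (del S c) a)) → ⊥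
      impossible (w , cw , aw , eq) with del-∈ S cw
      ... | Sw , w≢c = by-cases (w ≟ᶠ b)
        where
          w≢a : w ≢ a
          w≢a = neighbour-≢ adj symmetric irreflexive aw
          macw : m (del (del K c) w) ≡ j
          macw = ℕP.suc-injective (trans (cong suc (m-cong (del-cong (del-swap S a c) w)))
            (trans eq (trans (m-swap S c a) mac)))
          maw : m (del K w) ≡ suc j
          maw = ℕP.≤-antisym
            (m-undel-≤ (del K w) c (del-keep K (λ c≡w → w≢c (sym c≡w)) (del-keep S c≢a Sc))
              (ℕP.≤-reflexive (trans (m-swap K w c) macw)))
            (m-del-≥ K w (del-keep S w≢a Sw) (ℕP.≤-reflexive (sym mK)))
          by-cases : Dec (w ≡ b) → ⊥
          -- Transitivity needs three distinct vertices; for w = b the dependence of c on b is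
          -- already the contradiction.
          by-cases (yes refl) = ℕP.<-irrefl refl (subst (suc j ℕ.≤_) macw (dependent c Sc c≢b ac))
          by-cases (no w≢b) = dependence-transitive K b c w j (del-keep S b≢a Sb) (del-keep S c≢a Sc) (del-keep S w≢a Sw)
            (λ b≡c → c≢b (sym b≡c)) (λ b≡w → w≢b (sym b≡w)) (λ c≡w → w≢c (sym c≡w))
            mK mab mac maw (dependent c Sc c≢b ac) (dependent w Sw w≢b aw) macw

-- Bounded search and set operations on masks.

any-tabulate-elim : ∀ {A : Set} {n} (p : A → Bool) (f : Fin n → A) → any p (tabulate f) ≡ true →
  ∃ λ i → p (f i) ≡ true
any-tabulate-elim {n = suc n} p f t with p (f zero) in eq
... | true = zero , eq
... | false with any-tabulate-elim p (λ i → f (suc i)) t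
...   | i , q = suc i , q

any-tabulate-intro : ∀ {A : Set} {n} (p : A → Bool) (f : Fin n → A) i → p (f i) ≡ true →
  any p (tabulate f) ≡ true
any-tabulate-intro p f zero q = cong (_∨ any p (tabulate (λ i → f (suc i)))) q
any-tabulate-intro p f (suc i) q =
  trans (cong (p (f zero) ∨_) (any-tabulate-intro p (λ i → f (suc i)) i q)) (BoolP.∨-zeroʳ _)

any-cong : ∀ {A : Set} {p q : A → Bool} → (∀ x → p x ≡ q x) → ∀ xs → any p xs ≡ any q xs
any-cong eq [] = refl
any-cong eq (x ∷ xs) = cong₂ _∨_ (eq x) (any-cong eq xs)

module _ {n : ℕ} where

  infixl 7 _∩_ _∖_
  _∩_ _∖_ : Mask n → Mask n → Mask n
  (S ∩ X) i = S i ∧ X i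
  (S ∖ X) i = S i ∧ not (X i)

  ∖-∈ : ∀ (S X : Mask n) {i} → S i ≡ true → X i ≡ false → (S ∖ X) i ≡ true
  ∖-∈ S X p q = cong₂ (λ a b → a ∧ not b) p q

  del-∩ : ∀ (S X : Mask n) u i → (del S u ∩ X) i ≡ del (S ∩ X) u i
  del-∩ S X u i with S i | X i
  ... | false | _ = refl
  ... | true | true = BoolP.∧-identityʳ _
  ... | true | false = BoolP.∧-zeroʳ _

  del-∖ : ∀ (S X : Mask n) u i → (del S u ∖ X) i ≡ del (S ∖ X) u i
  del-∖ S X u i = del-∩ S (λ j → not (X j)) u i

  del-absent : ∀ (S : Mask n) {u} → S u ≡ false → ∀ i → del S u i ≡ S i
  del-absent S {u} Su i with i ≟ᶠ u
  ... | yes refl rewrite Su = refl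
  ... | no _ = BoolP.∧-identityʳ (S i)

-- Removing special vertices, adding universal vertices, splitting into separated parts.

module Decomposition (F : RealField) (θ : RealField.R F) {n : ℕ} (adj : Adj n)
  (symmetric : ∀ u v → adj u v ≡ adj v u) (irreflexive : ∀ u → adj u u ≡ false) where
  open OrderedField F using (_-_; ∑; ∑-cong; 0#; 1#)
  open PowerSeries F θ
  open MatchingSeries F θ adj symmetric irreflexive
  open Multiplicity F θ adj symmetric irreflexive
  open Stability F θ adj symmetric irreflexive

  -- The statuses of the theorem restated with the sealed `m`.
  essential special : Mask n → Mask n
  essential S u = S u ∧ (suc (m (del S u)) ≡ᵇ m S)
  special S u = S u ∧ not (essential S u) ∧ any (λ v → S v ∧ adj u v ∧ essential S v) (allFin n)

  special-specialᵇ : ∀ S u → specialᵇ F θ adj S u ≡ special S u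
  special-specialᵇ S u = cong₂ (λ e a → S u ∧ not e ∧ a) (same u)
    (any-cong (λ v → cong (λ e → S v ∧ adj u v ∧ e) (same v)) (allFin n))
    where
      same : ∀ v → essentialᵇ F θ adj S v ≡ essential S v
      same v = cong₂ (λ a b → S v ∧ (suc a ≡ᵇ b)) (sym (m-mult (del S v))) (sym (m-mult S))

  essential-elim : ∀ S u → essential S u ≡ true → suc (m (del S u)) ≡ m S
  essential-elim S u t = ≡ᵇ-true (proj₂ (∧-true {S u} t))

  essential-intro : ∀ S u → S u ≡ true → suc (m (del S u)) ≡ m S → essential S u ≡ true
  essential-intro S u Su eq = cong₂ _∧_ Su (≡ᵇ-intro eq)

  nonessential : ∀ S u → S u ≡ true → suc (m (del S u)) ≢ m S → m S ℕ.≤ m (del S u)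
  nonessential S u Su ≢ with interlace S u Su
  ... | lower p = ⊥-elim (≢ (sym p))
  ... | equal p = ℕP.≤-reflexive p
  ... | upper p = ℕP.<⇒≤ (ℕP.≤-reflexive (sym p))

  special-elim : ∀ S u → special S u ≡ true → S u ≡ true × m S ℕ.≤ m (del S u) ×
    ∃ λ c → S c ≡ true × adj u c ≡ true × suc (m (del S c)) ≡ m S
  special-elim S u t with ∧-true {S u} t
  ... | Su , t′ with ∧-true {not (essential S u)} t′
  ...   | ne , has with any-tabulate-elim (λ v → S v ∧ adj u v ∧ essential S v) (λ i → i) has
  ...     | c , t″ with ∧-true {S c} t″
  ...       | Sc , t‴ = Su , nonessential S u Su (λ eq → false≢true (BoolP.not-injective ne) (essential-intro S u Su eq))
              , c , Sc , proj₁ (∧-true {adj u c} t‴) , essential-elim S c (proj₂ (∧-true {adj u c} t‴))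

  special-intro : ∀ S u c → S u ≡ true → m S ℕ.≤ m (del S u) → S c ≡ true → adj u c ≡ true →
    suc (m (del S c)) ≡ m S → special S u ≡ true
  special-intro S u c Su ne Sc uc eq = cong₂ _∧_ Su (cong₂ _∧_
    (cong not (BoolP.¬-not (λ t → ℕP.<-irrefl refl (ℕP.≤-trans (ℕP.≤-reflexive (essential-elim S u t)) ne))))
    (any-tabulate-intro (λ v → S v ∧ adj u v ∧ essential S v) (λ i → i) c
      (cong₂ _∧_ Sc (cong₂ _∧_ uc (essential-intro S c Sc eq)))))

  special-positive : ∀ S a → special S a ≡ true → m (del S a) ≡ suc (m S)
  special-positive S a t with special-elim S a t
  ... | Sa , ne , c , Sc , ac , eq = special⇒positive S a c Sa Sc ac ne eq

  special-del : ∀ S a b → special S a ≡ true → S b ≡ true → b ≢ a → m (del (del S a) b) ≡ suc (m (del S b))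
  special-del S a b t Sb b≢a with special-elim S a t
  ... | Sa , ne , c , Sc , ac , eq = special-stable S a c b Sa Sc ac ne eq Sb b≢a

  special-not-essential : ∀ S a → special S a ≡ true → essential S a ≡ false
  special-not-essential S a t = BoolP.not-injective (proj₁ (∧-true {not (essential S a)} (proj₂ (∧-true {S a} t))))

  -- The deletion of a raises both multiplicities that are compared by one.
  essential-stable : ∀ S a b → special S a ≡ true → b ≢ a → essential (del S a) b ≡ essential S b
  essential-stable S a b t b≢a with S b BoolP.≟ true
  ... | yes Sb = cong₂ _∧_ (del-≢ S b≢a) (cong₂ (λ x y → suc x ≡ᵇ y)
          (special-del S a b t Sb b≢a) (special-positive S a t))
  ... | no ¬Sb = trans (cong (_∧ (suc (m (del (del S a) b)) ≡ᵇ m (del S a)))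
                   (trans (del-≢ S b≢a) (BoolP.¬-not ¬Sb)))
                 (sym (cong (_∧ (suc (m (del S b)) ≡ᵇ m S)) (BoolP.¬-not ¬Sb)))

  -- The other vertices keep their essential status, and a itself is not essential, so no vertex
  -- gains or loses an essential neighbour.
  special-stable-mask : ∀ S a b → special S a ≡ true → special (del S a) b ≡ del (special S) a b
  special-stable-mask S a b t = by-cases (b ≟ᶠ a)
    where
      by-cases : Dec (b ≡ a) → special (del S a) b ≡ del (special S) a b
      by-cases (yes refl) = trans (cong (_∧ (not (essential (del S b) b) ∧ any (λ v → del S b v ∧ adj b v ∧ essential (del S b) v) (allFin n)))
        (del-self S b)) (sym (del-self (special S) b))
      by-cases (no b≢a) = trans (cong₂ _∧_ (del-≢ S b≢a) (cong₂ _∧_ (cong not (essential-stable S a b t b≢a))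
        (any-cong neighbour (allFin n)))) (sym (del-≢ (special S) b≢a))
        where
          neighbour : ∀ v → del S a v ∧ adj b v ∧ essential (del S a) v ≡ S v ∧ adj b v ∧ essential S v
          neighbour v = at (v ≟ᶠ a)
            where
              at : Dec (v ≡ a) → del S a v ∧ adj b v ∧ essential (del S a) v ≡ S v ∧ adj b v ∧ essential S v
              at (yes refl) = trans (cong (_∧ (adj b v ∧ essential (del S v) v)) (del-self S v))
                (sym (trans (cong (λ e → S v ∧ adj b v ∧ e) (special-not-essential S v t))
                  (trans (cong (S v ∧_) (BoolP.∧-zeroʳ (adj b v))) (BoolP.∧-zeroʳ (S v)))))
              at (no v≢a) = cong₂ (λ x y → x ∧ adj b v ∧ y) (del-≢ S v≢a) (essential-stable S a v t v≢a)

  -- One special vertex is deleted at a time, and the remaining ones are then exactly the special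
  -- vertices of what is left. The second component is what lets statuses be read off after the
  -- removal.
  remove-specials : ∀ N S → size (special S) ≡ N → m (S ∖ special S) ≡ N ℕ.+ m S ×
    (∀ b → (S ∖ special S) b ≡ true → m (del (S ∖ special S) b) ≡ N ℕ.+ m (del S b))
  remove-specials zero S sz = m-cong same , λ b _ → m-cong (del-cong same b)
    where
      same : ∀ i → (S ∖ special S) i ≡ S i
      same i = trans (cong (λ b → S i ∧ not b) (size-zero (special S) sz i)) (BoolP.∧-identityʳ (S i))
  remove-specials (suc N) S sz with empty-or-∈ (special S)
  ... | inj₂ none with trans (sym sz) (size-empty none)
  ...   | ()
  remove-specials (suc N) S sz | inj₁ (a , t) =
      trans (m-cong (λ i → sym (same i))) (trans (proj₁ IH) (trans (cong (N ℕ.+_) (special-positive S a t)) (ℕP.+-suc N (m S))))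
    , λ b rb → trans (m-cong (del-cong (λ i → sym (same i)) b)) (trans (proj₂ IH b (trans (same b) rb))
        (trans (cong (N ℕ.+_) (special-del S a b t (proj₁ (∧-true {S b} rb)) (b≢a b rb))) (ℕP.+-suc N (m (del S b)))))
    where
      IH = remove-specials N (del S a) (trans (size-cong (λ b → special-stable-mask S a b t))
             (ℕP.suc-injective (trans (sym (size-del (special S) a t)) sz)))
      outside : (S ∖ special S) a ≡ false
      outside = trans (cong (λ b → S a ∧ not b) t) (BoolP.∧-zeroʳ (S a))
      b≢a : ∀ b → (S ∖ special S) b ≡ true → b ≢ a
      b≢a b rb refl = false≢true outside rb
      same : ∀ i → (del S a ∖ special (del S a)) i ≡ (S ∖ special S) i
      same i = by-cases (i ≟ᶠ a)
        where
          by-cases : Dec (i ≡ a) → (del S a ∖ special (del S a)) i ≡ (S ∖ special S) i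
          by-cases (yes refl) = trans (cong (_∧ not (special (del S i) i)) (del-self S i)) (sym outside)
          by-cases (no i≢a) = cong₂ (λ x y → x ∧ not y) (del-≢ S i≢a)
            (trans (special-stable-mask S a i t) (del-≢ (special S) i≢a))

  -- A vertex adjacent to all others is positive as soon as an essential vertex exists.
  m-join : ∀ (A : Mask n) → (∀ a z → A a ≡ true → z ≢ a → adj a z ≡ true) → ∀ N U →
    size (U ∩ A) ≡ N → N ℕ.≤ m (U ∖ A) → N ℕ.+ m U ≡ m (U ∖ A)
  m-join A joined zero U sz le = m-cong same
    where
      same : ∀ i → U i ≡ (U ∖ A) i
      same i with U i | size-zero (U ∩ A) sz i
      ... | false | _ = refl
      ... | true | none = cong not (sym none)
  m-join A joined (suc N) U sz le with empty-or-∈ (U ∩ A)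
  ... | inj₂ none with trans (sym sz) (size-empty none)
  ...   | ()
  m-join A joined (suc N) U sz le | inj₁ (a , t) =
    trans (sym (ℕP.+-suc N (m U))) (trans (cong (N ℕ.+_) (sym positive)) (trans IH (m-cong same)))
    where
      Ua : U a ≡ true
      Ua = proj₁ (∧-true t)
      Aa : A a ≡ true
      Aa = proj₂ (∧-true {U a} t)
      same : ∀ i → (del U a ∖ A) i ≡ (U ∖ A) i
      same i = trans (del-∖ U A a i) (del-absent (U ∖ A) (trans (cong (λ b → U a ∧ not b) Aa) (BoolP.∧-zeroʳ (U a))) i)
      IH : N ℕ.+ m (del U a) ≡ m (del U a ∖ A)
      IH = m-join A joined N (del U a) (trans (size-cong (del-∩ U A a))
             (ℕP.suc-injective (trans (sym (size-del (U ∩ A) a t)) sz)))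
             (ℕP.<⇒≤ (subst (suc N ℕ.≤_) (m-cong (λ i → sym (same i))) le))
      -- The hypothesis leaves room for one more vertex: N + 1 is at most N + m(U-a). A non-zero
      -- multiplicity supplies an essential vertex of U - a, to which a is joined.
      root : m (del U a) ≢ 0
      root z = ℕP.<-irrefl refl (ℕP.≤-trans le (ℕP.≤-reflexive (trans (m-cong (λ i → sym (same i)))
        (trans (sym IH) (trans (cong (N ℕ.+_) z) (ℕP.+-identityʳ N))))))
      positive : m (del U a) ≡ suc (m U)
      positive with m (del U a) in eq
      ... | zero = ⊥-elim (root eq)
      ... | suc j with essential-exists (size (del U a)) (del U a) ℕP.≤-refl j eq
      ...   | w , Uw , ess with del-∈ U Uw
      ...     | Uw′ , w≢a = trans (sym eq) (essential-neighbour⇒positive U a w Ua Uw′ (joined a w Aa w≢a) ess)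

  Separated : Mask n → Mask n → Set
  Separated S X = ∀ u v → S u ≡ true → S v ≡ true → X u ≡ true → X v ≡ false → adj u v ≡ false

  -- Expand at a vertex of X. Its neighbours in S lie in X as well, so the series of the other part
  -- is a common factor of the recurrence.
  μ-split : ∀ N S X → size S ℕ.≤ N → Separated S X → μ S ≈ μ (S ∩ X) ⊛ μ (S ∖ X)
  μ-split N S Y sz sep k with empty-or-∈ (S ∩ Y)
  ... | inj₂ none = trans (μ-cong same k) (sym (⊛-identityˡ (μ (S ∖ Y)) (μ-empty none) k))
    where
      same : ∀ i → S i ≡ (S ∖ Y) i
      same i with S i | none i
      ... | false | _ = refl
      ... | true | q = cong not (sym q)
  μ-split zero S Y sz sep k | inj₁ (u , t) = ⊥-elim (size-positive S u (proj₁ (∧-true t)) sz)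
  μ-split (suc N) S Y sz sep k | inj₁ (u , t) = begin
    μ S k
      ≡⟨ μ-recurrence S u Su k ⟩
    X 1# (μ (del S u)) k - ∑ (λ v → if S v ∧ adj u v then μ (del (del S u) v) k else 0#)
      ≡⟨ cong₂ _-_ (X-cong (λ i → trans (μ-split N (del S u) Y (size-del-≤ S u Su sz) (sep-del S u sep) i)
           (⊛-cong (μ-cong (del-∩ S Y u)) (μ-cong (rest-u S u Yu)) i)) k) (∑-cong term) ⟩
    X 1# (μ (del (S ∩ Y) u) ⊛ g) k - ∑ (λ v → (h v ⊛ g) k)
      ≡⟨ cong₂ _-_ (⊛-Xˡ 1# (μ (del (S ∩ Y) u)) g k) (⊛-∑ˡ h g k) ⟨
    (X 1# (μ (del (S ∩ Y) u)) ⊛ g) k - ((λ i → ∑ (λ v → h v i)) ⊛ g) k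
      ≡⟨ ⊛-subˡ (X 1# (μ (del (S ∩ Y) u))) (λ i → ∑ (λ v → h v i)) g k ⟨
    ((λ i → X 1# (μ (del (S ∩ Y) u)) i - ∑ (λ v → h v i)) ⊛ g) k
      ≡⟨ ⊛-cong {g = g} (λ i → sym (μ-recurrence (S ∩ Y) u t i)) (λ _ → refl) k ⟩
    (μ (S ∩ Y) ⊛ g) k ∎
    where
      open ≡-Reasoning
      Su : S u ≡ true
      Su = proj₁ (∧-true t)
      Yu : Y u ≡ true
      Yu = proj₂ (∧-true {S u} t)
      g = μ (S ∖ Y)
      h : Fin n → Series
      h v i = if (S ∩ Y) v ∧ adj u v then μ (del (del (S ∩ Y) u) v) i else 0#
      sep-del : ∀ S u → Separated S Y → Separated (del S u) Y
      sep-del S u sep x y p q = sep x y (proj₁ (del-∈ S p)) (proj₁ (del-∈ S q))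
      rest-u : ∀ S v → Y v ≡ true → ∀ i → (del S v ∖ Y) i ≡ (S ∖ Y) i
      rest-u S v Yv i = trans (del-∖ S Y v i) (del-absent (S ∖ Y) (trans (cong (λ b → S v ∧ not b) Yv) (BoolP.∧-zeroʳ (S v))) i)
      term : ∀ v → (if S v ∧ adj u v then μ (del (del S u) v) k else 0#) ≡ (h v ⊛ g) k
      term v with S v in Sv | adj u v in uv
      ... | false | _ = sym (⊛-zeroˡ (λ _ → 0#) g k (λ _ → refl))
      ... | true | false rewrite BoolP.∧-zeroʳ (Y v) = sym (⊛-zeroˡ (λ _ → 0#) g k (λ _ → refl))
      ... | true | true with Y v in Yv
      ...   | false = false≢true (sep u v Su Sv Yu Yv) uv
      ...   | true = trans (μ-split N (del (del S u) v) Y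
                (ℕP.<⇒≤ (subst (ℕ._≤ N) (size-del (del S u) v (del-keep S (neighbour-≢ adj symmetric irreflexive uv) Sv)) (size-del-≤ S u Su sz)))
                (sep-del (del S u) v (sep-del S u sep)) k)
              (⊛-cong (μ-cong (λ i → trans (del-∩ (del S u) Y v i) (del-cong (del-∩ S Y u) v i)))
                (μ-cong (λ i → trans (rest-u (del S u) v Yv i) (rest-u S u Yu i))) k)

  m-split : ∀ S X → Separated S X → m S ≡ m (S ∩ X) ℕ.+ m (S ∖ X)
  m-split S Y sep = order-unique (order-resp (μ-split (size S) S Y ℕP.≤-refl sep) (order-μ S))
    (order-⊛ (order-μ (S ∩ Y)) (order-μ (S ∖ Y)))

-- Connected components as least closed sets.

∑ℕ-mono : ∀ {n} {g h : Fin n → ℕ} → (∀ i → g i ℕ.≤ h i) → ∑ℕ g ℕ.≤ ∑ℕ h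
∑ℕ-mono {zero} le = z≤n
∑ℕ-mono {suc n} le = ℕP.+-mono-≤ (le zero) (∑ℕ-mono (λ i → le (suc i)))

module _ {n : ℕ} where

  size-⊆ : ∀ {S S′ : Mask n} → (∀ i → S i ≡ true → S′ i ≡ true) → size S ℕ.≤ size S′
  size-⊆ {S} {S′} sub = subst₂ ℕ._≤_ (sym (size-∑ S)) (sym (size-∑ S′)) (∑ℕ-mono indicator)
    where
      indicator : ∀ i → (if S i then 1 else 0) ℕ.≤ (if S′ i then 1 else 0)
      indicator i with S i | sub i
      ... | false | _ = z≤n
      ... | true | p rewrite p refl = ℕP.≤-refl

  size-≤ : ∀ (S : Mask n) → size S ℕ.≤ n
  size-≤ S = ℕP.≤-trans (ListP.length-filter _ (allFin n)) (ℕP.≤-reflexive (ListP.length-tabulate (λ i → i)))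

module Components {n : ℕ} (adj : Adj n) (symmetric : ∀ u v → adj u v ≡ adj v u) (T : Mask n) where

  Closed : Mask n → Set
  Closed C = ∀ x y → C x ≡ true → T y ≡ true → adj x y ≡ true → C y ≡ true

  step-elim : ∀ C w → step adj T C w ≡ true → C w ≡ true ⊎ T w ≡ true × ∃ λ x → C x ≡ true × adj x w ≡ true
  step-elim C w t with C w
  ... | true = inj₁ refl
  ... | false with any-tabulate-elim (λ x → C x ∧ adj x w) (λ i → i) (proj₂ (∧-true {T w} t))
  ...   | x , q = inj₂ (proj₁ (∧-true {T w} t) , x , proj₁ (∧-true q) , proj₂ (∧-true {C x} q))

  step-keep : ∀ C w → C w ≡ true → step adj T C w ≡ true
  step-keep C w t = cong (_∨ (T w ∧ any (λ x → C x ∧ adj x w) (allFin n))) t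

  step-intro : ∀ C x w → C x ≡ true → T w ≡ true → adj x w ≡ true → step adj T C w ≡ true
  step-intro C x w Cx Tw xw = trans (cong (C w ∨_) (cong₂ _∧_ Tw
    (any-tabulate-intro (λ x → C x ∧ adj x w) (λ i → i) x (cong₂ _∧_ Cx xw)))) (BoolP.∨-zeroʳ (C w))

  closed-step : ∀ C → Closed C → Closed (step adj T C)
  closed-step C closed x y Sx Ty xy with step-elim C x Sx
  ... | inj₁ Cx = step-keep C y (closed x y Cx Ty xy)
  ... | inj₂ (Tx , z , Cz , zx) = step-keep C y (closed x y (closed z x Cz Tx zx) Ty xy)

  module _ (u : Fin n) where

    stage : ℕ → Mask n
    stage k = iter k (step adj T) (λ w → T u ∧ eqᶠ w u)

    stage-⊆ : ∀ k w → stage k w ≡ true → T w ≡ true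
    stage-⊆ zero w t with eqᶠ-true {i = w} {u} (proj₂ (∧-true {T u} t))
    ... | refl = proj₁ (∧-true t)
    stage-⊆ (suc k) w t with step-elim (stage k) w t
    ... | inj₁ p = stage-⊆ k w p
    ... | inj₂ (Tw , _) = Tw

    stage-minimal : ∀ C → Closed C → C u ≡ true → ∀ k w → stage k w ≡ true → C w ≡ true
    stage-minimal C closed Cu zero w t with eqᶠ-true {i = w} {u} (proj₂ (∧-true {T u} t))
    ... | refl = Cu
    stage-minimal C closed Cu (suc k) w t with step-elim (stage k) w t
    ... | inj₁ p = stage-minimal C closed Cu k w p
    ... | inj₂ (Tw , x , p , xw) = closed x w (stage-minimal C closed Cu k x p) Tw xw

    stage-self : T u ≡ true → ∀ k → stage k u ≡ true
    stage-self Tu zero = cong₂ _∧_ Tu (eqᶠ-refl u)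
    stage-self Tu (suc k) = step-keep (stage k) u (stage-self Tu k)

    -- A round that adds no vertex has reached a closed set, and every other round adds at least
    -- one. More than n vertices are impossible, so n rounds suffice.
    stage-grows : T u ≡ true → ∀ k → Closed (stage k) ⊎ suc k ℕ.≤ size (stage k)
    stage-grows Tu zero = inj₂ (ℕP.≤-trans (s≤s z≤n) (ℕP.≤-reflexive (sym (size-del (stage 0) u (stage-self Tu 0)))))
    stage-grows Tu (suc k) with stage-grows Tu k
    ... | inj₁ closed = inj₁ (closed-step (stage k) closed)
    ... | inj₂ le with empty-or-∈ (stage (suc k) ∖ stage k)
    ...   | inj₁ (y , t) = inj₂ (ℕP.≤-trans (s≤s (ℕP.≤-trans le (size-⊆ inclusion)))
              (ℕP.≤-reflexive (sym (size-del (stage (suc k)) y (proj₁ (∧-true t))))))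
      where
        inclusion : ∀ i → stage k i ≡ true → del (stage (suc k)) y i ≡ true
        inclusion i p = del-keep (stage (suc k)) (λ { refl → false≢true (BoolP.not-injective (proj₂ (∧-true {stage (suc k) y} t))) p })
          (step-keep (stage k) i p)
    ...   | inj₂ none = inj₁ (closed-step (stage k) (λ x y p Ty xy → stays y (step-intro (stage k) x y p Ty xy)))
      where
        stays : ∀ y → stage (suc k) y ≡ true → stage k y ≡ true
        stays y t with stage k y BoolP.≟ true
        ... | yes p = p
        ... | no ¬p = false≢true (none y) (∖-∈ (stage (suc k)) (stage k) t (BoolP.¬-not ¬p))

  Q : Fin n → Mask n
  Q = component adj T

  component-⊆ : ∀ u w → Q u w ≡ true → T w ≡ true
  component-⊆ u = stage-⊆ u n

  component-minimal : ∀ u C → Closed C → C u ≡ true → ∀ w → Q u w ≡ true → C w ≡ true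
  component-minimal u C closed Cu = stage-minimal u C closed Cu n

  component-self : ∀ u → T u ≡ true → Q u u ≡ true
  component-self u Tu = stage-self u Tu n

  component-closed : ∀ u → T u ≡ true → Closed (Q u)
  component-closed u Tu with stage-grows u Tu n
  ... | inj₁ closed = closed
  ... | inj₂ le = ⊥-elim (ℕP.<-irrefl refl (ℕP.≤-trans le (size-≤ (stage u n))))

  complement-closed : ∀ C → Closed C → Closed (T ∖ C)
  complement-closed C closed x y p Ty xy with C y in Cy
  ... | false = cong (_∧ true) Ty
  ... | true = false≢true (BoolP.not-injective (proj₂ (∧-true {T x} p)))
          (closed y x Cy (proj₁ (∧-true {T x} p)) (trans (symmetric y x) xy))

  -- Otherwise the complement of `Q v` in T is a closed set containing u, hence by minimality all of
  -- `Q u` and in particular v.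
  component-sym : ∀ u v → T u ≡ true → Q u v ≡ true → Q v u ≡ true
  component-sym u v Tu uv with Q v u in eq
  ... | true = refl
  ... | false = false≢true (BoolP.not-injective (proj₂ (∧-true {T v}
          (component-minimal u (T ∖ Q v) (complement-closed (Q v) (component-closed v Tv)) (∖-∈ T (Q v) Tu eq) v uv))))
          (component-self v Tv)
    where
      Tv : T v ≡ true
      Tv = component-⊆ u v uv

  component-≗ : ∀ u v → T u ≡ true → Q u v ≡ true → ∀ x → Q u x ≡ Q v x
  component-≗ u v Tu uv x with Q u x in ux | Q v x in vx
  ... | true | true = refl
  ... | false | false = refl
  ... | true | false = sym (false≢true vx (component-minimal u (Q v) (component-closed v Tv) (component-sym u v Tu uv) x ux))
    where
      Tv : T v ≡ true
      Tv = component-⊆ u v uv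
  ... | false | true = sym (false≢true ux (component-minimal v (Q u) (component-closed u Tu) uv x vx))

-- Transfer between G, G - A and S_θ(G), and the characterisation of the edges.

module MainTheorem (F : RealField) (θ : RealField.R F) {n : ℕ} (adj : Adj n)
  (symmetric : ∀ u v → adj u v ≡ adj v u) (irreflexive : ∀ u → adj u u ≡ false)
  (A : Mask n) (A-special : ∀ i → A i ≡ Decomposition.special F θ adj symmetric irreflexive full i) where
  open PowerSeries F θ using (Interlace; lower; equal; upper)
  open MatchingSeries F θ adj symmetric irreflexive using (m; m-mult)
  open Multiplicity F θ adj symmetric irreflexive using (m-cong; interlace)
  open Stability F θ adj symmetric irreflexive using (essential-exists)
  open Decomposition F θ adj symmetric irreflexive

  T : Mask n
  T i = not (A i)

  open Components adj symmetric T

  -- For A = `Aθ` this is `Sθ` definitionally; keeping A a parameter prevents it from being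
  -- unfolded.
  joined : Adj n
  joined w z = not (eqᶠ w z) ∧ (adj w z ∨ A w ∨ A z)

  joined-symmetric : ∀ u v → joined u v ≡ joined v u
  joined-symmetric u v = cong₂ (λ a b → not a ∧ b) (eqᶠ-sym u v) (cong₂ _∨_ (symmetric u v) (BoolP.∨-comm (A u) (A v)))

  joined-irreflexive : ∀ u → joined u u ≡ false
  joined-irreflexive u = cong (λ b → not b ∧ (adj u u ∨ A u ∨ A u)) (eqᶠ-refl u)

  open MatchingSeries F θ joined joined-symmetric joined-irreflexive using ()
    renaming (m to m′; m-mult to m′-mult)
  open Multiplicity F θ joined joined-symmetric joined-irreflexive using ()
    renaming (m-swap to m′-swap)
  open Decomposition F θ joined joined-symmetric joined-irreflexive using ()
    renaming (m-join to m′-join)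
  open Stability F θ joined joined-symmetric joined-irreflexive using ()
    renaming (m-del-≤ to m′-del-≤)

  T⇒¬A : ∀ {i} → T i ≡ true → A i ≡ false
  T⇒¬A = BoolP.not-injective

  m-T : m T ≡ size A ℕ.+ m full
  m-T = trans (m-cong (λ i → cong not (A-special i))) (proj₁ (remove-specials (size A) full (sym (size-cong A-special))))

  m-T-del : ∀ b → T b ≡ true → m (del T b) ≡ size A ℕ.+ m (del full b)
  m-T-del b Tb = trans (m-cong (del-cong (λ i → cong not (A-special i)) b))
    (proj₂ (remove-specials (size A) full (sym (size-cong A-special))) b (trans (cong not (sym (A-special b))) Tb))

  joined-agrees : ∀ i j → T i ≡ true → T j ≡ true → adj i j ≡ joined i j
  joined-agrees i j Ti Tj with i ≟ᶠ j
  ... | yes refl = irreflexive i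
  ... | no _ rewrite T⇒¬A {i} Ti | T⇒¬A {j} Tj = sym (BoolP.∨-identityʳ (adj i j))

  joined-total : ∀ a z → A a ≡ true → z ≢ a → joined a z ≡ true
  joined-total a z Aa z≢a rewrite eqᶠ-≢ (λ a≡z → z≢a (sym a≡z)) | Aa = BoolP.∨-zeroʳ (adj a z)

  -- Away from A the two graphs coincide, and each of the N vertices of A in U is universal in
  -- `joined`, so it takes one off the multiplicity.
  m′-A : ∀ N U → size (U ∩ A) ≡ N → N ℕ.≤ m (U ∖ A) → N ℕ.+ m′ U ≡ m (U ∖ A)
  m′-A N U sz le = trans (m′-join A joined-total N U sz (subst (N ℕ.≤_) same le)) (sym same)
    where
      same : m (U ∖ A) ≡ m′ (U ∖ A)
      same = Agreement.m-agree F θ adj joined symmetric irreflexive joined-symmetric joined-irreflexive (λ _ → refl)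
        (λ i j p q → joined-agrees i j (proj₂ (∧-true {U i} p)) (proj₂ (∧-true {U j} q)))

  m′-full : m′ full ≡ m full
  m′-full = ℕP.+-cancelˡ-≡ (size A) _ _ (trans (m′-A (size A) full refl
    (subst (size A ℕ.≤_) (sym m-T) (ℕP.m≤m+n (size A) (m full)))) m-T)

  m′-del-T : ∀ b → T b ≡ true → m′ (del full b) ≡ m (del full b)
  m′-del-T b Tb = ℕP.+-cancelˡ-≡ (size A) _ _ (trans (m′-A (size A) (del full b)
      (size-cong (λ i → trans (del-∩ full A b i) (del-absent A (T⇒¬A Tb) i)))
      (subst (size A ℕ.≤_) (sym eq) (ℕP.m≤m+n (size A) _))) eq)
    where
      eq : m (del full b ∖ A) ≡ size A ℕ.+ m (del full b)
      eq = trans (m-cong (del-∖ full A b)) (m-T-del b Tb)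

  ∩-del-del : ∀ u v i → (del (del full u) v ∩ A) i ≡ del (del A u) v i
  ∩-del-del u v i = trans (del-∩ (del full u) A v i) (del-cong (del-∩ full A u) v i)

  ∖-del-del : ∀ u v i → (del (del full u) v ∖ A) i ≡ del (del T u) v i
  ∖-del-del u v i = trans (del-∖ (del full u) A v i) (del-cong (del-∖ full A u) v i)

  -- The bound gives `size A` ≤ m T ≤ m(T-u-v), so every vertex of A finds something to lower.
  m′-del-TT : ∀ u v → T u ≡ true → T v ≡ true → m T ℕ.≤ m (del (del T u) v) →
    size A ℕ.+ m′ (del (del full u) v) ≡ m (del (del T u) v)
  m′-del-TT u v Tu Tv le = trans (m′-A (size A) (del (del full u) v)
      (size-cong (λ i → trans (∩-del-del u v i) (trans (del-cong (del-absent A (T⇒¬A Tu)) v i) (del-absent A (T⇒¬A Tv) i))))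
      (subst (size A ℕ.≤_) (sym eq) (ℕP.≤-trans (ℕP.≤-trans (ℕP.m≤m+n (size A) (m full)) (ℕP.≤-reflexive (sym m-T))) le))) eq
    where
      eq : m (del (del full u) v ∖ A) ≡ m (del (del T u) v)
      eq = m-cong (∖-del-del u v)

  -- With u gone, one vertex fewer is added back to T - v; this accounts for the successor.
  m′-del-AT : ∀ u v → A u ≡ true → T v ≡ true → m′ (del (del full u) v) ≡ suc (m (del full v))
  m′-del-AT u v Au Tv = ℕP.+-cancelˡ-≡ k _ _ (trans (m′-A k (del (del full u) v)
      (size-cong (λ i → trans (∩-del-del u v i) (del-absent (del A u) (cong (_∧ not (eqᶠ v u)) (T⇒¬A Tv)) i)))
      (subst (k ℕ.≤_) (sym eq) (ℕP.m≤m+n k _))) eq)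
    where
      k = size (del A u)
      eq : m (del (del full u) v ∖ A) ≡ k ℕ.+ suc (m (del full v))
      eq = trans (m-cong (λ i → trans (∖-del-del u v i) (del-cong (del-absent T (cong not Au)) v i)))
        (trans (m-T-del v Tv) (trans (cong (ℕ._+ m (del full v)) (size-del A u Au)) (sym (ℕP.+-suc k _))))

  m′-del-AA : ∀ u v → A u ≡ true → A v ≡ true → u ≢ v → m′ (del (del full u) v) ≡ suc (suc (m full))
  m′-del-AA u v Au Av u≢v = ℕP.+-cancelˡ-≡ k _ _ (trans (m′-A k (del (del full u) v)
      (size-cong (∩-del-del u v)) (subst (k ℕ.≤_) (sym eq) (ℕP.m≤m+n k _))) eq)
    where
      k = size (del (del A u) v)
      eq : m (del (del full u) v ∖ A) ≡ k ℕ.+ suc (suc (m full))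
      eq = trans (m-cong (λ i → trans (∖-del-del u v i) (trans (del-cong (del-absent T (cong not Au)) v i) (del-absent T (cong not Av) i))))
        (trans m-T (trans (cong (ℕ._+ m full) (trans (size-del A u Au)
          (cong suc (size-del (del A u) v (del-keep A (λ v≡u → u≢v (sym v≡u)) Av)))))
          (sym (trans (ℕP.+-suc k (suc (m full))) (cong suc (ℕP.+-suc k (m full)))))))

  A-positive : ∀ a → A a ≡ true → m (del full a) ≡ suc (m full)
  A-positive a Aa = special-positive full a (trans (sym (A-special a)) Aa)

  T-essential : ∀ b → T b ≡ true → suc (m (del T b)) ≡ m T → suc (m (del full b)) ≡ m full
  T-essential b Tb eq = ℕP.+-cancelˡ-≡ (size A) _ _
    (trans (ℕP.+-suc (size A) (m (del full b))) (trans (cong suc (sym (m-T-del b Tb))) (trans eq m-T)))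

  T-nonessential : ∀ b → T b ≡ true → suc (m (del full b)) ≢ m full → m T ℕ.≤ m (del T b)
  T-nonessential b Tb ne = nonessential T b Tb (λ eq → ne (T-essential b Tb eq))

  -- A non-essential vertex of G - A next to an essential one would have been special in G. So a
  -- component consists of essential vertices only or contains none.
  nonessential-closed : Closed (T ∖ essential T)
  nonessential-closed x y p Ty xy with essential T y in ey
  ... | false = cong (_∧ true) Ty
  ... | true with ∧-true {T x} p
  ...   | Tx , ne = false≢true (T⇒¬A Tx) (trans (A-special x) (special-intro full x y refl
            (nonessential full x refl λ eq → false≢true (BoolP.not-injective ne) (essential-intro T x Tx
              (trans (cong suc (m-T-del x Tx)) (trans (sym (ℕP.+-suc (size A) _)) (trans (cong (size A ℕ.+_) eq) (sym m-T))))))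
            refl xy (T-essential y Ty (essential-elim T y ey))))

  module _ (w : Fin n) (Tw : T w ≡ true) where

    separated : ∀ {S} → (∀ i → S i ≡ true → T i ≡ true) → Separated S (Q w)
    separated S⊆T u v Su Sv Qu Qv with adj u v in uv
    ... | false = refl
    ... | true = false≢true Qv (component-closed w Tw u v Qu (S⊆T v Sv) uv)

    T∩Q : ∀ i → (T ∩ Q w) i ≡ Q w i
    T∩Q i with Q w i in Qi
    ... | false = BoolP.∧-zeroʳ (T i)
    ... | true = trans (BoolP.∧-identityʳ (T i)) (component-⊆ w i Qi)

    rest : Mask n
    rest = T ∖ Q w

    rest-out : ∀ u → Q w u ≡ true → rest u ≡ false
    rest-out u Qu = trans (cong (λ b → T u ∧ not b) Qu) (BoolP.∧-zeroʳ (T u))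

    m-T-split : m T ≡ m (Q w) ℕ.+ m rest
    m-T-split = trans (m-split T (Q w) (separated (λ _ p → p))) (cong (ℕ._+ m rest) (m-cong T∩Q))

    m-T-split-in : ∀ u → Q w u ≡ true → m (del T u) ≡ m (del (Q w) u) ℕ.+ m rest
    m-T-split-in u Qu = trans (m-split (del T u) (Q w) (separated (λ i p → proj₁ (del-∈ T p))))
      (cong₂ ℕ._+_ (m-cong (λ i → trans (del-∩ T (Q w) u i) (del-cong T∩Q u i)))
        (m-cong (λ i → trans (del-∖ T (Q w) u i) (del-absent rest (rest-out u Qu) i))))

    m-T-split-out : ∀ v → Q w v ≡ false → m (del T v) ≡ m (Q w) ℕ.+ m (del rest v)
    m-T-split-out v Qv = trans (m-split (del T v) (Q w) (separated (λ i p → proj₁ (del-∈ T p))))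
      (cong₂ ℕ._+_ (m-cong (λ i → trans (del-∩ T (Q w) v i) (trans (del-cong T∩Q v i) (del-absent (Q w) Qv i))))
        (m-cong (del-∖ T (Q w) v)))

    m-T-split-in-in : ∀ u v → Q w u ≡ true → Q w v ≡ true → m (del (del T u) v) ≡ m (del (del (Q w) u) v) ℕ.+ m rest
    m-T-split-in-in u v Qu Qv =
      trans (m-split (del (del T u) v) (Q w) (separated (λ i p → proj₁ (del-∈ T (proj₁ (del-∈ (del T u) p))))))
      (cong₂ ℕ._+_ (m-cong (λ i → trans (del-∩ (del T u) (Q w) v i) (del-cong (λ i → trans (del-∩ T (Q w) u i) (del-cong T∩Q u i)) v i)))
        (m-cong (λ i → trans (del-∖ (del T u) (Q w) v i)
          (trans (del-cong (λ i → trans (del-∖ T (Q w) u i) (del-absent rest (rest-out u Qu) i)) v i) (del-absent rest (rest-out v Qv) i)))))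

    m-T-split-in-out : ∀ u v → Q w u ≡ true → Q w v ≡ false → m (del (del T u) v) ≡ m (del (Q w) u) ℕ.+ m (del rest v)
    m-T-split-in-out u v Qu Qv =
      trans (m-split (del (del T u) v) (Q w) (separated (λ i p → proj₁ (del-∈ T (proj₁ (del-∈ (del T u) p))))))
      (cong₂ ℕ._+_ (m-cong (λ i → trans (del-∩ (del T u) (Q w) v i) (trans (del-cong (λ i → trans (del-∩ T (Q w) u i) (del-cong T∩Q u i)) v i)
          (del-absent (del (Q w) u) (cong (_∧ not (eqᶠ v u)) Qv) i))))
        (m-cong (λ i → trans (del-∖ (del T u) (Q w) v i) (del-cong (λ i → trans (del-∖ T (Q w) u i) (del-absent rest (rest-out u Qu) i)) v i))))

    -- Deletions on the two sides of a separation change the multiplicity independently.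
    modular : ∀ u v → Q w u ≡ true → Q w v ≡ false → m (del (del T u) v) ℕ.+ m T ≡ m (del T u) ℕ.+ m (del T v)
    modular u v Qu Qv = trans (cong₂ ℕ._+_ (m-T-split-in-out u v Qu Qv) m-T-split)
      (trans (exchange (m (del (Q w) u)) (m (del rest v)) (m (Q w)) (m rest))
        (sym (cong₂ ℕ._+_ (m-T-split-in u Qu) (m-T-split-out v Qv))))
      where
        exchange : ∀ a b c d → (a ℕ.+ b) ℕ.+ (c ℕ.+ d) ≡ (a ℕ.+ d) ℕ.+ (c ℕ.+ b)
        exchange a b c d = trans (+-interchange a b c d) (trans (cong ((a ℕ.+ c) ℕ.+_) (ℕP.+-comm b d)) (+-interchange a c d b))

    -- A component of non-zero multiplicity has an essential vertex, which is essential in T too.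
    -- But the non-essential vertices are closed and contain w, hence the whole component.
    nonessential⇒zero : m T ℕ.≤ m (del T w) → m (Q w) ≡ 0
    nonessential⇒zero ne with m (Q w) in eq
    ... | zero = refl
    ... | suc j with essential-exists (size (Q w)) (Q w) ℕP.≤-refl j eq
    ...   | b , Qb , ess = false≢true (BoolP.not-injective (proj₂ (∧-true {T b}
              (component-minimal w (T ∖ essential T) nonessential-closed (∖-∈ T (essential T) Tw
                (BoolP.¬-not (λ t → ℕP.<-irrefl refl (ℕP.≤-trans (ℕP.≤-reflexive (essential-elim T w t)) ne)))) b Qb))))
            (essential-intro T b (component-⊆ w b Qb)
              (trans (cong suc (m-T-split-in b Qb)) (trans (cong (ℕ._+ m rest) ess) (sym m-T-split))))

    zero⇒nonessential : m (Q w) ≡ 0 → ∀ u → Q w u ≡ true → m T ℕ.≤ m (del T u)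
    zero⇒nonessential z u Qu = ℕP.≤-trans (ℕP.≤-reflexive (trans m-T-split (cong (ℕ._+ m rest) z)))
      (ℕP.≤-trans (ℕP.m≤n+m (m rest) (m (del (Q w) u))) (ℕP.≤-reflexive (sym (m-T-split-in u Qu))))

  -- The component of u has multiplicity zero, so deletions inside it cannot lower anything; if v
  -- lies elsewhere, only its own effect is left, and v is non-essential.
  T-del-del-≥ : ∀ u v → T u ≡ true → m T ℕ.≤ m (del T u) → m T ℕ.≤ m (del T v) → m T ℕ.≤ m (del (del T u) v)
  T-del-del-≥ u v Tu nu nv with Q u v in Qv
  ... | true = ℕP.≤-trans (ℕP.≤-reflexive (trans (m-T-split u Tu) (cong (ℕ._+ m (rest u Tu)) (nonessential⇒zero u Tu nu))))
      (ℕP.≤-trans (ℕP.m≤n+m _ (m (del (del (Q u) u) v))) (ℕP.≤-reflexive (sym (m-T-split-in-in u Tu u v (component-self u Tu) Qv))))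
  ... | false = ℕP.≤-trans nv (ℕP.≤-trans (ℕP.≤-reflexive (trans (m-T-split-out u Tu v Qv) (cong (ℕ._+ m (del (rest u Tu) v)) (nonessential⇒zero u Tu nu))))
      (ℕP.≤-trans (ℕP.m≤n+m _ (m (del (Q u) u))) (ℕP.≤-reflexive (sym (m-T-split-in-out u Tu u v (component-self u Tu) Qv)))))

  T-pair : ∀ u v → T u ≡ true → T v ≡ true → m T ℕ.≤ m (del T u) → m T ℕ.≤ m (del T v) →
    m′ (del (del full u) v) ≡ suc (m full) ⇔ m (del (del T u) v) ≡ suc (m T)
  T-pair u v Tu Tv nu nv = mk⇔
    (λ eq → trans (sym pair) (trans (cong (size A ℕ.+_) eq) (trans (ℕP.+-suc (size A) (m full)) (cong suc (sym m-T)))))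
    (λ eq → ℕP.+-cancelˡ-≡ (size A) _ _ (trans pair (trans eq (trans (cong suc m-T) (sym (ℕP.+-suc (size A) (m full)))))))
    where
      pair = m′-del-TT u v Tu Tv (T-del-del-≥ u v Tu nu nv)

  D1-elim : ∀ S u v → D1 F θ adj S u v ≡ true → S u ≡ true × S v ≡ true × m (del (del S u) v) ≡ suc (m S)
  D1-elim S u v t with ∧-true {S u} t
  ... | Su , t′ with ∧-true {S v} t′
  ...   | Sv , t″ = Su , Sv , trans (m-mult (del (del S u) v))
            (trans (≡ᵇ-true (proj₂ (∧-true {not (eqᶠ u v)} t″))) (cong suc (sym (m-mult S))))

  D1-intro : ∀ S u v → u ≢ v → S u ≡ true → S v ≡ true → m (del (del S u) v) ≡ suc (m S) → D1 F θ adj S u v ≡ true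
  D1-intro S u v u≢v Su Sv eq = cong₂ _∧_ Su (cong₂ _∧_ Sv (cong₂ _∧_ (cong not (eqᶠ-≢ u≢v))
    (≡ᵇ-intro (trans (sym (m-mult (del (del S u) v))) (trans eq (cong suc (m-mult S)))))))

  neutral-elim : ∀ v → Nθ F θ adj v ≡ true → m (del full v) ≡ m full
  neutral-elim v t = trans (m-mult (del full v)) (trans (≡ᵇ-true t) (sym (m-mult full)))

  neutral-intro : ∀ v → m (del full v) ≡ m full → Nθ F θ adj v ≡ true
  neutral-intro v eq = ≡ᵇ-intro (trans (sym (m-mult (del full v))) (trans eq (m-mult full)))

  -- For A = `Aθ` this is `Pθ`.
  Positive : Fin n → Bool
  Positive u = positiveᵇ F θ adj full u ∧ T u

  positive-elim : ∀ v → Positive v ≡ true → m (del full v) ≡ suc (m full) × T v ≡ true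
  positive-elim v t with ∧-true {positiveᵇ F θ adj full v} t
  ... | p , Tv = trans (m-mult (del full v)) (trans (≡ᵇ-true p) (cong suc (sym (m-mult full)))) , Tv

  positive-intro : ∀ v → m (del full v) ≡ suc (m full) → T v ≡ true → Positive v ≡ true
  positive-intro v eq Tv = cong₂ _∧_ (≡ᵇ-intro (trans (sym (m-mult (del full v))) (trans eq (cong suc (m-mult full))))) Tv

  neutral-T : ∀ v → m (del full v) ≡ m full → T v ≡ true
  neutral-T v eq with A v in Av
  ... | false = refl
  ... | true = ⊥-elim (ℕP.<-irrefl (trans (sym eq) (A-positive v Av)) ℕP.≤-refl)

  Characterisation : Fin n → Fin n → Set
  Characterisation u v =
    ((A u ≡ true × Nθ F θ adj v ≡ true) ⊎ (A v ≡ true × Nθ F θ adj u ≡ true))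
    ⊎ ((((Positive u ≡ true × Nθ F θ adj v ≡ true) ⊎ (Positive v ≡ true × Nθ F θ adj u ≡ true))
        × ∃[ w₁ ] ∃[ w₂ ] (T w₁ ≡ true × T w₂ ≡ true
            × mult F θ adj (Q w₁) ≡ 0 × mult F θ adj (Q w₂) ≡ 0
            × Q w₁ u ≡ true × Q w₂ v ≡ true
            × ¬ (∀ x → Q w₁ x ≡ Q w₂ x)))
    ⊎ ∃[ w ] (T w ≡ true × mult F θ adj (Q w) ≡ 0 × D1 F θ adj (Q w) u v ≡ true))

  T-neutral : ∀ b → T b ≡ true → m (del T b) ≡ m T → m (del full b) ≡ m full
  T-neutral b Tb eq = ℕP.+-cancelˡ-≡ (size A) _ _ (trans (sym (m-T-del b Tb)) (trans eq m-T))

  T-positive : ∀ b → T b ≡ true → m (del T b) ≡ suc (m T) → m (del full b) ≡ suc (m full)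
  T-positive b Tb eq = ℕP.+-cancelˡ-≡ (size A) _ _ (trans (sym (m-T-del b Tb))
    (trans eq (trans (cong suc m-T) (sym (ℕP.+-suc (size A) (m full))))))

  -- Deleting an essential u leaves m full - 1, and a second deletion raises this to m full at most.
  essential-excluded : ∀ u v → u ≢ v → T u ≡ true → m′ (del (del full u) v) ≡ suc (m full) → m T ℕ.≤ m (del T u)
  essential-excluded u v u≢v Tu eq = T-nonessential u Tu (λ ess → ℕP.<-irrefl refl
    (ℕP.≤-trans (ℕP.≤-reflexive (sym eq)) (ℕP.≤-trans
      (m′-del-≤ (del full u) v (del-keep full (λ v≡u → u≢v (sym v≡u)) refl) ℕP.≤-refl)
      (ℕP.≤-reflexive (trans (cong suc (m′-del-T u Tu)) ess)))))

  forward : ∀ u v → u ≢ v → m′ (del (del full u) v) ≡ suc (m full) → Characterisation u v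
  forward u v u≢v eq = by-A (A u) (A v) refl refl
    where
      ¬A⇒T : ∀ {i} → A i ≡ false → T i ≡ true
      ¬A⇒T Ai = cong not Ai
      eq′ : m′ (del (del full v) u) ≡ suc (m full)
      eq′ = trans (m′-swap full v u) eq
      in-T : T u ≡ true → T v ≡ true → Characterisation u v
      in-T Tu Tv = by-component (Q u v) refl
        where
          nu = essential-excluded u v u≢v Tu eq
          nv = essential-excluded v u (λ v≡u → u≢v (sym v≡u)) Tv eq′
          mT : m (del (del T u) v) ≡ suc (m T)
          mT = Equivalence.to (T-pair u v Tu Tv nu nv) eq
          zero-at : ∀ w → T w ≡ true → m T ℕ.≤ m (del T w) → mult F θ adj (Q w) ≡ 0
          zero-at w Tw nw = trans (sym (m-mult (Q w))) (nonessential⇒zero w Tw nw)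
          by-component : ∀ b → Q u v ≡ b → Characterisation u v
          by-component true Quv = inj₂ (inj₂ (u , Tu , zero-at u Tu nu ,
            D1-intro (Q u) u v u≢v (component-self u Tu) Quv (ℕP.+-cancelʳ-≡ (m (rest u Tu)) _ _
              (trans (sym (m-T-split-in-in u Tu u v (component-self u Tu) Quv)) (trans mT (cong suc (m-T-split u Tu)))))))
          by-component false Quv = inj₂ (inj₁ (signs (interlace T u Tu) (interlace T v Tv) ,
            u , v , Tu , Tv , zero-at u Tu nu , zero-at v Tv nv , component-self u Tu , component-self v Tv ,
            λ same → false≢true (trans (sym (same v)) Quv) (component-self v Tv)))
            where
              -- Two numbers, neither below m T, with sum 2 m T + 1: one vertex is neutral and the
              -- other positive.
              total : suc (m T ℕ.+ m T) ≡ m (del T u) ℕ.+ m (del T v)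
              total = trans (cong (ℕ._+ m T) (sym mT)) (modular u Tu u v (component-self u Tu) Quv)
              signs : Interlace (m T) (m (del T u)) → Interlace (m T) (m (del T v)) →
                (Positive u ≡ true × Nθ F θ adj v ≡ true) ⊎ (Positive v ≡ true × Nθ F θ adj u ≡ true)
              signs (lower p) _ = ⊥-elim (ℕP.<-irrefl refl (ℕP.≤-trans (ℕP.≤-reflexive (sym p)) nu))
              signs (equal p) (lower q) = ⊥-elim (ℕP.<-irrefl refl (ℕP.≤-trans (ℕP.≤-reflexive (sym q)) nv))
              signs (upper p) (lower q) = ⊥-elim (ℕP.<-irrefl refl (ℕP.≤-trans (ℕP.≤-reflexive (sym q)) nv))
              signs (equal p) (equal q) = ⊥-elim (ℕP.<-irrefl (trans (cong₂ ℕ._+_ p q) (sym total)) ℕP.≤-refl)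
              signs (upper p) (upper q) = ⊥-elim (ℕP.<-irrefl (trans total (trans (cong₂ ℕ._+_ p q)
                (cong suc (ℕP.+-suc (m T) (m T))))) ℕP.≤-refl)
              signs (equal p) (upper q) = inj₂ (positive-intro v (T-positive v Tv q) Tv , neutral-intro u (T-neutral u Tu (sym p)))
              signs (upper p) (equal q) = inj₁ (positive-intro u (T-positive u Tu p) Tu , neutral-intro v (T-neutral v Tv (sym q)))
      by-A : ∀ a b → A u ≡ a → A v ≡ b → Characterisation u v
      by-A true true Au Av = ⊥-elim (ℕP.<-irrefl (trans (sym eq) (m′-del-AA u v Au Av u≢v)) ℕP.≤-refl)
      by-A true false Au Av = inj₁ (inj₁ (Au , neutral-intro v (ℕP.suc-injective (trans (sym (m′-del-AT u v Au (¬A⇒T Av))) eq))))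
      by-A false true Au Av = inj₁ (inj₂ (Av , neutral-intro u (ℕP.suc-injective (trans (sym (m′-del-AT v u Av (¬A⇒T Au))) eq′))))
      by-A false false Au Av = in-T (¬A⇒T Au) (¬A⇒T Av)

  backward : ∀ u v → u ≢ v → Characterisation u v → m′ (del (del full u) v) ≡ suc (m full)
  backward u v u≢v (inj₁ (inj₁ (Au , Nv))) =
    trans (m′-del-AT u v Au (neutral-T v (neutral-elim v Nv))) (cong suc (neutral-elim v Nv))
  backward u v u≢v (inj₁ (inj₂ (Av , Nu))) =
    trans (m′-swap full u v) (trans (m′-del-AT v u Av (neutral-T u (neutral-elim u Nu))) (cong suc (neutral-elim u Nu)))
  backward u v u≢v (inj₂ (inj₁ (signs , w₁ , w₂ , Tw₁ , Tw₂ , z₁ , z₂ , Qu , Qv , differ))) =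
    Equivalence.from (T-pair u v (component-⊆ w₁ u Qu) (component-⊆ w₂ v Qv)
      (zero⇒nonessential w₁ Tw₁ (trans (m-mult (Q w₁)) z₁) u Qu) (zero⇒nonessential w₂ Tw₂ (trans (m-mult (Q w₂)) z₂) v Qv))
      (ℕP.+-cancelʳ-≡ (m T) _ _ (trans (modular w₁ Tw₁ u v Qu apart) (total signs)))
    where
      Tu = component-⊆ w₁ u Qu
      Tv = component-⊆ w₂ v Qv
      -- A common vertex v would make both masks equal to `Q v`.
      apart : Q w₁ v ≡ false
      apart = BoolP.¬-not (λ t → differ (λ x → trans (component-≗ w₁ v Tw₁ t x) (sym (component-≗ w₂ v Tw₂ Qv x))))
      neutral-in-T : ∀ b → T b ≡ true → m (del full b) ≡ m full → m (del T b) ≡ m T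
      neutral-in-T b Tb eq = trans (m-T-del b Tb) (trans (cong (size A ℕ.+_) eq) (sym m-T))
      positive-in-T : ∀ b → T b ≡ true → m (del full b) ≡ suc (m full) → m (del T b) ≡ suc (m T)
      positive-in-T b Tb eq = trans (m-T-del b Tb) (trans (cong (size A ℕ.+_) eq) (trans (ℕP.+-suc (size A) (m full)) (cong suc (sym m-T))))
      total : (Positive u ≡ true × Nθ F θ adj v ≡ true) ⊎ (Positive v ≡ true × Nθ F θ adj u ≡ true) →
        m (del T u) ℕ.+ m (del T v) ≡ suc (m T) ℕ.+ m T
      total (inj₁ (Pu , Nv)) = cong₂ ℕ._+_ (positive-in-T u Tu (proj₁ (positive-elim u Pu))) (neutral-in-T v Tv (neutral-elim v Nv))
      total (inj₂ (Pv , Nu)) = trans (cong₂ ℕ._+_ (neutral-in-T u Tu (neutral-elim u Nu)) (positive-in-T v Tv (proj₁ (positive-elim v Pv)))) (ℕP.+-suc (m T) (m T))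
  backward u v u≢v (inj₂ (inj₂ (w , Tw , z , d))) with D1-elim (Q w) u v d
  ... | Qu , Qv , eq = Equivalence.from (T-pair u v (component-⊆ w u Qu) (component-⊆ w v Qv)
      (zero⇒nonessential w Tw z′ u Qu) (zero⇒nonessential w Tw z′ v Qv))
      (trans (m-T-split-in-in w Tw u v Qu Qv) (trans (cong (ℕ._+ m (rest w Tw)) eq) (cong suc (sym (m-T-split w Tw)))))
    where
      z′ : m (Q w) ≡ 0
      z′ = trans (m-mult (Q w)) z

  characterisation : ∀ u v → u ≢ v → D1 F θ joined full u v ≡ true ⇔ Characterisation u v
  characterisation u v u≢v = mk⇔
    (λ t → forward u v u≢v (trans (m′-mult (del (del full u) v)) (trans (≡ᵇ-true (proj₂ (∧-true {not (eqᶠ u v)} t)))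
      (cong suc (trans (sym (m′-mult full)) m′-full)))))
    (λ c → cong₂ _∧_ (cong not (eqᶠ-≢ u≢v)) (≡ᵇ-intro (trans (sym (m′-mult (del (del full u) v)))
      (trans (backward u v u≢v c) (cong suc (trans (sym m′-full) (m′-mult full)))))))

theorem5p11 : (F : RealField) (θ : RealField.R F) (n : ℕ) (adj : Adj n) →
    (∀ u v → adj u v ≡ adj v u) → (∀ u → adj u u ≡ false) →
    (u v : Fin n) → u ≢ v →
    let A = Aθ F θ adj
        N = Nθ F θ adj
        P = Pθ F θ adj
        T = GminusA F θ adj
        Q = component adj T
    in (D1 F θ (Sθ F θ adj) full u v ≡ true)
       ⇔ (((A u ≡ true × N v ≡ true) ⊎ (A v ≡ true × N u ≡ true))
          ⊎ ((((P u ≡ true × N v ≡ true) ⊎ (P v ≡ true × N u ≡ true))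
              × ∃[ w₁ ] ∃[ w₂ ] (T w₁ ≡ true × T w₂ ≡ true
                  × mult F θ adj (Q w₁) ≡ 0 × mult F θ adj (Q w₂) ≡ 0
                  × Q w₁ u ≡ true × Q w₂ v ≡ true
                  × ¬ (∀ x → Q w₁ x ≡ Q w₂ x)))
          ⊎ ∃[ w ] (T w ≡ true × mult F θ adj (Q w) ≡ 0
                    × D1 F θ adj (Q w) u v ≡ true)))
theorem5p11 F θ n adj symmetric irreflexive = MainTheorem.characterisation F θ adj symmetric irreflexive (Aθ F θ adj)
  (Decomposition.special-specialᵇ F θ adj symmetric irreflexive full)
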